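{- Let $n$ be a positive integer coprime with $3$. Then \[ \sum_{k=0}^{n-1} [6k+1]\frac{(q;q^3)_k^6}{(q^3;q^3)_k^6}\, q^{3k} \equiv \begin{cases} 0 \pmod{[n]}, &\text{if } n\equiv 1\pmod 3,\\ 0 \pmod{[n]\Phi_n(q)}, &\text{if } n\equiv 2\pmod 3. \end{cases} \]
   Context: Here $q$ is an indeterminate. For $x$ and a base $p$ (a power of $q$), $(x;p)_k=\prod_{j=0}^{k-1}(1-xp^j)$ for integers $k\ge 0$. The $q$-integer is $[m]=1+q+\cdots+q^{m-1}$, and $\Phi_n(q)$ is the $n$-th cyclotomic polynomial. For rational functions $A(q),B(q)$ and a polynomial $P(q)$, $A(q)\equiv B(q)\pmod{P(q)}$ means that the numerator of the reduced form of $A(q)-B(q)$ is divisible by $P(q)$ in $\mathbb{Z}[q]$. -}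

module Defs where

open import Data.Nat as ℕ using (ℕ; zero; suc; _∸_)
open import Data.Nat.Divisibility using (_∣?_)
open import Data.Integer as ℤ using (ℤ; +_; 0ℤ; 1ℤ)
open import Data.List using (List; []; _∷_; _++_; replicate; reverse; length; foldr; upTo; zip; map; filter)
open import Data.List.Relation.Unary.All using (All)
open import Data.Product using (_×_; _,_; proj₁; proj₂; ∃)
open import Relation.Binary.PropositionalEquality using (_≡_)
open import Relation.Nullary using (¬_; yes; no)

-- Polynomials in ℤ[q]: coefficient lists, lowest degree first.
-- Trailing zeros are allowed; equality is the setoid _≈ₚ_ below.

Poly : Set
Poly = List ℤ

infixl 6 _+ₚ_ _-ₚ_
infixl 7 _*ₚ_

_+ₚ_ : Poly → Poly → Poly
[]      +ₚ q       = q
(a ∷ p) +ₚ []      = a ∷ p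
(a ∷ p) +ₚ (b ∷ q) = (a ℤ.+ b) ∷ (p +ₚ q)

negₚ : Poly → Poly
negₚ = map (λ x → ℤ.- x)

_-ₚ_ : Poly → Poly → Poly
p -ₚ q = p +ₚ negₚ q

scaleₚ : ℤ → Poly → Poly
scaleₚ c = map (c ℤ.*_)

_*ₚ_ : Poly → Poly → Poly
[]      *ₚ q = []
(a ∷ p) *ₚ q = scaleₚ a q +ₚ (0ℤ ∷ (p *ₚ q))

oneₚ : Poly
oneₚ = 1ℤ ∷ []

powₚ : Poly → ℕ → Poly
powₚ p zero    = oneₚ
powₚ p (suc e) = p *ₚ powₚ p e

qpow : ℕ → Poly
qpow m = replicate m 0ℤ ++ (1ℤ ∷ [])

qint : ℕ → Poly
qint m = replicate m 1ℤ

IsZeroₚ : Poly → Set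
IsZeroₚ p = All (_≡ 0ℤ) p

_≈ₚ_ : Poly → Poly → Set
p ≈ₚ q = IsZeroₚ (p -ₚ q)

_∣ₚ_ : Poly → Poly → Set
P ∣ₚ N = ∃ λ U → N ≈ₚ (P *ₚ U)

Coprimeₚ : Poly → Poly → Set
Coprimeₚ N D = ∀ G → G ∣ₚ N → G ∣ₚ D → G ∣ₚ oneₚ

poch : ℕ → ℕ → ℕ → Poly
poch a b zero    = oneₚ
poch a b (suc k) = poch a b k *ₚ (oneₚ -ₚ qpow (a ℕ.+ b ℕ.* k))

-- Cyclotomic polynomials, defined recursively by
--   q^m - 1 = ∏_{d ∣ m} Φ_d(q),
-- i.e. Φ_m = (q^m - 1) / ∏_{d ∣ m, d < m} Φ_d  (exact division by a
-- monic polynomial, computed by long division).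

-- long division of a high-degree-first list by a monic
-- high-degree-first divisor (1 ∷ bs); returns the quotient (high first).
private
  subPrefix : ℤ → List ℤ → List ℤ → List ℤ
  subPrefix c []       as       = as
  subPrefix c (b ∷ bs) []       = []
  subPrefix c (b ∷ bs) (a ∷ as) = (a ℤ.- c ℤ.* b) ∷ subPrefix c bs as

  divHF : ℕ → List ℤ → List ℤ → List ℤ
  divHF zero     as       bs = []
  divHF (suc f)  []       bs = []
  divHF (suc f)  (a ∷ as) bs with length bs ℕ.≤? length as
  ... | yes _ = a ∷ divHF f (subPrefix a bs as) bs
  ... | no  _ = []

  stripHF : List ℤ → List ℤ
  stripHF []       = []
  stripHF (a ∷ as) with a ℤ.≟ 0ℤ
  ... | yes _ = stripHF as
  ... | no  _ = a ∷ as

divMonicₚ : Poly → Poly → Poly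
divMonicₚ p m with stripHF (reverse m)
... | []      = []
... | (_ ∷ bs) = let ps = stripHF (reverse p) in
                 reverse (divHF (length ps) ps bs)

private
  prodₚ : List Poly → Poly
  prodₚ = foldr _*ₚ_ oneₚ

  nextΦ : ℕ → List Poly → Poly
  nextΦ m prev =
    divMonicₚ (qpow m -ₚ oneₚ)
      (prodₚ (map proj₂ (filter (λ dp → proj₁ dp ∣? m)
                                  (zip (map suc (upTo (length prev))) prev))))

  cycs : ℕ → List Poly
  cycs zero    = []
  cycs (suc m) = let prev = cycs m in prev ++ (nextΦ (suc m) prev ∷ [])

Φ : ℕ → Poly
Φ zero    = oneₚ   -- unused junk value
Φ (suc m) = nextΦ (suc m) (cycs m)

Frac : Set
Frac = Poly × Poly

_+F_ : Frac → Frac → Frac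
(a , b) +F (c , d) = (a *ₚ d +ₚ c *ₚ b , b *ₚ d)

_-F_ : Frac → Frac → Frac
(a , b) -F (c , d) = (a *ₚ d -ₚ c *ₚ b , b *ₚ d)

zeroF : Frac
zeroF = ([] , oneₚ)

-- A ≡ B (mod P): the numerator of the reduced form of A - B is
-- divisible by P.  Here (N , D) ranges over all reduced forms of A - B
-- (D ≠ 0, N and D coprime in ℤ[q], N/D = A - B); reduced forms are
-- unique up to units, so this is the paper's notion.
_≡F_mod_ : Frac → Frac → Poly → Set
A ≡F B mod P = let (a , b) = A -F B in
  ∀ N D → ¬ IsZeroₚ D → Coprimeₚ N D → (a *ₚ D) ≈ₚ (N *ₚ b) → P ∣ₚ N

term : ℕ → Frac
term k = ( qint (6 ℕ.* k ℕ.+ 1) *ₚ powₚ (poch 1 3 k) 6 *ₚ qpow (3 ℕ.* k)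
         , powₚ (poch 3 3 k) 6 )

sumTo : ℕ → Frac
sumTo zero    = zeroF
sumTo (suc n) = sumTo n +F term n

S : ℕ → Frac
S n = sumTo n

{-# OPTIONS --safe #-}
-- The summand is the very-well-poised term of Jackson's terminating 8φ7 sum in base q^3 with all
-- parameters equal to q. Replacing two of the parameters by q z and q / z changes the k-th term only by
-- a multiple of (1 - z)^2. For d coprime to 3 take z = q^(3m+1), where 3m + 1 is d or 2d: the deformed
-- sum terminates at k = m, and Jackson's sum evaluates it to (1 - z) (q^2;q^3)_m^3 / (q^3;q^3)_m^3. The
-- factor 1 - z is divisible by Φ_d; for d ≡ 2 (mod 3), also 1 - q^d divides (q^2;q^3)_m, so that
-- the sum over k < d vanishes modulo Φ_d^2. Modulo Φ_d, consecutive blocks of d terms are proportional,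
-- with factors integral at Φ_d; hence Φ_d divides the sum for every d > 1 dividing n, and [n] is the
-- product of these pairwise coprime Φ_d. Instead of irreducibility of Φ_d, only the non-zero-divisors
-- modulo Φ_d are used.
module Submission where

open import Defs
open import Algebra.Bundles using (CommutativeRing)
import Algebra.Properties.Semiring.Exp as Exp
open import Algebra.Structures using (IsCommutativeRing)
open import Data.Integer as ℤ using (ℤ; +_; -[1+_]; 0ℤ; 1ℤ)
import Data.Integer.Properties as ℤ
open import Data.List
  using (List; []; _∷_; _++_; reverse; length; foldr; foldl; map; filter; zip; zipWith; upTo; replicate)
import Data.List.Properties as List
open import Data.List.Relation.Unary.All using (All; []; _∷_)
import Data.List.Relation.Unary.All.Properties as All
open import Data.Maybe.Base using (Maybe; just; nothing)
open import Data.Nat as ℕ using (ℕ; zero; suc; _≤_; _%_)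
open import Data.Nat.Coprimality using (Coprime; coprime-divisor)
import Data.Nat.Divisibility as ℕ
import Data.Nat.DivMod as ℕ
open import Data.Nat.GCD using (gcd; gcd-GCD; gcd[m,n]∣m; gcd[m,n]∣n; module Bézout)
import Data.Nat.Properties as ℕ
open import Data.Nat.Tactic.RingSolver using (solve-∀)
open import Data.Product using (_×_; _,_; proj₁; proj₂; ∃)
open import Data.Sum using (inj₁; inj₂)
open import Level using (_⊔_; 0ℓ) renaming (suc to lsuc)
open import Relation.Nullary using (¬_; Dec; yes; no; contradiction)
import Relation.Binary.PropositionalEquality as ≡
open ≡ using (_≡_)

-- Jackson's sum applies because of the base q^3: with a = q it asks the five free upper parameters,
-- the terminating one included, to multiply to a^2 q^3 = q^5. Five copies of q do so, and the pair
-- q z, q / z leaves the product unchanged. Termination needs q / z = q^(-3m), hence z = q^(3m+1).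
-- This can be q^d for d ≡ 1 (mod 3) only; for d ≡ 2 the least suitable multiple of d is 2d. The
-- difficulty for k ≥ d is that (q^3;q^3)_k is itself divisible by Φ_d, so that no single term is
-- visibly integral. Divisibility is therefore stated in a localization, and the quotient
-- (q;q^3)_(ld) / (q^3;q^3)_(ld) is shown to be integral there block by block. Cancelling 1 - q^d in
-- a block leaves a cofactor that is 3 (l + 1) modulo Φ_d. Positive integers thus have to be
-- non-zero-divisors modulo Φ_d; this comes from its constant term, which is a unit by the
-- factorization of q^d - 1.

-- Polynomial identities with integer coefficients in a commutative ring

module IntegerSolver {c ℓ} (R : CommutativeRing c ℓ) where
  open CommutativeRing R
  open import Algebra.Solver.Ring.AlmostCommutativeRing
  open import Algebra.Properties.Ring ring
  open import Algebra.Properties.AbelianGroup +-abelianGroup using (⁻¹-∙-comm)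
  open import Algebra.Properties.Semiring.Mult.TCOptimised semiring
    using (1+×; ×-homo-+; ×1-homo-*) renaming (_×_ to _·_)
  open import Relation.Binary.Reasoning.Setoid setoid

  nat : ℕ → Carrier
  nat n = n · 1#

  int : ℤ → Carrier
  int (+ n)    = nat n
  int -[1+ n ] = - nat (suc n)

  nat-suc : ∀ n → nat (suc n) ≈ 1# + nat n
  nat-suc n = 1+× n 1#

  private
    int-⊖ : ∀ m n → int (m ℤ.⊖ n) ≈ nat m - nat n
    int-⊖ zero    zero    = sym (-‿inverseʳ 0#)
    int-⊖ zero    (suc n) = sym (+-identityˡ _)
    int-⊖ (suc m) zero    = sym (trans (+-congˡ -0#≈0#) (+-identityʳ _))
    int-⊖ (suc m) (suc n) = begin
      int (suc m ℤ.⊖ suc n)               ≡⟨ ≡.cong int (ℤ.[1+m]⊖[1+n]≡m⊖n m n) ⟩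
      int (m ℤ.⊖ n)                       ≈⟨ int-⊖ m n ⟩
      nat m - nat n                       ≈⟨ +-congʳ (+-identityˡ _) ⟨
      (0# + nat m) - nat n                ≈⟨ +-congʳ (+-congʳ (-‿inverseʳ 1#)) ⟨
      ((1# - 1#) + nat m) - nat n         ≈⟨ +-congʳ (trans (+-assoc _ _ _)
                                               (trans (+-congˡ (+-comm _ _)) (sym (+-assoc _ _ _)))) ⟩
      ((1# + nat m) - 1#) - nat n         ≈⟨ +-assoc _ _ _ ⟩
      (1# + nat m) + (- 1# - nat n)       ≈⟨ +-congˡ (⁻¹-∙-comm _ _) ⟩
      (1# + nat m) - (1# + nat n)         ≈⟨ +-cong (1+× m 1#) (-‿cong (1+× n 1#)) ⟨
      nat (suc m) - nat (suc n)           ∎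

    int-neg : ∀ i → int (ℤ.- i) ≈ - int i
    int-neg (+ zero)  = sym -0#≈0#
    int-neg (+ suc n) = refl
    int-neg -[1+ n ]  = sym (-‿involutive _)

    int-+ : ∀ i j → int (i ℤ.+ j) ≈ int i + int j
    int-+ (+ m)    (+ n)    = ×-homo-+ 1# m n
    int-+ (+ m)    -[1+ n ] = int-⊖ m (suc n)
    int-+ -[1+ m ] (+ n)    = trans (int-⊖ n (suc m)) (+-comm _ _)
    int-+ -[1+ m ] -[1+ n ] = begin
      - nat (suc (suc (m ℕ.+ n)))      ≡⟨ ≡.cong (λ k → - nat (suc k)) (ℕ.+-suc m n) ⟨
      - nat (suc m ℕ.+ suc n)          ≈⟨ -‿cong (×-homo-+ 1# (suc m) (suc n)) ⟩
      - (nat (suc m) + nat (suc n))    ≈⟨ ⁻¹-∙-comm _ _ ⟨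
      - nat (suc m) - nat (suc n)      ∎

    int-pos* : ∀ m j → int (+ m ℤ.* j) ≈ int (+ m) * int j
    int-pos* m (+ n) = trans (reflexive (≡.cong int (≡.sym (ℤ.pos-* m n)))) (×1-homo-* m n)
    int-pos* m -[1+ n ] = begin
      int (+ m ℤ.* -[1+ n ])       ≡⟨ ≡.cong int (ℤ.neg-distribʳ-* (+ m) (+ suc n)) ⟨
      int (ℤ.- (+ m ℤ.* + suc n))  ≈⟨ int-neg (+ m ℤ.* + suc n) ⟩
      - int (+ m ℤ.* + suc n)      ≈⟨ -‿cong (int-pos* m (+ suc n)) ⟩
      - (nat m * nat (suc n))      ≈⟨ -‿distribʳ-* _ _ ⟩
      nat m * - nat (suc n)        ∎

    int-* : ∀ i j → int (i ℤ.* j) ≈ int i * int j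
    int-* (+ m)    j = int-pos* m j
    int-* -[1+ m ] j = begin
      int (-[1+ m ] ℤ.* j)         ≡⟨ ≡.cong int (ℤ.neg-distribˡ-* (+ suc m) j) ⟨
      int (ℤ.- (+ suc m ℤ.* j))    ≈⟨ int-neg (+ suc m ℤ.* j) ⟩
      - int (+ suc m ℤ.* j)        ≈⟨ -‿cong (int-pos* (suc m) j) ⟩
      - (nat (suc m) * int j)      ≈⟨ -‿distribˡ-* _ _ ⟩
      - nat (suc m) * int j        ∎

    homomorphism : ℤ.+-*-rawRing -Raw-AlmostCommutative⟶ fromCommutativeRing R
    homomorphism = record
      { ⟦_⟧    = int
      ; +-homo = int-+
      ; *-homo = int-*
      ; -‿homo = int-neg
      ; 0-homo = refl
      ; 1-homo = refl
      }

    int≟ : ∀ i j → Maybe (int i ≈ int j)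
    int≟ i j with i ℤ.≟ j
    ... | yes i≡j = just (reflexive (≡.cong int i≡j))
    ... | no  _   = nothing

  open import Algebra.Solver.Ring ℤ.+-*-rawRing (fromCommutativeRing R) homomorphism int≟ public
    using (solve; _:=_; _:+_; _:*_; _:-_; :-_; _:^_; con)

-- Finite sums and products

module FiniteSums {c ℓ} (R : CommutativeRing c ℓ) where
  open CommutativeRing R
  open IntegerSolver R
  open Exp semiring using (_^_)

  ∑ : ℕ → (ℕ → Carrier) → Carrier
  ∑ zero    f = 0#
  ∑ (suc n) f = ∑ n f + f n

  ∏ : ℕ → (ℕ → Carrier) → Carrier
  ∏ zero    f = 1#
  ∏ (suc n) f = ∏ n f * f n

  ∑-cong : ∀ n {f g} → (∀ i → i ℕ.< n → f i ≈ g i) → ∑ n f ≈ ∑ n g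
  ∑-cong zero    f≈g = refl
  ∑-cong (suc n) f≈g = +-cong (∑-cong n λ i i<n → f≈g i (ℕ.m<n⇒m<1+n i<n)) (f≈g n ℕ.≤-refl)

  ∏-cong : ∀ n {f g} → (∀ i → i ℕ.< n → f i ≈ g i) → ∏ n f ≈ ∏ n g
  ∏-cong zero    f≈g = refl
  ∏-cong (suc n) f≈g = *-cong (∏-cong n λ i i<n → f≈g i (ℕ.m<n⇒m<1+n i<n)) (f≈g n ℕ.≤-refl)

  ∑-split : ∀ m n f → ∑ (m ℕ.+ n) f ≈ ∑ m f + ∑ n (λ i → f (m ℕ.+ i))
  ∑-split m zero    f rewrite ℕ.+-identityʳ m = sym (+-identityʳ _)
  ∑-split m (suc n) f rewrite ℕ.+-suc m n = trans (+-congʳ (∑-split m n f)) (+-assoc _ _ _)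

  ∏-split : ∀ m n f → ∏ (m ℕ.+ n) f ≈ ∏ m f * ∏ n (λ i → f (m ℕ.+ i))
  ∏-split m zero    f rewrite ℕ.+-identityʳ m = sym (*-identityʳ _)
  ∏-split m (suc n) f rewrite ℕ.+-suc m n = trans (*-congʳ (∏-split m n f)) (*-assoc _ _ _)

  ∑-distribˡ : ∀ c n f → ∑ n (λ i → c * f i) ≈ c * ∑ n f
  ∑-distribˡ c zero    f = sym (zeroʳ c)
  ∑-distribˡ c (suc n) f = trans (+-congʳ (∑-distribˡ c n f)) (sym (distribˡ _ _ _))

  ∑-sub : ∀ n f g → ∑ n f - ∑ n g ≈ ∑ n (λ i → f i - g i)
  ∑-sub zero    f g = -‿inverseʳ 0#
  ∑-sub (suc n) f g = trans
    (solve 4 (λ a b c d → (a :+ b) :- (c :+ d) := (a :- c) :+ (b :- d)) refl _ _ _ _)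
    (+-congʳ (∑-sub n f g))

  ∑-drop-last : ∀ n f → f n ≈ 0# → ∑ (suc n) f ≈ ∑ n f
  ∑-drop-last n f fn≈0 = trans (+-congˡ fn≈0) (+-identityʳ _)

  -- The shape of a Wilf-Zeilberger argument: `h` is the certificate, whose differences are b f - a
  -- g.
  ∑-telescope : ∀ {a b} {f g h : ℕ → Carrier} → h 0 ≈ 0# →
    (∀ k → b * f k + h k ≈ a * g k + h (suc k)) → ∀ k → b * ∑ k f ≈ a * ∑ k g + h k
  ∑-telescope {a} {b} h0≈0 step zero    =
    trans (zeroʳ b) (sym (trans (+-cong (zeroʳ a) h0≈0) (+-identityˡ 0#)))
  ∑-telescope {a} {b} {f} {g} {h} h0≈0 step (suc k) = begin
    b * (∑ k f + f k)                ≈⟨ distribˡ _ _ _ ⟩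
    b * ∑ k f + b * f k              ≈⟨ +-congʳ (∑-telescope {f = f} {g} {h} h0≈0 step k) ⟩
    a * ∑ k g + h k + b * f k        ≈⟨ solve 3 (λ u v w → u :+ v :+ w := u :+ (w :+ v)) refl _ _ _ ⟩
    a * ∑ k g + (b * f k + h k)      ≈⟨ +-congˡ (step k) ⟩
    a * ∑ k g + (a * g k + h (suc k))
      ≈⟨ solve 4 (λ a s t u → a :* s :+ (a :* t :+ u) := a :* (s :+ t) :+ u) refl a _ _ _ ⟩
    a * (∑ k g + g k) + h (suc k)    ∎
    where open import Relation.Binary.Reasoning.Setoid setoid

  ∏-* : ∀ n f g → ∏ n (λ i → f i * g i) ≈ ∏ n f * ∏ n g
  ∏-* zero    f g = sym (*-identityˡ 1#)
  ∏-* (suc n) f g = trans (*-congʳ (∏-* n f g))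
    (solve 4 (λ a b c d → (a :* b) :* (c :* d) := (a :* c) :* (b :* d)) refl _ _ _ _)

  geometric : ∀ x n → (1# - x) * ∑ n (x ^_) ≈ 1# - x ^ n
  geometric x zero    = trans (zeroʳ _) (sym (-‿inverseʳ 1#))
  geometric x (suc n) = trans (distribˡ _ _ _) (trans (+-congʳ (geometric x n))
    (solve 2 (λ x y → (con (+ 1) :- y) :+ (con (+ 1) :- x) :* y := con (+ 1) :- x :* y) refl x (x ^ n)))

-- Divisibility, congruences and non-zero-divisors in a domain

record IntegralDomain c ℓ : Set (lsuc (c ⊔ ℓ)) where
  field
    commutativeRing : CommutativeRing c ℓ
  open CommutativeRing commutativeRing public
  field
    1≉0              : ¬ 1# ≈ 0#
    x*y≈0∧x≉0⇒y≈0 : ∀ {x y} → x * y ≈ 0# → ¬ x ≈ 0# → y ≈ 0#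

module Divisibility {c ℓ} (D : IntegralDomain c ℓ) where
  open IntegralDomain D
  open IntegerSolver commutativeRing
  open FiniteSums commutativeRing
  open Exp semiring using (_^_)
  open import Algebra.Properties.Semiring.Divisibility semiring public
    using (_∣_; _,_; x∣ʳyx; x∣ʳy⇒x∣ʳzy; ∣ʳ-trans; ∣ʳ-respʳ-≈; ∣ʳ-respˡ-≈; ∣ʳ-refl; _∣0)

  quotient : ∀ {x y} → x ∣ y → Carrier
  quotient (u , _) = u

  quotient-* : ∀ {x y} (x∣y : x ∣ y) → quotient x∣y * x ≈ y
  quotient-* (_ , ux≈y) = ux≈y

  *-≉0 : ∀ {x y} → ¬ x ≈ 0# → ¬ y ≈ 0# → ¬ x * y ≈ 0#
  *-≉0 x≉0 y≉0 xy≈0 = y≉0 (x*y≈0∧x≉0⇒y≈0 xy≈0 x≉0)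

  x^n≉0 : ∀ n {x} → ¬ x ≈ 0# → ¬ x ^ n ≈ 0#
  x^n≉0 zero    x≉0 = 1≉0
  x^n≉0 (suc n) x≉0 = *-≉0 x≉0 (x^n≉0 n x≉0)

  ∏-≉0 : ∀ n {f} → (∀ i → i ℕ.< n → ¬ f i ≈ 0#) → ¬ ∏ n f ≈ 0#
  ∏-≉0 zero    f≉0 = 1≉0
  ∏-≉0 (suc n) f≉0 = *-≉0 (∏-≉0 n λ i i<n → f≉0 i (ℕ.m<n⇒m<1+n i<n)) (f≉0 n ℕ.≤-refl)

  x-y≈0⇒x≈y : ∀ {x y} → x - y ≈ 0# → x ≈ y
  x-y≈0⇒x≈y {x} {y} eq = trans (solve 2 (λ x y → x := (x :- y) :+ y) refl x y)
    (trans (+-congʳ eq) (+-identityˡ y))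

  x≈y⇒x-y≈0 : ∀ {x y} → x ≈ y → x - y ≈ 0#
  x≈y⇒x-y≈0 eq = trans (+-congʳ eq) (-‿inverseʳ _)

  *-cancelˡ-≉0 : ∀ {d x y} → ¬ d ≈ 0# → d * x ≈ d * y → x ≈ y
  *-cancelˡ-≉0 {d} {x} {y} d≉0 eq = x-y≈0⇒x≈y (x*y≈0∧x≉0⇒y≈0
    (trans (solve 3 (λ d x y → d :* (x :- y) := d :* x :- d :* y) refl d x y) (x≈y⇒x-y≈0 eq)) d≉0)

  ∣-+ : ∀ {P x y} → P ∣ x → P ∣ y → P ∣ x + y
  ∣-+ (u , e) (v , f) = u + v , trans (distribʳ _ _ _) (+-cong e f)

  ∣-neg : ∀ {P x} → P ∣ x → P ∣ - x
  ∣-neg (u , e) = - u , trans (solve 2 (λ u p → :- u :* p := :- (u :* p)) refl _ _) (-‿cong e)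

  ∣-*ˡ : ∀ {P x} y → P ∣ x → P ∣ y * x
  ∣-*ˡ y = x∣ʳy⇒x∣ʳzy y

  ∣-*ʳ : ∀ {P x} y → P ∣ x → P ∣ x * y
  ∣-*ʳ y P∣x = ∣ʳ-respʳ-≈ (*-comm y _) (∣-*ˡ y P∣x)

  ∣-*-cong : ∀ {P Q x y} → P ∣ x → Q ∣ y → P * Q ∣ x * y
  ∣-*-cong (u , e) (v , f) = u * v ,
    trans (solve 4 (λ u v p q → u :* v :* (p :* q) := (u :* p) :* (v :* q)) refl _ _ _ _) (*-cong e f)

  *-cancelˡ-∣ : ∀ {d P x} → ¬ d ≈ 0# → d * P ∣ d * x → P ∣ x
  *-cancelˡ-∣ {d} {P} d≉0 (u , e) = u ,
    *-cancelˡ-≉0 d≉0 (trans (solve 3 (λ d u p → d :* (u :* p) := u :* (d :* p)) refl d u P) e)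

  module Modulo (Q : Carrier) where

    infix 4 _≋_
    _≋_ : Carrier → Carrier → Set (c ⊔ ℓ)
    x ≋ y = Q ∣ x - y

    ≈⇒≋ : ∀ {x y} → x ≈ y → x ≋ y
    ≈⇒≋ x≈y = ∣ʳ-respʳ-≈ (sym (x≈y⇒x-y≈0 x≈y)) (Q ∣0)

    ≋-refl : ∀ {x} → x ≋ x
    ≋-refl = ≈⇒≋ refl

    ≋-sym : ∀ {x y} → x ≋ y → y ≋ x
    ≋-sym x≋y = ∣ʳ-respʳ-≈ (solve 2 (λ x y → :- (x :- y) := y :- x) refl _ _) (∣-neg x≋y)

    ≋-trans : ∀ {x y z} → x ≋ y → y ≋ z → x ≋ z
    ≋-trans x≋y y≋z =
      ∣ʳ-respʳ-≈ (solve 3 (λ x y z → (x :- y) :+ (y :- z) := x :- z) refl _ _ _) (∣-+ x≋y y≋z)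

    ≋-+ : ∀ {x y u v} → x ≋ y → u ≋ v → x + u ≋ y + v
    ≋-+ x≋y u≋v = ∣ʳ-respʳ-≈
      (solve 4 (λ x y u v → (x :- y) :+ (u :- v) := (x :+ u) :- (y :+ v)) refl _ _ _ _)
      (∣-+ x≋y u≋v)

    ≋-neg : ∀ {x y} → x ≋ y → - x ≋ - y
    ≋-neg x≋y = ∣ʳ-respʳ-≈ (solve 2 (λ x y → :- (x :- y) := :- x :- :- y) refl _ _) (∣-neg x≋y)

    ≋-* : ∀ {x y u v} → x ≋ y → u ≋ v → x * u ≋ y * v
    ≋-* {x} {y} {u} {v} x≋y u≋v = ∣ʳ-respʳ-≈
      (solve 4 (λ x y u v → u :* (x :- y) :+ y :* (u :- v) := x :* u :- y :* v) refl x y u v)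
      (∣-+ (∣-*ˡ u x≋y) (∣-*ˡ y u≋v))

    ≋-∏ : ∀ n {f g} → (∀ i → i ℕ.< n → f i ≋ g i) → ∏ n f ≋ ∏ n g
    ≋-∏ zero    f≋g = ≋-refl
    ≋-∏ (suc n) f≋g = ≋-* (≋-∏ n λ i i<n → f≋g i (ℕ.m<n⇒m<1+n i<n)) (f≋g n ℕ.≤-refl)

    ≋-^ : ∀ n {x y} → x ≋ y → x ^ n ≋ y ^ n
    ≋-^ zero    x≋y = ≋-refl
    ≋-^ (suc n) x≋y = ≋-* x≋y (≋-^ n x≋y)

    1^n≋1 : ∀ n {x} → x ≋ 1# → x ^ n ≋ 1#
    1^n≋1 zero    x≋1 = ≋-refl
    1^n≋1 (suc n) x≋1 = ≋-trans (≋-* x≋1 (1^n≋1 n x≋1)) (≈⇒≋ (*-identityˡ 1#))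

    ∑-powers≋nat : ∀ n {x} → x ≋ 1# → ∑ n (x ^_) ≋ nat n
    ∑-powers≋nat zero    x≋1 = ≋-refl
    ∑-powers≋nat (suc n) x≋1 = ≋-trans (≋-+ (∑-powers≋nat n x≋1) (1^n≋1 n x≋1))
      (≈⇒≋ (trans (+-comm _ _) (sym (nat-suc n))))

    ∣-resp-≋ : ∀ {x y} → x ≋ y → Q ∣ x → Q ∣ y
    ∣-resp-≋ x≋y Q∣x = ∣ʳ-respʳ-≈ (solve 2 (λ x y → x :+ (y :- x) := y) refl _ _)
      (∣-+ Q∣x (≋-sym x≋y))

    -- Stands in for coprimality with `Q`: a domain such as ℤ[q] need not have Bézout identities, so
    -- that coprime elements need not be invertible modulo each other.
    Regular : Carrier → Set (c ⊔ ℓ)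
    Regular v = ∀ {x} → Q ∣ v * x → Q ∣ x

    regular-1 : Regular 1#
    regular-1 = ∣ʳ-respʳ-≈ (*-identityˡ _)

    regular-* : ∀ {v w} → Regular v → Regular w → Regular (v * w)
    regular-* rv rw Q∣ = rw (rv (∣ʳ-respʳ-≈ (*-assoc _ _ _) Q∣))

    regular-∏ : ∀ n {f} → (∀ i → i ℕ.< n → Regular (f i)) → Regular (∏ n f)
    regular-∏ zero    r = regular-1
    regular-∏ (suc n) r = regular-* (regular-∏ n λ i i<n → r i (ℕ.m<n⇒m<1+n i<n)) (r n ℕ.≤-refl)

    regular-resp-≋ : ∀ {v w} → v ≋ w → Regular v → Regular w
    regular-resp-≋ v≋w rv Q∣ = rv (∣-resp-≋ (≋-* (≋-sym v≋w) ≋-refl) Q∣)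

    regular-resp-≈ : ∀ {v w} → v ≈ w → Regular v → Regular w
    regular-resp-≈ v≈w = regular-resp-≋ (≈⇒≋ v≈w)

    regular-factor : ∀ {v w} → v ∣ w → Regular w → Regular v
    regular-factor (u , uv≈w) rw Q∣ =
      rw (∣ʳ-respʳ-≈ (trans (sym (*-assoc _ _ _)) (*-congʳ uv≈w)) (∣-*ˡ u Q∣))

  open Modulo using (Regular)

  -- The two factors of the modulus are removed in turn: `P` divides x = y P, and after cancelling
  -- `P` the other factor divides v y, hence y. The case P = P′ carries regularity over to squares.
  regular-*-modulus : ∀ {P P′ v} → ¬ P ≈ 0# → Regular P v → Regular P′ v → Regular (P * P′) v
  regular-*-modulus {P} {P′} {v} P≉0 r r′ {x} (u , e)
    with y , yP≈x ← r (u * P′ , trans (solve 3 (λ u p p′ → u :* p′ :* p := u :* (p :* p′)) refl u P P′) e)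
    = ∣ʳ-respʳ-≈ (trans (*-comm _ _) yP≈x) (∣-*-cong ∣ʳ-refl (r′ (*-cancelˡ-∣ P≉0 (u ,
        trans e (trans (*-congˡ (sym yP≈x))
        (solve 3 (λ v y p → v :* (y :* p) := p :* (v :* y)) refl v y P))))))

  -- If y P = P′ x, then P′ divides P y, hence y = w P′; cancelling P′ leaves x = w P.
  regular-sym : ∀ {P P′} → ¬ P′ ≈ 0# → Regular P′ P → Regular P P′
  regular-sym {P} {P′} P′≉0 r {x} (y , yP≈P′x)
    with w , wP′≈y ← r {y} (x , trans (*-comm _ _) (trans (sym yP≈P′x) (*-comm _ _)))
    = w , *-cancelˡ-≉0 P′≉0 (trans (solve 3 (λ p w p′ → p′ :* (w :* p) := (w :* p′) :* p) refl P w P′)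
        (trans (*-congʳ wP′≈y) yP≈P′x))

-- Fractions

module FractionField {c ℓ} (D : IntegralDomain c ℓ) where
  open IntegralDomain D
  open IntegerSolver commutativeRing
  open Divisibility D

  record Fraction : Set (c ⊔ ℓ) where
    constructor frac
    field
      num   : Carrier
      den   : Carrier
      den≉0 : ¬ den ≈ 0#
  open Fraction public

  infix 4 _≃_
  record _≃_ (x y : Fraction) : Set ℓ where
    constructor cross
    field crossed : num x * den y ≈ num y * den x
  open _≃_ public

  infixl 6 _+ᶠ_
  infixl 7 _*ᶠ_
  _+ᶠ_ _*ᶠ_ : Fraction → Fraction → Fraction
  frac a b b≉0 +ᶠ frac c d d≉0 = frac (a * d + c * b) (b * d) (*-≉0 b≉0 d≉0)
  frac a b b≉0 *ᶠ frac c d d≉0 = frac (a * c) (b * d) (*-≉0 b≉0 d≉0)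

  -ᶠ_ : Fraction → Fraction
  -ᶠ frac a b b≉0 = frac (- a) b b≉0

  fromCarrier : Carrier → Fraction
  fromCarrier a = frac a 1# 1≉0

  private
    ≃-trans : ∀ {x y z} → x ≃ y → y ≃ z → x ≃ z
    ≃-trans {frac a b _} {frac c d d≉0} {frac e f _} (cross ad≈cb) (cross cf≈ed) =
      cross (*-cancelˡ-≉0 d≉0 (begin
        d * (a * f)  ≈⟨ solve 3 (λ d a f → d :* (a :* f) := a :* d :* f) refl d a f ⟩
        a * d * f    ≈⟨ *-congʳ ad≈cb ⟩
        c * b * f    ≈⟨ solve 3 (λ c b f → c :* b :* f := c :* f :* b) refl c b f ⟩
        c * f * b    ≈⟨ *-congʳ cf≈ed ⟩
        e * d * b    ≈⟨ solve 3 (λ e d b → e :* d :* b := d :* (e :* b)) refl e d b ⟩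
        d * (e * b)  ∎))
      where open import Relation.Binary.Reasoning.Setoid setoid

    +-cong-≃ : ∀ {x y u v} → x ≃ y → u ≃ v → x +ᶠ u ≃ y +ᶠ v
    +-cong-≃ {frac a b _} {frac c d _} {frac a′ b′ _} {frac c′ d′ _} (cross e) (cross e′) =
      cross (begin
        (a * b′ + a′ * b) * (d * d′)
          ≈⟨ solve 6 (λ a b d a′ b′ d′ → (a :* b′ :+ a′ :* b) :* (d :* d′)
               := (a :* d) :* (b′ :* d′) :+ (a′ :* d′) :* (b :* d)) refl a b d a′ b′ d′ ⟩
        (a * d) * (b′ * d′) + (a′ * d′) * (b * d)
          ≈⟨ +-cong (*-congʳ e) (*-congʳ e′) ⟩
        (c * b) * (b′ * d′) + (c′ * b′) * (b * d)
          ≈⟨ solve 6 (λ c b d c′ b′ d′ → (c :* b) :* (b′ :* d′) :+ (c′ :* b′) :* (b :* d)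
               := (c :* d′ :+ c′ :* d) :* (b :* b′)) refl c b d c′ b′ d′ ⟩
        (c * d′ + c′ * d) * (b * b′)  ∎)
      where open import Relation.Binary.Reasoning.Setoid setoid

    *-cong-≃ : ∀ {x y u v} → x ≃ y → u ≃ v → x *ᶠ u ≃ y *ᶠ v
    *-cong-≃ {frac a b _} {frac c d _} {frac a′ b′ _} {frac c′ d′ _} (cross e) (cross e′) =
      cross (begin
        a * a′ * (d * d′)    ≈⟨ interchange a a′ d d′ ⟩
        a * d * (a′ * d′)    ≈⟨ *-cong e e′ ⟩
        c * b * (c′ * b′)    ≈⟨ interchange c b c′ b′ ⟩
        c * c′ * (b * b′)    ∎)
      where
      open import Relation.Binary.Reasoning.Setoid setoid
      open import Algebra.Properties.CommutativeSemigroup *-commutativeSemigroup using (interchange)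

    ≃-isCommutativeRing : IsCommutativeRing _≃_ _+ᶠ_ _*ᶠ_ -ᶠ_ (fromCarrier 0#) (fromCarrier 1#)
    ≃-isCommutativeRing = record
      { isRing = record
        { +-isAbelianGroup = record
          { isGroup = record
            { isMonoid = record
              { isSemigroup = record
                { isMagma = record
                  { isEquivalence = record
                    { refl  = cross refl
                    ; sym   = λ (cross e) → cross (sym e)
                    ; trans = ≃-trans
                    }
                  ; ∙-cong = +-cong-≃
                  }
                ; assoc = λ (frac a b _) (frac c d _) (frac e f _) → cross
                    (solve 6 (λ a b c d e f →
                      ((a :* d :+ c :* b) :* f :+ e :* (b :* d)) :* (b :* (d :* f))
                        := (a :* (d :* f) :+ (c :* f :+ e :* d) :* b) :* (b :* d :* f)) refl a b c d e f)
                }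
              ; identity =
                  (λ (frac a b _) → cross
                    (solve 2 (λ a b → (con (+ 0) :* b :+ a :* con (+ 1)) :* b
                      := a :* (con (+ 1) :* b)) refl a b))
                , (λ (frac a b _) → cross
                    (solve 2 (λ a b → (a :* con (+ 1) :+ con (+ 0) :* b) :* b
                      := a :* (b :* con (+ 1))) refl a b))
              }
            ; inverse =
                (λ (frac a b _) → cross
                  (solve 2 (λ a b → (:- a :* b :+ a :* b) :* con (+ 1) := con (+ 0) :* (b :* b)) refl a b))
              , (λ (frac a b _) → cross
                  (solve 2 (λ a b → (a :* b :+ :- a :* b) :* con (+ 1) := con (+ 0) :* (b :* b)) refl a b))
            ; ⁻¹-cong = λ { {frac a b _} {frac c d _} (cross e) → cross
                (trans (solve 2 (λ a d → :- a :* d := :- (a :* d)) refl a d)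
                (trans (-‿cong e) (solve 2 (λ c b → :- (c :* b) := :- c :* b) refl c b))) }
            }
          ; comm = λ (frac a b _) (frac c d _) → cross
              (solve 4 (λ a b c d → (a :* d :+ c :* b) :* (d :* b) := (c :* b :+ a :* d) :* (b :* d))
                refl a b c d)
          }
        ; *-cong = *-cong-≃
        ; *-assoc = λ (frac a b _) (frac c d _) (frac e f _) → cross
            (solve 6 (λ a b c d e f → a :* c :* e :* (b :* (d :* f)) := a :* (c :* e) :* (b :* d :* f))
              refl a b c d e f)
        ; *-identity =
            (λ (frac a b _) → cross
              (solve 2 (λ a b → con (+ 1) :* a :* b := a :* (con (+ 1) :* b)) refl a b))
          , (λ (frac a b _) → cross
              (solve 2 (λ a b → a :* con (+ 1) :* b := a :* (b :* con (+ 1))) refl a b))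
        ; distrib =
            (λ (frac a b _) (frac c d _) (frac e f _) → cross
              (solve 6 (λ a b c d e f → a :* (c :* f :+ e :* d) :* (b :* d :* (b :* f))
                := (a :* c :* (b :* f) :+ a :* e :* (b :* d)) :* (b :* (d :* f))) refl a b c d e f))
          , (λ (frac a b _) (frac c d _) (frac e f _) → cross
              (solve 6 (λ a b c d e f → (c :* f :+ e :* d) :* a :* (d :* b :* (f :* b))
                := (c :* a :* (f :* b) :+ e :* a :* (d :* b)) :* (d :* f :* b)) refl a b c d e f))
        }
      ; *-comm = λ (frac a b _) (frac c d _) → cross
          (solve 4 (λ a b c d → a :* c :* (d :* b) := c :* a :* (b :* d)) refl a b c d)
      }

  fractionField : CommutativeRing (c ⊔ ℓ) ℓ
  fractionField = record { isCommutativeRing = ≃-isCommutativeRing }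

-- Divisibility and integrality of fractions in a localization

module FractionDivisibility {c ℓ} (D : IntegralDomain c ℓ) where
  open IntegralDomain D
  open IntegerSolver commutativeRing
  open Divisibility D
  open Modulo using (Regular; regular-1; regular-*; regular-resp-≋)
  open FractionField D
  open FiniteSums fractionField
  private module K = CommutativeRing fractionField
  open Exp K.semiring using () renaming (_^_ to _^ᶠ_)

  -- Q divides x in the localization at the non-zero-divisors modulo Q.
  infix 4 _∣ᶠ_
  record _∣ᶠ_ (Q : Carrier) (x : Fraction) : Set (c ⊔ ℓ) where
    constructor divisible
    field
      rep         : Fraction
      x≃rep       : x ≃ rep
      Q∣num       : Q ∣ num rep
      regular-den : Regular Q (den rep)

  record IntegralAt (Q : Carrier) (x : Fraction) : Set (c ⊔ ℓ) where
    constructor integral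
    field
      rep         : Fraction
      x≃rep       : x ≃ rep
      regular-den : Regular Q (den rep)

  ∣ᶠ-resp-≃ : ∀ {Q x y} → x ≃ y → Q ∣ᶠ x → Q ∣ᶠ y
  ∣ᶠ-resp-≃ x≃y (divisible r x≃r Q∣ reg) = divisible r (K.trans (K.sym x≃y) x≃r) Q∣ reg

  ∣ᶠ-0 : ∀ {Q} → Q ∣ᶠ fromCarrier 0#
  ∣ᶠ-0 {Q} = divisible (fromCarrier 0#) K.refl (Q ∣0) (regular-1 Q)

  ∣ᶠ-+ : ∀ {Q x y} → Q ∣ᶠ x → Q ∣ᶠ y → Q ∣ᶠ x +ᶠ y
  ∣ᶠ-+ {Q} (divisible (frac a b b≉0) x≃ Q∣a reg-b) (divisible (frac c d d≉0) y≃ Q∣c reg-d) =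
    divisible (frac a b b≉0 +ᶠ frac c d d≉0) (K.+-cong x≃ y≃)
      (∣-+ (∣-*ʳ d Q∣a) (∣-*ʳ b Q∣c)) (regular-* Q reg-b reg-d)

  ∣ᶠ-* : ∀ {Q x y} → IntegralAt Q x → Q ∣ᶠ y → Q ∣ᶠ x *ᶠ y
  ∣ᶠ-* {Q} (integral (frac a b b≉0) x≃ reg-b) (divisible (frac c d d≉0) y≃ Q∣c reg-d) =
    divisible (frac a b b≉0 *ᶠ frac c d d≉0) (K.*-cong x≃ y≃)
      (∣-*ˡ a Q∣c) (regular-* Q reg-b reg-d)

  integral-* : ∀ {Q x y} → IntegralAt Q x → IntegralAt Q y → IntegralAt Q (x *ᶠ y)
  integral-* {Q} (integral (frac a b b≉0) x≃ reg-b) (integral (frac c d d≉0) y≃ reg-d) =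
    integral (frac a b b≉0 *ᶠ frac c d d≉0) (K.*-cong x≃ y≃) (regular-* Q reg-b reg-d)

  integral-1 : ∀ {Q} → IntegralAt Q (fromCarrier 1#)
  integral-1 {Q} = integral (fromCarrier 1#) K.refl (regular-1 Q)

  integral-^ : ∀ {Q x} → IntegralAt Q x → ∀ n → IntegralAt Q (x ^ᶠ n)
  integral-^ i zero    = integral-1
  integral-^ i (suc n) = integral-* i (integral-^ i n)

  integral-resp-≃ : ∀ {Q x y} → x ≃ y → IntegralAt Q x → IntegralAt Q y
  integral-resp-≃ x≃y (integral r x≃r reg) = integral r (K.trans (K.sym x≃y) x≃r) reg

  ∣ᶠ-∑ : ∀ {Q} n {f} → (∀ i → i ℕ.< n → Q ∣ᶠ f i) → Q ∣ᶠ ∑ n f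
  ∣ᶠ-∑ zero    Q∣f = ∣ᶠ-0
  ∣ᶠ-∑ (suc n) Q∣f = ∣ᶠ-+ (∣ᶠ-∑ n λ i i<n → Q∣f i (ℕ.m<n⇒m<1+n i<n)) (Q∣f n ℕ.≤-refl)

  ∣ᶠ-∑-congruent : ∀ {Q} n {f g} → (∀ i → i ℕ.< n → Q ∣ᶠ f i +ᶠ -ᶠ g i) → Q ∣ᶠ ∑ n g → Q ∣ᶠ ∑ n f
  ∣ᶠ-∑-congruent {Q} n {f} {g} f≋g Q∣g = ∣ᶠ-resp-≃
    (K.trans (K.+-congʳ {∑ n g} (K.sym (∑-sub n f g)))
      (K.trans (K.+-assoc (∑ n f) (-ᶠ ∑ n g) (∑ n g))
        (K.trans (K.+-congˡ {∑ n f} (K.-‿inverseˡ (∑ n g))) (K.+-identityʳ (∑ n f)))))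
    (∣ᶠ-+ (∣ᶠ-∑ n f≋g) Q∣g)

  module _ {Q : Carrier} where
    open Modulo Q using (_≋_; ≋-*; ≋-sym)

    ∣ᶠ-congruent : ∀ {u v u′ v′ v≉0 v′≉0} → u ≋ u′ → v ≋ v′ → Regular Q v →
      Q ∣ᶠ frac u v v≉0 +ᶠ -ᶠ frac u′ v′ v′≉0
    ∣ᶠ-congruent {u} {v} {u′} {v′} {v≉0} {v′≉0} u≋u′ v≋v′ reg-v =
      divisible (frac u v v≉0 +ᶠ -ᶠ frac u′ v′ v′≉0) K.refl
        (∣ʳ-respʳ-≈ (solve 4 (λ u v u′ v′ → u :* v′ :- u′ :* v := u :* v′ :+ :- u′ :* v) refl u v u′ v′)
          (≋-* u≋u′ (≋-sym v≋v′)))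
        (regular-* Q reg-v (regular-resp-≋ Q v≋v′ reg-v))

  -- A regular `c` may join the denominator of the representative.
  ∣ᶠ-cancel-regular : ∀ {Q c x} → ¬ c ≈ 0# → Regular Q c → Q ∣ᶠ fromCarrier c *ᶠ x → Q ∣ᶠ x
  ∣ᶠ-cancel-regular {Q} {c} {frac m d _} c≉0 reg-c (divisible (frac n e e≉0) (cross eq) Q∣n reg-e) =
    divisible (frac n (c * e) (*-≉0 c≉0 e≉0))
      (cross (trans (solve 4 (λ c m d e → m :* (c :* e) := c :* m :* e) refl c m d e)
        (trans eq (solve 2 (λ n d → n :* (con (+ 1) :* d) := n :* d) refl n d))))
      Q∣n (regular-* Q reg-c reg-e)

  -- The denominator must stay regular for the smaller modulus: if P divides v x, then P P′ divides
  -- v (P′ x), hence P′ x, and P′ cancels.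
  ∣ᶠ-drop-factor : ∀ {P P′ x} → ¬ P′ ≈ 0# → P * P′ ∣ᶠ x → P ∣ᶠ x
  ∣ᶠ-drop-factor {P} {P′} P′≉0 (divisible r x≃r PP′∣ reg) = divisible r x≃r
    (∣ʳ-trans (P′ , *-comm P′ P) PP′∣)
    (λ {x} P∣vx → *-cancelˡ-∣ P′≉0 (∣ʳ-respˡ-≈ (*-comm P P′) (reg
      (∣ʳ-respˡ-≈ (*-comm P′ P) (∣ʳ-respʳ-≈
        (solve 3 (λ p v x → p :* (v :* x) := v :* (p :* x)) refl P′ (den r) x)
        (∣-*-cong (∣ʳ-refl {P′}) P∣vx))))))

  -- The way back to polynomials: with c / d the representative of x, the hypothesis gives d N = c
  -- M, a multiple of P, and the regular d cancels.
  ∣ᶠ⇒∣ : ∀ {P x N M} → P ∣ᶠ x → num x * M ≈ N * den x → P ∣ N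
  ∣ᶠ⇒∣ {P} {frac a b b≉0} {N} {M} (divisible (frac c d _) (cross eq) P∣c reg-d) aM≈Nb =
    reg-d (∣ʳ-respʳ-≈ (*-cancelˡ-≉0 b≉0 (begin
      b * (c * M)  ≈⟨ solve 3 (λ b c m → b :* (c :* m) := c :* b :* m) refl b c M ⟩
      c * b * M    ≈⟨ *-congʳ eq ⟨
      a * d * M    ≈⟨ solve 3 (λ a d m → a :* d :* m := a :* m :* d) refl a d M ⟩
      a * M * d    ≈⟨ *-congʳ aM≈Nb ⟩
      N * b * d    ≈⟨ solve 3 (λ n b d → n :* b :* d := b :* (d :* n)) refl N b d ⟩
      b * (d * N)  ∎)) (∣-*ʳ M P∣c))
    where open import Relation.Binary.Reasoning.Setoid setoid

-- Jackson's sum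

-- Since q is neither zero nor a root of unity, no denominator of the hypergeometric terms vanishes.
record Indeterminate {c ℓ} (D : IntegralDomain c ℓ) : Set (c ⊔ ℓ) where
  open IntegralDomain D
  open Exp semiring using (_^_)
  field
    q         : Carrier
    q≉0       : ¬ q ≈ 0#
    1-q^1+k≉0 : ∀ k → ¬ 1# - q ^ suc k ≈ 0#

module JacksonSum {c ℓ} (D : IntegralDomain c ℓ) (I : Indeterminate D) where
  open IntegralDomain D
  open Indeterminate I
  open IntegerSolver commutativeRing
  open FiniteSums commutativeRing using (∏; ∏-cong)
  open Divisibility D
  open FractionField D
  open FiniteSums fractionField using (∑-telescope; ∑-drop-last) renaming (∑ to ∑ᶠ)
  module K = CommutativeRing fractionField
  open Exp semiring public using (_^_; ^-congʳ; ^-congˡ; ^-homo-*; ^-assocʳ)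

  p : Carrier
  p = q ^ 3

  pochhammer : Carrier → ℕ → Carrier
  pochhammer a k = ∏ k (λ i → 1# - a * p ^ i)

  U V Z : ℕ → Carrier
  U = pochhammer q
  V = pochhammer p
  Z = pochhammer (q ^ 2)

  -- With z = q p^N, `C` and `E` are (q z; p)_k and (p z; p)_k, whereas `A` and `B` are (q / z; p)_k
  -- and (p / z; p)_k multiplied by p^(N k). This clears negative powers of p and cancels in `T`.
  A B C E : ℕ → ℕ → Carrier
  A N k = ∏ k (λ i → p ^ N - p ^ i)
  B N k = ∏ k (λ i → p ^ N - q ^ 2 * p ^ i)
  C N   = pochhammer (q ^ 2 * p ^ N)
  E N   = pochhammer (q ^ 4 * p ^ N)

  ^-≉0 : ∀ k → ¬ q ^ k ≈ 0#
  ^-≉0 k = x^n≉0 k q≉0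

  p^≈q^ : ∀ i → p ^ i ≈ q ^ (3 ℕ.* i)
  p^≈q^ = ^-assocʳ q 3

  q^*p^ : ∀ a i → q ^ a * p ^ i ≈ q ^ (a ℕ.+ 3 ℕ.* i)
  q^*p^ a i = trans (*-congˡ (p^≈q^ i)) (sym (^-homo-* q a (3 ℕ.* i)))

  p^-≉0 : ∀ k → ¬ p ^ k ≈ 0#
  p^-≉0 k eq = ^-≉0 (3 ℕ.* k) (trans (sym (p^≈q^ k)) eq)

  ≉-resp : ∀ {x y} → x ≈ y → ¬ x ≈ 0# → ¬ y ≈ 0#
  ≉-resp x≈y x≉0 y≈0 = x≉0 (trans x≈y y≈0)

  1-q^*p^≉0 : ∀ a i → ¬ 1# - q ^ suc a * p ^ i ≈ 0#
  1-q^*p^≉0 a i = ≉-resp (+-congˡ (-‿cong (sym (q^*p^ (suc a) i)))) (1-q^1+k≉0 (a ℕ.+ 3 ℕ.* i))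

  -‿≉0 : ∀ {x} → ¬ x ≈ 0# → ¬ - x ≈ 0#
  -‿≉0 x≉0 -x≈0 = x≉0 (trans (solve 1 (λ x → x := :- :- x) refl _)
    (trans (-‿cong -x≈0) (solve 0 (:- con (+ 0) := con (+ 0)) refl)))

  V≉0 : ∀ k → ¬ V k ≈ 0#
  V≉0 k = ∏-≉0 k λ i _ → 1-q^*p^≉0 2 i

  E≉0 : ∀ N k → ¬ E N k ≈ 0#
  E≉0 N k = ∏-≉0 k λ i _ → ≉-resp
    (+-congˡ (-‿cong (trans (*-congˡ (^-homo-* p N i)) (sym (*-assoc _ _ _)))))
    (1-q^*p^≉0 3 (N ℕ.+ i))

  -- The exponents 3 N and 3 i + 2 differ modulo 3. Taking out the smaller power leaves a factor 1 -
  -- q^j with j > 0, where j is 3 (i - N) + 2 or 3 (N - i) - 2.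
  B-factor≉0 : ∀ N i → ¬ p ^ N - q ^ 2 * p ^ i ≈ 0#
  B-factor≉0 N i with ℕ.≤-<-connex N i
  ... | inj₁ N≤i = ≉-resp
    (begin
      p ^ N * (1# - q ^ 2 * p ^ (i ℕ.∸ N))
        ≈⟨ solve 3 (λ s q r → s :* (con (+ 1) :- q :^ 2 :* r) := s :- q :^ 2 :* (s :* r)) refl _ q _ ⟩
      p ^ N - q ^ 2 * (p ^ N * p ^ (i ℕ.∸ N))
        ≈⟨ +-congˡ (-‿cong (*-congˡ (^-homo-* p N _))) ⟨
      p ^ N - q ^ 2 * p ^ (N ℕ.+ (i ℕ.∸ N))
        ≡⟨ ≡.cong (λ k → p ^ N - q ^ 2 * p ^ k) (ℕ.m+[n∸m]≡n N≤i) ⟩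
      p ^ N - q ^ 2 * p ^ i ∎)
    (*-≉0 (p^-≉0 N) (1-q^*p^≉0 1 (i ℕ.∸ N)))
    where open import Relation.Binary.Reasoning.Setoid setoid
  ... | inj₂ i<N = ≉-resp
    (begin
      p ^ i * (q ^ 2 * - (1# - q ^ 1 * p ^ d))
        ≈⟨ solve 3 (λ s q r → s :* (q :^ 2 :* :- (con (+ 1) :- q :^ 1 :* r))
             := s :* (q :^ 3 :* r) :- q :^ 2 :* s) refl _ q _ ⟩
      p ^ i * p ^ suc d - q ^ 2 * p ^ i
        ≈⟨ +-congʳ (^-homo-* p i (suc d)) ⟨
      p ^ (i ℕ.+ suc d) - q ^ 2 * p ^ i
        ≡⟨ ≡.cong (λ k → p ^ k - q ^ 2 * p ^ i) (≡.trans (ℕ.+-suc i d) (ℕ.m+[n∸m]≡n i<N)) ⟩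
      p ^ N - q ^ 2 * p ^ i ∎)
    (*-≉0 (p^-≉0 i) (*-≉0 (^-≉0 2) (-‿≉0 (1-q^*p^≉0 0 d))))
    where
    open import Relation.Binary.Reasoning.Setoid setoid
    d : ℕ
    d = N ℕ.∸ suc i

  B≉0 : ∀ N k → ¬ B N k ≈ 0#
  B≉0 N k = ∏-≉0 k λ i _ → B-factor≉0 N i

  -- 1 - q times the k-th term of Jackson's sum in base p with a = q and upper parameters q, q, q, q
  -- z, p^(-N), where z = q p^N. The factor `A` terminates it at k = N.
  T : ℕ → ℕ → Fraction
  T N k = frac
    ((1# - q * p ^ k * p ^ k) * p ^ k * (U k ^ 4 * C N k * A N k))
    (V k ^ 4 * E N k * B N k)
    (*-≉0 (*-≉0 (x^n≉0 4 (V≉0 k)) (E≉0 N k)) (B≉0 N k))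

  -- The WZ certificate of Jackson's sum.
  H : ℕ → ℕ → Fraction
  H N zero    = fromCarrier 0#
  H N (suc k) = frac
    (- (q * p ^ N * (1# - q ^ 5 * p ^ N * p ^ N)) * (U (suc k) ^ 4 * C (suc N) k * A N k))
    (V k ^ 4 * E (suc N) k * B N k)
    (*-≉0 (*-≉0 (x^n≉0 4 (V≉0 k)) (E≉0 (suc N) k)) (B≉0 N k))

  -- a N / b N is the ratio of `closedForm` at N + 1 and at N, because q p^(N+1) = q^4 p^N.
  a b : ℕ → Carrier
  a N = (1# - q ^ 4 * p ^ N) * (1# - q ^ 2 * p ^ N) ^ 3
  b N = (1# - p * p ^ N) ^ 3 * (1# - q * p ^ N)

  private
    pochhammer-shift : ∀ a k → pochhammer a (suc k) ≈ (1# - a) * pochhammer (a * p) k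
    pochhammer-shift a zero    = solve 1 (λ a → con (+ 1) :* (con (+ 1) :- a :* con (+ 1))
      := (con (+ 1) :- a) :* con (+ 1)) refl a
    pochhammer-shift a (suc k) = trans (*-congʳ (pochhammer-shift a k))
      (solve 4 (λ a p s r → (con (+ 1) :- a) :* r :* (con (+ 1) :- a :* (p :* s))
        := (con (+ 1) :- a) :* (r :* (con (+ 1) :- a :* p :* s))) refl a p (p ^ k) (pochhammer (a * p) k))

    pochhammer-cong : ∀ {a b} k → a ≈ b → pochhammer a k ≈ pochhammer b k
    pochhammer-cong k a≈b = ∏-cong k λ i _ → +-congˡ (-‿cong (*-congʳ a≈b))

    q^*p^-suc : ∀ a N → q ^ a * p ^ N * p ≈ q ^ a * p ^ suc N
    q^*p^-suc a N = solve 3 (λ u x p → u :* x :* p := u :* (p :* x)) refl _ _ p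

    C-suc : ∀ N k → C N (suc k) ≈ (1# - q ^ 2 * p ^ N) * C (suc N) k
    C-suc N k = trans (pochhammer-shift _ k) (*-congˡ (pochhammer-cong k (q^*p^-suc 2 N)))

    E-suc : ∀ N k → E N (suc k) ≈ (1# - q ^ 4 * p ^ N) * E (suc N) k
    E-suc N k = trans (pochhammer-shift _ k) (*-congˡ (pochhammer-cong k (q^*p^-suc 4 N)))

    -- The factor at i = 0 is split off; each of the k others is p times a factor of the product for
    -- N.
    shifted-∏ : ∀ r N k → ∏ (suc k) (λ i → p ^ suc N - r * p ^ i)
                          ≈ (p * p ^ N - r) * p ^ k * ∏ k (λ i → p ^ N - r * p ^ i)
    shifted-∏ r N zero    = solve 3 (λ x r p → con (+ 1) :* (p :* x :- r :* con (+ 1))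
      := (p :* x :- r) :* con (+ 1) :* con (+ 1)) refl (p ^ N) r p
    shifted-∏ r N (suc k) = trans (*-congʳ (shifted-∏ r N k))
      (solve 5 (λ x r p s w → (p :* x :- r) :* s :* w :* (p :* x :- r :* (p :* s))
        := (p :* x :- r) :* (p :* s) :* (w :* (x :- r :* s))) refl (p ^ N) r p (p ^ k) _)

    B-suc : ∀ N k → B (suc N) (suc k) ≈ (p * p ^ N - q ^ 2) * p ^ k * B N k
    B-suc = shifted-∏ (q ^ 2)

    A-suc : ∀ N k → A (suc N) (suc k) ≈ (p * p ^ N - 1#) * p ^ k * A N k
    A-suc N k = trans (∏-cong (suc k) λ i _ → +-congˡ (-‿cong (sym (*-identityˡ _))))
      (trans (shifted-∏ 1# N k) (*-congˡ (∏-cong k λ i _ → +-congˡ (-‿cong (*-identityˡ _)))))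

    A-vanishes : ∀ N → A N (suc N) ≈ 0#
    A-vanishes N = trans (*-congˡ (-‿inverseʳ _)) (zeroʳ _)

    frac≃0 : ∀ {x} → num x ≈ 0# → x ≃ fromCarrier 0#
    frac≃0 n≈0 = cross (trans (*-congʳ n≈0) (solve 1 (λ d → con (+ 0) :* con (+ 1) := con (+ 0) :* d) refl _))

    frac-+ : ∀ {m n d} {d≉0 : ¬ d ≈ 0#} → frac m d d≉0 +ᶠ frac n d d≉0 ≃ frac (m + n) d d≉0
    frac-+ = cross (solve 3 (λ m n d → (m :* d :+ n :* d) :* d := (m :+ n) :* (d :* d)) refl _ _ _)

    frac-cong : ∀ {m n d} {d≉0 : ¬ d ≈ 0#} → m ≈ n → frac m d d≉0 ≃ frac n d d≉0
    frac-cong m≈n = cross (*-congʳ m≈n)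

    -- What is left of the recurrence for k > 0 once common factors are removed, with x = p^N, s =
    -- p^(k-1) and y = p^k. It holds with q, x and s independent, so that expansion proves it.
    wz-identity : ∀ q x s → let p = q ^ 3; y = p * s; κ = - (q * x * (1# - q ^ 5 * x * x)) in
      (1# - p * x) ^ 4 * ((1# - q * y * y) * y) * (1# - q ^ 2 * x * y) * (x - q ^ 2 * s)
        + κ * (1# - y) ^ 4 * q ^ 2 * (1# - q ^ 4 * x * y) * (x - q ^ 2 * s)
      ≈ (1# - q ^ 2 * x) ^ 4 * ((1# - q * y * y) * y) * (x - s) * q ^ 2 * (1# - q ^ 4 * x * y)
        + κ * (1# - q * y) ^ 4 * (1# - q ^ 2 * x * y) * (x - s) * q ^ 2
    wz-identity = solve 3 (λ q x s →
      let p = q :^ 3; y = p :* s; o = con (+ 1); κ = :- (q :* x :* (o :- q :^ 5 :* x :* x)) in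
      (o :- p :* x) :^ 4 :* ((o :- q :* y :* y) :* y) :* (o :- q :^ 2 :* x :* y) :* (x :- q :^ 2 :* s)
        :+ κ :* (o :- y) :^ 4 :* q :^ 2 :* (o :- q :^ 4 :* x :* y) :* (x :- q :^ 2 :* s)
      := (o :- q :^ 2 :* x) :^ 4 :* ((o :- q :* y :* y) :* y) :* (x :- s) :* q :^ 2 :* (o :- q :^ 4 :* x :* y)
        :+ κ :* (o :- q :* y) :^ 4 :* (o :- q :^ 2 :* x :* y) :* (x :- s) :* q :^ 2) refl

    module Step (N j : ℕ) where
      x s y c₀ c₁ e₀ e₁ b₀ w M κ Δ : Carrier
      x  = p ^ N
      s  = p ^ j
      y  = p * s
      c₀ = 1# - q ^ 2 * x
      c₁ = 1# - q ^ 2 * x * y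
      e₀ = 1# - q ^ 4 * x
      e₁ = 1# - q ^ 4 * x * y
      b₀ = x - q ^ 2 * s
      w  = (1# - q * y * y) * y
      M  = U (suc j) ^ 4 * C (suc N) j * A N j
      κ  = - (q * x * (1# - q ^ 5 * x * x))
      Δ  = V (suc j) ^ 4 * E (suc N) j * B N j * (q ^ 2 * e₁ * b₀)

      Δ≉0 : ¬ Δ ≈ 0#
      Δ≉0 = *-≉0 (*-≉0 (*-≉0 (x^n≉0 4 (V≉0 (suc j))) (E≉0 (suc N) j)) (B≉0 N j))
        (*-≉0 (*-≉0 (^-≉0 2)
          (≉-resp (+-congˡ (-‿cong (trans (*-congˡ (^-homo-* p N (suc j))) (sym (*-assoc _ _ _)))))
            (1-q^*p^≉0 3 (N ℕ.+ suc j))))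
          (B-factor≉0 N j))

      -- Puts the four terms of the recurrence over one denominator and takes out the common
      -- numerator `M`; the remaining numerators are the summands of `wz-identity`.
      over : Carrier → Fraction
      over n = frac (n * M) Δ Δ≉0

      C′-suc : C (suc N) (suc j) ≈ C (suc N) j * c₁
      C′-suc = *-congˡ (+-congˡ (-‿cong
        (solve 4 (λ u x p s → u :* (p :* x) :* s := u :* x :* (p :* s)) refl _ x p s)))

      E′-suc : E (suc N) (suc j) ≈ E (suc N) j * e₁
      E′-suc = *-congˡ (+-congˡ (-‿cong
        (solve 4 (λ u x p s → u :* (p :* x) :* s := u :* x :* (p :* s)) refl _ x p s)))

      open import Relation.Binary.Reasoning.Setoid setoid

      -- Passing from N to N + 1 in A / B contributes (1 - p x) / (q^2 (1 - q x)), as p = q^2 q.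
      -- This cancels the factor 1 - q x of `b N`, completes the fourth power of 1 - p x, and
      -- accounts for q^2 in `Δ`.
      bT-over : fromCarrier (b N) *ᶠ T (suc N) (suc j) ≃ over ((1# - p * x) ^ 4 * w * c₁ * b₀)
      bT-over = cross (begin
        b N * (w * (U (suc j) ^ 4 * C (suc N) (suc j) * A (suc N) (suc j))) * Δ
          ≈⟨ *-congʳ (*-congˡ (*-congˡ (*-cong (*-congˡ C′-suc) (A-suc N j)))) ⟩
        b N * (w * (U (suc j) ^ 4 * (C (suc N) j * c₁) * ((p * x - 1#) * s * A N j))) * Δ
          ≈⟨ solve 13 (λ q x s w u c c₁ α v e e₁ β b₀ →
               (con (+ 1) :- q :^ 3 :* x) :^ 3 :* (con (+ 1) :- q :* x) :*
                 (w :* (u :* (c :* c₁) :* ((q :^ 3 :* x :- con (+ 1)) :* s :* α)))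
                 :* (v :* e :* β :* (q :^ 2 :* e₁ :* b₀))
             := (con (+ 1) :- q :^ 3 :* x) :^ 4 :* w :* c₁ :* b₀ :* (u :* c :* α)
                 :* (con (+ 1) :* (v :* (e :* e₁) :* ((q :^ 3 :* x :- q :^ 2) :* s :* β))))
               refl q x s w (U (suc j) ^ 4) (C (suc N) j) c₁ (A N j) (V (suc j) ^ 4)
               (E (suc N) j) e₁ (B N j) b₀ ⟩
        (1# - p * x) ^ 4 * w * c₁ * b₀ * M
          * (1# * (V (suc j) ^ 4 * (E (suc N) j * e₁) * ((p * x - q ^ 2) * s * B N j)))
          ≈⟨ *-congˡ (*-congˡ (*-cong (*-congˡ E′-suc) (B-suc N j))) ⟨
        (1# - p * x) ^ 4 * w * c₁ * b₀ * M
          * (1# * (V (suc j) ^ 4 * E (suc N) (suc j) * B (suc N) (suc j))) ∎)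

      aT-over : fromCarrier (a N) *ᶠ T N (suc j) ≃ over (c₀ ^ 4 * w * (x - s) * q ^ 2 * e₁)
      aT-over = cross (begin
        a N * (w * (U (suc j) ^ 4 * C N (suc j) * A N (suc j))) * Δ
          ≈⟨ *-congʳ (*-congˡ (*-congˡ (*-congʳ (*-congˡ (C-suc N j))))) ⟩
        a N * (w * (U (suc j) ^ 4 * (c₀ * C (suc N) j) * A N (suc j))) * Δ
          ≈⟨ solve 14 (λ q c₀ e₀ a₀ w u c e₁ α v e b₀ β one →
               e₀ :* c₀ :^ 3 :* (w :* (u :* (c₀ :* c) :* (α :* a₀)))
                 :* (v :* e :* β :* (q :^ 2 :* e₁ :* b₀))
             := c₀ :^ 4 :* w :* a₀ :* q :^ 2 :* e₁ :* (u :* c :* α)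
                 :* (con (+ 1) :* (v :* (e₀ :* e) :* (β :* b₀))))
               refl q c₀ e₀ (x - s) w (U (suc j) ^ 4) (C (suc N) j) e₁ (A N j) (V (suc j) ^ 4)
               (E (suc N) j) b₀ (B N j) 1# ⟩
        c₀ ^ 4 * w * (x - s) * q ^ 2 * e₁ * M
          * (1# * (V (suc j) ^ 4 * (e₀ * E (suc N) j) * B N (suc j)))
          ≈⟨ *-congˡ (*-congˡ (*-congʳ (*-congˡ (E-suc N j)))) ⟨
        c₀ ^ 4 * w * (x - s) * q ^ 2 * e₁ * M
          * (1# * (V (suc j) ^ 4 * E N (suc j) * B N (suc j))) ∎)

      H-over : H N (suc j) ≃ over (κ * (1# - y) ^ 4 * q ^ 2 * e₁ * b₀)
      H-over = cross (solve 11 (λ q y κ e₁ u c α v e b₀ β →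
               κ :* (u :* c :* α) :* ((v :* (con (+ 1) :- y)) :^ 4 :* e :* β :* (q :^ 2 :* e₁ :* b₀))
             := κ :* (con (+ 1) :- y) :^ 4 :* q :^ 2 :* e₁ :* b₀ :* (u :* c :* α) :* (v :^ 4 :* e :* β))
               refl q y κ e₁ (U (suc j) ^ 4) (C (suc N) j) (A N j) (V j) (E (suc N) j) b₀ (B N j))

      H-suc-over : H N (suc (suc j)) ≃ over (κ * (1# - q * y) ^ 4 * c₁ * (x - s) * q ^ 2)
      H-suc-over = cross (begin
        κ * (U (suc (suc j)) ^ 4 * C (suc N) (suc j) * A N (suc j)) * Δ
          ≈⟨ *-congʳ (*-congˡ (*-congʳ (*-congˡ C′-suc))) ⟩
        κ * (U (suc (suc j)) ^ 4 * (C (suc N) j * c₁) * A N (suc j)) * Δ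
          ≈⟨ solve 13 (λ q y κ e₁ c₁ u c α a₀ v e b₀ β →
               κ :* ((u :* (con (+ 1) :- q :* y)) :^ 4 :* (c :* c₁) :* (α :* a₀))
                 :* (v :* e :* β :* (q :^ 2 :* e₁ :* b₀))
             := κ :* (con (+ 1) :- q :* y) :^ 4 :* c₁ :* a₀ :* q :^ 2 :* (u :^ 4 :* c :* α)
                 :* (v :* (e :* e₁) :* (β :* b₀)))
               refl q y κ e₁ c₁ (U (suc j)) (C (suc N) j) (A N j) (x - s) (V (suc j) ^ 4)
               (E (suc N) j) b₀ (B N j) ⟩
        κ * (1# - q * y) ^ 4 * c₁ * (x - s) * q ^ 2 * M
          * (V (suc j) ^ 4 * (E (suc N) j * e₁) * B N (suc j))
          ≈⟨ *-congˡ (*-congʳ (*-congˡ E′-suc)) ⟨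
        κ * (1# - q * y) ^ 4 * c₁ * (x - s) * q ^ 2 * M
          * (V (suc j) ^ 4 * E (suc N) (suc j) * B N (suc j)) ∎)

      over-+ : ∀ m n → over m +ᶠ over n ≃ over (m + n)
      over-+ m n = K.trans frac-+ (frac-cong (sym (distribʳ M m n)))

  telescope : ∀ N k →
    fromCarrier (b N) *ᶠ T (suc N) k +ᶠ H N k ≃ fromCarrier (a N) *ᶠ T N k +ᶠ H N (suc k)
  telescope N zero    = cross
    -- At k = 0 all products are empty except U 1 = 1 - q, and the claim is b (1 - q) = a (1 - q) +
    -- κ (1 - q)^4 with κ the prefactor of `H`.
    (solve 2 (λ q x →
      let o = con (+ 1); t = (o :- q :* o :* o) :* o :* (o :^ 4 :* o :* o); d = o :^ 4 :* o :* o in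
      ((o :- q :^ 3 :* x) :^ 3 :* (o :- q :* x) :* t :* o :+ con (+ 0) :* (o :* d))
        :* (o :* d :* d)
      := ((o :- q :^ 4 :* x) :* (o :- q :^ 2 :* x) :^ 3 :* t :* d
          :+ :- (q :* x :* (o :- q :^ 5 :* x :* x)) :* ((o :* (o :- q :* o)) :^ 4 :* o :* o) :* (o :* d))
        :* (o :* d :* o)) refl q (p ^ N))
  telescope N (suc j) = begin
    fromCarrier (b N) *ᶠ T (suc N) (suc j) +ᶠ H N (suc j)       ≈⟨ K.+-cong bT-over H-over ⟩
    over ((1# - p * x) ^ 4 * w * c₁ * b₀) +ᶠ over (κ * (1# - y) ^ 4 * q ^ 2 * e₁ * b₀)
                                                                ≈⟨ over-+ _ _ ⟩
    over ((1# - p * x) ^ 4 * w * c₁ * b₀ + κ * (1# - y) ^ 4 * q ^ 2 * e₁ * b₀)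
                                                                ≈⟨ frac-cong (*-congʳ (wz-identity q x s)) ⟩
    over (c₀ ^ 4 * w * (x - s) * q ^ 2 * e₁ + κ * (1# - q * y) ^ 4 * c₁ * (x - s) * q ^ 2)
                                                                ≈⟨ over-+ _ _ ⟨
    over (c₀ ^ 4 * w * (x - s) * q ^ 2 * e₁) +ᶠ over (κ * (1# - q * y) ^ 4 * c₁ * (x - s) * q ^ 2)
                                                                ≈⟨ K.+-cong aT-over H-suc-over ⟨
    fromCarrier (a N) *ᶠ T N (suc j) +ᶠ H N (suc (suc j))       ∎
    where
    open Step N j
    open import Relation.Binary.Reasoning.Setoid K.setoid

  fromCarrier-cancel : ∀ {c x y} → ¬ c ≈ 0# →
    fromCarrier c *ᶠ x ≃ fromCarrier c *ᶠ y → x ≃ y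
  fromCarrier-cancel {c} {frac m d _} {frac n e _} c≉0 (cross eq) = cross (*-cancelˡ-≉0 c≉0
    (trans (solve 4 (λ c m d e → c :* (m :* e) := c :* m :* (con (+ 1) :* e)) refl c m d e)
    (trans eq (solve 4 (λ c n d e → c :* n :* (con (+ 1) :* d) := c :* (n :* d)) refl c n d e))))

  private
    T-vanishes : ∀ N → T N (suc N) ≃ fromCarrier 0#
    T-vanishes N = frac≃0 (trans (*-congˡ (trans (*-congˡ (A-vanishes N)) (zeroʳ _))) (zeroʳ _))

    H-vanishes : ∀ N → H N (suc (suc N)) ≃ fromCarrier 0#
    H-vanishes N = frac≃0 (trans (*-congˡ (trans (*-congˡ (A-vanishes N)) (zeroʳ _))) (zeroʳ _))

    -- The summation runs to k = N + 1, the last term for N + 1. At that point both the term for N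
    -- and the boundary value of the certificate contain A N (N + 1) = 0.
    sum-recurrence : ∀ N →
      fromCarrier (b N) *ᶠ ∑ᶠ (suc (suc N)) (T (suc N)) ≃ fromCarrier (a N) *ᶠ ∑ᶠ (suc N) (T N)
    sum-recurrence N = begin
      b′ *ᶠ ∑ᶠ (suc (suc N)) (T (suc N))
        ≈⟨ ∑-telescope {a′} {b′} {T (suc N)} {T N} {H N} K.refl (telescope N) (suc (suc N)) ⟩
      a′ *ᶠ ∑ᶠ (suc (suc N)) (T N) +ᶠ H N (suc (suc N))
        ≈⟨ K.+-cong (K.*-congˡ {a′} (∑-drop-last (suc N) (T N) (T-vanishes N))) (H-vanishes N) ⟩
      a′ *ᶠ ∑ᶠ (suc N) (T N) +ᶠ fromCarrier 0#
        ≈⟨ K.+-identityʳ (a′ *ᶠ ∑ᶠ (suc N) (T N)) ⟩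
      a′ *ᶠ ∑ᶠ (suc N) (T N) ∎
      where
      open import Relation.Binary.Reasoning.Setoid K.setoid
      a′ b′ : Fraction
      a′ = fromCarrier (a N)
      b′ = fromCarrier (b N)

  -- In Jackson's product the quotient (q^4;p)_N / (q;p)_N collapses to (1 - q p^N) / (1 - q), and
  -- the factor 1 - q carried by `T` absorbs the denominator.
  closedForm : ℕ → Fraction
  closedForm N = frac ((1# - q * p ^ N) * Z N ^ 3) (V N ^ 3)
    (x^n≉0 3 (V≉0 N))

  jackson-sum : ∀ N → ∑ᶠ (suc N) (T N) ≃ closedForm N
  jackson-sum zero    = cross
    (solve 1 (λ q → let o = con (+ 1); d = o :^ 4 :* o :* o in
      (con (+ 0) :* d :+ (o :- q :* o :* o) :* o :* (o :^ 4 :* o :* o) :* o) :* o :^ 3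
      := (o :- q :* o) :* o :^ 3 :* (o :* d)) refl q)
  jackson-sum (suc N) = fromCarrier-cancel b≉0 (begin
    fromCarrier (b N) *ᶠ ∑ᶠ (suc (suc N)) (T (suc N))  ≈⟨ sum-recurrence N ⟩
    fromCarrier (a N) *ᶠ ∑ᶠ (suc N) (T N)              ≈⟨ K.*-congˡ {fromCarrier (a N)} (jackson-sum N) ⟩
    fromCarrier (a N) *ᶠ closedForm N
      ≈⟨ cross (solve 4 (λ q x z v → let o = con (+ 1); p = q :^ 3 in
           (o :- q :^ 4 :* x) :* (o :- q :^ 2 :* x) :^ 3 :* ((o :- q :* x) :* z :^ 3)
             :* (o :* (v :* (o :- p :* x)) :^ 3)
           := (o :- p :* x) :^ 3 :* (o :- q :* x) :* ((o :- q :* (p :* x)) :* (z :* (o :- q :^ 2 :* x)) :^ 3)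
             :* (o :* v :^ 3)) refl q (p ^ N) (Z N) (V N)) ⟩
    fromCarrier (b N) *ᶠ closedForm (suc N)            ∎)
    where
    open import Relation.Binary.Reasoning.Setoid K.setoid
    b≉0 : ¬ b N ≈ 0#
    b≉0 = *-≉0 (x^n≉0 3 (1-q^*p^≉0 2 N))
      (≉-resp (+-congˡ (-‿cong (*-congʳ (*-identityʳ q)))) (1-q^*p^≉0 0 N))

-- Congruences for the truncated sums

module Congruences {c ℓ} (D : IntegralDomain c ℓ) (I : Indeterminate D) where
  open IntegralDomain D
  open Indeterminate I
  open IntegerSolver commutativeRing
  open FiniteSums commutativeRing
  open Divisibility D
  open Modulo using (Regular; regular-1; regular-*; regular-∏; regular-resp-≈)
  open FractionField D
  open FractionDivisibility D
  open JacksonSum D I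
  open FiniteSums fractionField using () renaming (∑ to ∑ᶠ; ∑-split to ∑ᶠ-split)

  factor∣∏ : ∀ n {i} f → i ℕ.< n → f i ∣ ∏ n f
  factor∣∏ (suc n) {i} f i<1+n with ℕ.m<1+n⇒m<n∨m≡n i<1+n
  ... | inj₁ i<n    = ∣-*ʳ (f n) (factor∣∏ n f i<n)
  ... | inj₂ ≡.refl = x∣ʳyx (f n) (∏ n f)

  V^n≉0 : ∀ k n → ¬ V k ^ n ≈ 0#
  V^n≉0 k n = x^n≉0 n (V≉0 k)

  -- (1 - q) times the k-th summand.
  τ : ℕ → Fraction
  τ k = frac ((1# - q * p ^ k * p ^ k) * p ^ k * U k ^ 6) (V k ^ 6) (V^n≉0 k 6)

  -- The properties of Φ_d on which the congruences rest. Integers enter because the cofactor of 1 -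
  -- q^d in 1 - q^(jd) is j modulo `P`.
  record CyclotomicModulus (d : ℕ) (P : Carrier) : Set (c ⊔ ℓ) where
    field
      1<d         : 1 ℕ.< d
      coprime-3   : Coprime d 3
      P≉0         : ¬ P ≈ 0#
      P∣1-q^d     : P ∣ 1# - q ^ d
      regular-1-q^ : ∀ k → ¬ d ℕ.∣ k → Regular P (1# - q ^ k)
      regular-nat : ∀ k → Regular P (nat (suc k))

  regular-^ : ∀ {Q v} n → Regular Q v → Regular Q (v ^ n)
  regular-^ zero    reg = regular-1 _
  regular-^ (suc n) reg = regular-* _ reg (regular-^ n reg)

  module _ {d : ℕ} {Q : Carrier}
    (coprime-3 : Coprime d 3)
    (regular-1-q^ : ∀ k → ¬ d ℕ.∣ k → Regular Q (1# - q ^ k))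
    where

    d∤3[1+i] : ∀ {i} → suc i ℕ.< d → ¬ d ℕ.∣ 3 ℕ.+ 3 ℕ.* i
    d∤3[1+i] {i} 1+i<d d∣ = ℕ.<⇒≱ 1+i<d (ℕ.∣⇒≤ (coprime-divisor coprime-3
      (≡.subst (d ℕ.∣_) (≡.sym (ℕ.*-suc 3 i)) d∣)))

    regular-V-factor : ∀ {i} → suc i ℕ.< d → Regular Q (1# - p * p ^ i)
    regular-V-factor {i} 1+i<d = regular-resp-≈ Q
      (+-congˡ (-‿cong (sym (q^*p^ 3 i)))) (regular-1-q^ _ (d∤3[1+i] 1+i<d))

    regular-V : ∀ {k} → k ℕ.< d → Regular Q (V k)
    regular-V {k} k<d = regular-∏ Q k λ i i<k → regular-V-factor (ℕ.≤-<-trans i<k k<d)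

  module _ {d m r : ℕ} {Q : Carrier}
    (coprime-3 : Coprime d 3)
    (regular-1-q^ : ∀ k → ¬ d ℕ.∣ k → Regular Q (1# - q ^ k))
    (regular-q : Regular Q q)
    (3m+1≡rd : 1 ℕ.+ 3 ℕ.* m ≡ r ℕ.* d) (m<d : m ℕ.< d)
    where
    open Modulo Q using (_≋_; ≋-*; ≋-∏; ≋-refl; ≋-trans; ≈⇒≋)

    -- The deformation parameter q^(3m+1) = q^(rd). The modulus `Q` will be Φ_d for r = 1 and its
    -- square for r = 2.
    z : Carrier
    z = q * p ^ m

    1-z≈1-q^rd : 1# - z ≈ 1# - q ^ (r ℕ.* d)
    1-z≈1-q^rd = +-congˡ (-‿cong (trans (*-congʳ (sym (*-identityʳ q)))
      (trans (q^*p^ 1 m) (^-congʳ q 3m+1≡rd))))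

    -- The parameters z u and u / z differ from u, u only to second order in 1 - z.
    deformation : Q ∣ (1# - z) * (1# - z) → ∀ u →
      z * ((1# - u) * (1# - u)) ≋ (1# - z * u) * (z - u)
    deformation Q∣ u = ∣ʳ-respʳ-≈
      (solve 2 (λ z u → u :* ((con (+ 1) :- z) :* (con (+ 1) :- z)) :=
        z :* ((con (+ 1) :- u) :* (con (+ 1) :- u)) :- (con (+ 1) :- z :* u) :* (z :- u)) refl z u)
      (∣-*ˡ u Q∣)

    ∏-deformed : ∀ k a → ∏ k (λ i → z * ((1# - a * p ^ i) * (1# - a * p ^ i)))
                         ≈ ∏ k (λ _ → z) * (pochhammer a k * pochhammer a k)
    ∏-deformed k a = trans (∏-* k _ _) (*-congˡ (∏-* k _ _))

    -- Since z - q p^i = q (p^m - p^i), the deformed factors are those of `T` up to one q for each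
    -- i. The denominators in `EB` yield the same power of q, so that it cancels.
    CA : ∀ k → ∏ k (λ i → (1# - z * (q * p ^ i)) * (z - q * p ^ i)) ≈ C m k * A m k * ∏ k (λ _ → q)
    CA k = trans (∏-cong k λ i _ →
        solve 3 (λ q x s → (con (+ 1) :- q :* x :* (q :* s)) :* (q :* x :- q :* s)
          := (con (+ 1) :- q :^ 2 :* x :* s) :* (x :- s) :* q) refl q (p ^ m) (p ^ i))
      (trans (∏-* k _ _) (*-congʳ (∏-* k _ _)))

    EB : ∀ k → ∏ k (λ i → (1# - z * (p * p ^ i)) * (z - p * p ^ i)) ≈ E m k * B m k * ∏ k (λ _ → q)
    EB k = trans (∏-cong k λ i _ →
        solve 3 (λ q x s → (con (+ 1) :- q :* x :* (q :^ 3 :* s)) :* (q :* x :- q :^ 3 :* s)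
          := (con (+ 1) :- q :^ 4 :* x :* s) :* (x :- q :^ 2 :* s) :* q) refl q (p ^ m) (p ^ i))
      (trans (∏-* k _ _) (*-congʳ (∏-* k _ _)))

    ∏q≉0 : ∀ k → ¬ ∏ k (λ _ → q) ≈ 0#
    ∏q≉0 k = ∏-≉0 k λ _ _ → q≉0

    regular-z : Regular Q z
    regular-z = regular-* Q regular-q (regular-^ m (regular-^ 3 regular-q))

    ∏z≉0 : ∀ k → ¬ ∏ k (λ _ → z) ≈ 0#
    ∏z≉0 k = ∏-≉0 k λ _ _ → *-≉0 q≉0 (p^-≉0 m)

    -- Both fractions are expanded, `τ k` by z^k and `T m k` by q^k; numerators and denominators are
    -- then congruent factor by factor.
    τ≋T : Q ∣ (1# - z) * (1# - z) → ∀ k → k ℕ.< d → Q ∣ᶠ τ k +ᶠ -ᶠ T m k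
    τ≋T Q∣ k k<d = ∣ᶠ-resp-≃ (K.+-cong (K.sym τ≃) (K.-‿cong (K.sym T≃)))
      (∣ᶠ-congruent {v≉0 = d₁≉0} {v′≉0 = d₂≉0}
        (≋-* ≋-refl (≋-* ≋-refl num≋))
        (≋-* ≋-refl den≋)
        (regular-* Q (regular-^ 4 reg-V)
          (regular-* Q (regular-∏ Q k λ _ _ → regular-z) (regular-* Q reg-V reg-V))))
      where
      reg-V : Regular Q (V k)
      reg-V = regular-V coprime-3 regular-1-q^ k<d

      w d₁ d₂ : Carrier
      w  = (1# - q * p ^ k * p ^ k) * p ^ k
      d₁ = V k ^ 4 * (∏ k (λ _ → z) * (V k * V k))
      d₂ = V k ^ 4 * (E m k * B m k * ∏ k (λ _ → q))

      num≋ : ∏ k (λ _ → z) * (U k * U k) ≋ C m k * A m k * ∏ k (λ _ → q)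
      num≋ = ≋-trans (≈⇒≋ (sym (∏-deformed k q)))
        (≋-trans (≋-∏ k λ i _ → deformation Q∣ (q * p ^ i)) (≈⇒≋ (CA k)))

      den≋ : ∏ k (λ _ → z) * (V k * V k) ≋ E m k * B m k * ∏ k (λ _ → q)
      den≋ = ≋-trans (≈⇒≋ (sym (∏-deformed k p)))
        (≋-trans (≋-∏ k λ i _ → deformation Q∣ (p * p ^ i)) (≈⇒≋ (EB k)))

      d₁≉0 : ¬ d₁ ≈ 0#
      d₁≉0 = *-≉0 (V^n≉0 k 4) (*-≉0 (∏z≉0 k) (*-≉0 (V≉0 k) (V≉0 k)))

      d₂≉0 : ¬ d₂ ≈ 0#
      d₂≉0 = *-≉0 (V^n≉0 k 4) (*-≉0 (*-≉0 (E≉0 m k) (B≉0 m k)) (∏q≉0 k))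

      τ≃ : τ k ≃ frac (w * (U k ^ 4 * (∏ k (λ _ → z) * (U k * U k)))) d₁ d₁≉0
      τ≃ = cross (solve 4 (λ w u z v → w :* u :^ 6 :* (v :^ 4 :* (z :* (v :* v)))
        := w :* (u :^ 4 :* (z :* (u :* u))) :* v :^ 6) refl w (U k) (∏ k (λ _ → z)) (V k))

      T≃ : T m k ≃ frac (w * (U k ^ 4 * (C m k * A m k * ∏ k (λ _ → q)))) d₂ d₂≉0
      T≃ = cross (solve 8 (λ w u c a e b q v →
          w :* (u :* c :* a) :* (v :* (e :* b :* q)) := w :* (u :* (c :* a :* q)) :* (v :* e :* b))
        refl w (U k ^ 4) (C m k) (A m k) (E m k) (B m k) (∏ k (λ _ → q)) (V k ^ 4))

    -- Beyond m, the product `U k` contains 1 - q p^m = 1 - z, and it occurs to the sixth power.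
    Q∣ᶠτ : Q ∣ (1# - z) * (1# - z) → ∀ k → m ℕ.< k → k ℕ.< d → Q ∣ᶠ τ k
    Q∣ᶠτ Q∣ k m<k k<d = divisible (τ k) K.refl
      (∣-*ˡ _ (∣ʳ-respʳ-≈ (solve 1 (λ u → u :* u :* u :^ 4 := u :^ 6) refl (U k))
        (∣-*ʳ _ (∣ʳ-trans Q∣ (∣-*-cong 1-z∣U 1-z∣U)))))
      (regular-^ 6 (regular-V coprime-3 regular-1-q^ k<d))
      where
      1-z∣U : 1# - z ∣ U k
      1-z∣U = factor∣∏ k (λ i → 1# - q * p ^ i) m<k

    -- Up to k = m the terms are replaced by Jackson's, whose sum is `closedForm m`; each later term
    -- vanishes modulo `Q` by itself.
    block : Q ∣ (1# - z) * (1# - z) → Q ∣ (1# - z) * Z m ^ 3 → Q ∣ᶠ ∑ᶠ d τ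
    block Q∣[1-z]² Q∣closed = ≡.subst (λ n → Q ∣ᶠ ∑ᶠ n τ) (ℕ.m+[n∸m]≡n m<d)
      (∣ᶠ-resp-≃ (K.sym (∑ᶠ-split (suc m) (d ℕ.∸ suc m) τ)) (∣ᶠ-+
        (∣ᶠ-∑-congruent (suc m) (λ k k≤m → τ≋T Q∣[1-z]² k (ℕ.<-≤-trans k≤m m<d))
          (∣ᶠ-resp-≃ (K.sym (jackson-sum m))
            (divisible (closedForm m) K.refl Q∣closed (regular-^ 3 (regular-V coprime-3 regular-1-q^ m<d)))))
        (∣ᶠ-∑ (d ℕ.∸ suc m) λ i i< → Q∣ᶠτ Q∣[1-z]² (suc m ℕ.+ i) (ℕ.s≤s (ℕ.m≤m+n m i))
          (ℕ.≤-trans (ℕ.+-monoʳ-< (suc m) i<) (ℕ.≤-reflexive (ℕ.m+[n∸m]≡n m<d))))))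

private
  1+3[1+2e]≡2[2+3e] : ∀ e → 1 ℕ.+ 3 ℕ.* suc (2 ℕ.* e) ≡ 2 ℕ.* (2 ℕ.+ 3 ℕ.* e)
  1+3[1+2e]≡2[2+3e] = solve-∀

  3+3[s+n]≡3[s+1+n] : ∀ s n → 3 ℕ.+ 3 ℕ.* (s ℕ.+ n) ≡ 3 ℕ.* (s ℕ.+ suc n)
  3+3[s+n]≡3[s+1+n] = solve-∀

  3[ld+d]≡d[3[1+l]] : ∀ l d → 3 ℕ.* (l ℕ.* d ℕ.+ d) ≡ d ℕ.* (3 ℕ.* suc l)
  3[ld+d]≡d[3[1+l]] = solve-∀

  1+3[s+m]≡3s+[1+3m] : ∀ s m → 1 ℕ.+ 3 ℕ.* (s ℕ.+ m) ≡ 3 ℕ.* s ℕ.+ (1 ℕ.+ 3 ℕ.* m)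
  1+3[s+m]≡3s+[1+3m] = solve-∀

  3[ld]+rd≡[3l+r]d : ∀ l r d → 3 ℕ.* (l ℕ.* d) ℕ.+ r ℕ.* d ≡ (3 ℕ.* l ℕ.+ r) ℕ.* d
  3[ld]+rd≡[3l+r]d = solve-∀

  6k+1≡1+3[k+k] : ∀ k → 6 ℕ.* k ℕ.+ 1 ≡ 1 ℕ.+ 3 ℕ.* (k ℕ.+ k)
  6k+1≡1+3[k+k] = solve-∀

-- Complete blocks of d terms modulo Φ_d

module CyclotomicCongruences {c ℓ} (D : IntegralDomain c ℓ) (I : Indeterminate D) where
  open IntegralDomain D
  open Indeterminate I
  open IntegerSolver commutativeRing
  open FiniteSums commutativeRing
  open Divisibility D
  open Modulo using (Regular; regular-1; regular-*; regular-resp-≋; regular-resp-≈)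
  open FractionField D
  open FractionDivisibility D
  open JacksonSum D I
  open Congruences D I
  module FractionSolver = IntegerSolver fractionField
  open Exp K.semiring using () renaming (_^_ to _^ᶠ_)
  open FiniteSums fractionField using ()
    renaming (∑ to ∑ᶠ; ∑-cong to ∑ᶠ-cong; ∑-distribˡ to ∑ᶠ-distribˡ; ∑-split to ∑ᶠ-split)

  cut₁ : ∀ {d} m → 1 ℕ.+ 3 ℕ.* m ≡ d → (1 ℕ.+ 3 ℕ.* m ≡ 1 ℕ.* d) × m ℕ.< d
  cut₁ {d} m 3m+1≡d = ≡.trans 3m+1≡d (≡.sym (ℕ.*-identityˡ d))
    , ≡.subst (m ℕ.<_) 3m+1≡d (ℕ.s≤s (ℕ.m≤n*m m 3))

  -- For d = 3 e + 2 the sum is cut at m = 2 e + 1, which still lies in the first block.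
  cut₂ : ∀ {d} e → 2 ℕ.+ 3 ℕ.* e ≡ d →
    (1 ℕ.+ 3 ℕ.* suc (2 ℕ.* e) ≡ 2 ℕ.* d) × suc (2 ℕ.* e) ℕ.< d
  cut₂ e 3e+2≡d = ≡.trans
      (1+3[1+2e]≡2[2+3e] e)
      (≡.cong (2 ℕ.*_) 3e+2≡d)
    , ≡.subst (suc (2 ℕ.* e) ℕ.<_) 3e+2≡d (ℕ.s≤s (ℕ.s≤s (ℕ.*-monoˡ-≤ e {2} {3} (ℕ.n≤1+n 2))))

  module _ {d : ℕ} {P : Carrier} (M : CyclotomicModulus d P) where
    open CyclotomicModulus M
    open Modulo P
      using (_≋_; ≋-*; ≋-+; ≋-neg; ≋-∏; ≋-refl; ≋-sym; ≋-trans; ≈⇒≋; ≋-^; 1^n≋1; ∑-powers≋nat; ∣-resp-≋)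

    q^d≋1 : q ^ d ≋ 1#
    q^d≋1 = ≋-sym P∣1-q^d

    q^kd≋1 : ∀ k → q ^ (k ℕ.* d) ≋ 1#
    q^kd≋1 k = ≋-trans (≈⇒≋ (trans (^-congʳ q (ℕ.*-comm k d)) (sym (^-assocʳ q d k)))) (1^n≋1 k q^d≋1)

    -- q is even a unit modulo `P`, with inverse q^(d-1).
    regular-q : Regular P q
    regular-q {x} P∣qx = ∣-resp-≋ (≋-trans (≋-* q^d≋1 ≋-refl) (≈⇒≋ (*-identityˡ x)))
      (∣ʳ-respʳ-≈ (trans (solve 3 (λ q r x → r :* (q :* x) := q :* r :* x) refl q (q ^ (d ℕ.∸ 1)) x)
        (*-congʳ (^-congʳ q (ℕ.m+[n∸m]≡n (ℕ.<⇒≤ 1<d))))) (∣-*ˡ (q ^ (d ℕ.∸ 1)) P∣qx))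

    1-q^d∣1-q^kd : ∀ k → 1# - q ^ d ∣ 1# - q ^ (k ℕ.* d)
    1-q^d∣1-q^kd k = ∑ k ((q ^ d) ^_) , trans (*-comm _ _) (trans (geometric (q ^ d) k)
      (+-congˡ (-‿cong (trans (^-assocʳ q d k) (^-congʳ q (ℕ.*-comm d k))))))

    block-1 : ∀ m → 1 ℕ.+ 3 ℕ.* m ≡ d → P ∣ᶠ ∑ᶠ d τ
    block-1 m 3m+1≡d = block {m = m} {r = 1} coprime-3 regular-1-q^ regular-q 3m+1≡1d m<d
      (∣-*ˡ _ P∣1-z) (∣-*ʳ _ P∣1-z)
      where
      3m+1≡1d = proj₁ (cut₁ m 3m+1≡d)
      m<d = proj₂ (cut₁ m 3m+1≡d)
      P∣1-z : P ∣ 1# - q * p ^ m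
      P∣1-z = ∣ʳ-respʳ-≈ (sym (1-z≈1-q^rd {m = m} {r = 1} coprime-3 regular-1-q^ regular-q 3m+1≡1d m<d))
        (∣ʳ-trans P∣1-q^d (1-q^d∣1-q^kd 1))

    -- Here 3(2e+1) + 1 = 2d; one factor P comes from 1 - q^(2d) and the other from 1 - q^(3e+2),
    -- a factor of (q^2;q^3)_(2e+1).
    block-2 : ∀ e → 2 ℕ.+ 3 ℕ.* e ≡ d → P * P ∣ᶠ ∑ᶠ d τ
    block-2 e 3e+2≡d = block {m = m} {r = 2} coprime-3 reg reg-q 3m+1≡2d m<d
      (∣-*-cong P∣1-z P∣1-z)
      (∣-*-cong P∣1-z (∣-*ʳ _ (∣ʳ-trans P∣1-q^2p^e (factor∣∏ m (λ i → 1# - q ^ 2 * p ^ i) e<m))))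
      where
      m : ℕ
      m = suc (2 ℕ.* e)
      reg : ∀ k → ¬ d ℕ.∣ k → Regular (P * P) (1# - q ^ k)
      reg k d∤k = regular-*-modulus P≉0 (regular-1-q^ k d∤k) (regular-1-q^ k d∤k)
      reg-q : Regular (P * P) q
      reg-q = regular-*-modulus P≉0 regular-q regular-q
      e<m : e ℕ.< m
      e<m = ℕ.s≤s (ℕ.m≤n*m e 2)
      3m+1≡2d = proj₁ (cut₂ e 3e+2≡d)
      m<d = proj₂ (cut₂ e 3e+2≡d)
      P∣1-z : P ∣ 1# - q * p ^ m
      P∣1-z = ∣ʳ-respʳ-≈ (sym (1-z≈1-q^rd {m = m} {r = 2} coprime-3 reg reg-q 3m+1≡2d m<d))
        (∣ʳ-trans P∣1-q^d (1-q^d∣1-q^kd 2))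
      P∣1-q^2p^e : P ∣ 1# - q ^ 2 * p ^ e
      P∣1-q^2p^e = ∣ʳ-respʳ-≈ (+-congˡ (-‿cong (trans (^-congʳ q (≡.sym 3e+2≡d)) (sym (q^*p^ 2 e))))) P∣1-q^d

    ratio : ℕ → Fraction
    ratio k = frac (U k) (V k) (V≉0 k)

    U′ V′ : ℕ → ℕ → Carrier
    U′ s k = ∏ k (λ i → 1# - q * p ^ (s ℕ.+ i))
    V′ s k = ∏ k (λ i → 1# - p * p ^ (s ℕ.+ i))

    V′≉0 : ∀ s k → ¬ V′ s k ≈ 0#
    V′≉0 s k = ∏-≉0 k λ i _ → 1-q^*p^≉0 2 (s ℕ.+ i)

    V′^n≉0 : ∀ s k n → ¬ V′ s k ^ n ≈ 0#
    V′^n≉0 s k n = x^n≉0 n (V′≉0 s k)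

    p^ld≋1 : ∀ l → p ^ (l ℕ.* d) ≋ 1#
    p^ld≋1 l = ≋-trans (≈⇒≋ (trans (p^≈q^ (l ℕ.* d)) (^-congʳ q (≡.sym (ℕ.*-assoc 3 l d)))))
      (q^kd≋1 (3 ℕ.* l))

    p^[ld+j]≋p^j : ∀ l j → p ^ (l ℕ.* d ℕ.+ j) ≋ p ^ j
    p^[ld+j]≋p^j l j = ≋-trans (≈⇒≋ (^-homo-* p (l ℕ.* d) j))
      (≋-trans (≋-* (p^ld≋1 l) ≋-refl) (≈⇒≋ (*-identityˡ _)))

    factor≋ : ∀ a l j → 1# - a * p ^ (l ℕ.* d ℕ.+ j) ≋ 1# - a * p ^ j
    factor≋ a l j = ≋-+ ≋-refl (≋-neg (≋-* ≋-refl (p^[ld+j]≋p^j l j)))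

    V′-regular : ∀ l {k} → k ℕ.< d → Regular P (V′ (l ℕ.* d) k)
    V′-regular l {k} k<d = regular-resp-≋ P (≋-∏ k λ i _ → ≋-sym (factor≋ p l i))
      (regular-V coprime-3 regular-1-q^ k<d)

    ratio-split : ∀ s k → ratio (s ℕ.+ k) ≃ ratio s *ᶠ frac (U′ s k) (V′ s k) (V′≉0 s k)
    ratio-split s k = cross (*-cong (∏-split s k _) (sym (∏-split s k _)))

    τ-split : ∀ s j → τ (s ℕ.+ j) ≃ ratio s ^ᶠ 6 *ᶠ
      frac ((1# - q * p ^ (s ℕ.+ j) * p ^ (s ℕ.+ j)) * p ^ (s ℕ.+ j) * U′ s j ^ 6) (V′ s j ^ 6) (V′^n≉0 s j 6)
    τ-split s j = cross (begin
      w * U (s ℕ.+ j) ^ 6 * (V s ^ 6 * V′ s j ^ 6)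
        ≈⟨ *-congʳ (*-congˡ (^-congˡ 6 (∏-split s j _))) ⟩
      w * (U s * U′ s j) ^ 6 * (V s ^ 6 * V′ s j ^ 6)
        ≈⟨ solve 5 (λ w u u′ v v′ → w :* (u :* u′) :^ 6 :* (v :^ 6 :* v′ :^ 6)
             := u :^ 6 :* (w :* u′ :^ 6) :* (v :* v′) :^ 6) refl w (U s) (U′ s j) (V s) (V′ s j) ⟩
      U s ^ 6 * (w * U′ s j ^ 6) * (V s * V′ s j) ^ 6
        ≈⟨ *-congˡ (^-congˡ 6 (∏-split s j _)) ⟨
      U s ^ 6 * (w * U′ s j ^ 6) * V (s ℕ.+ j) ^ 6 ∎)
      where
      open import Relation.Binary.Reasoning.Setoid setoid
      w : Carrier
      w = (1# - q * p ^ (s ℕ.+ j) * p ^ (s ℕ.+ j)) * p ^ (s ℕ.+ j)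

    module _ {m r : ℕ} (3m+1≡rd : 1 ℕ.+ 3 ℕ.* m ≡ r ℕ.* d) (m<d : m ℕ.< d) where

      -- The single factor of V′ and the single factor of U′ divisible by 1 - q^d cancel.
      integral-block : ∀ l → IntegralAt P (frac (U′ (l ℕ.* d) d) (V′ (l ℕ.* d) d) (V′≉0 (l ℕ.* d) d))
      integral-block l = integral (frac u (V′ s n * G) (*-≉0 (V′≉0 s n) G≉0))
        (cross (begin
          U′ s d * (V′ s n * G)
            ≈⟨ *-congʳ u*[1-q^d]≈U′ ⟨
          u * (1# - q ^ d) * (V′ s n * G)
            ≈⟨ solve 4 (λ u e v g → u :* e :* (v :* g) := u :* (v :* (e :* g))) refl u _ (V′ s n) G ⟩
          u * (V′ s n * ((1# - q ^ d) * G))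
            ≈⟨ *-congˡ V′-last ⟨
          u * V′ s d ∎))
        -- The first d - 1 factors of `V′` are regular; the cofactor `G` of 1 - q^d in the last one
        -- is 3 (l + 1) modulo `P`, a positive integer.
        (regular-* P (V′-regular l n<d)
          (regular-resp-≋ P (≋-sym (∑-powers≋nat (3 ℕ.* suc l) q^d≋1)) (regular-nat (l ℕ.+ 2 ℕ.* suc l))))
        where
        open import Relation.Binary.Reasoning.Setoid setoid
        s n : ℕ
        s = l ℕ.* d
        n = d ℕ.∸ 1

        1+n≡d : suc n ≡ d
        1+n≡d = ℕ.m+[n∸m]≡n (ℕ.<⇒≤ 1<d)

        n<d : n ℕ.< d
        n<d = ℕ.≤-reflexive 1+n≡d

        G : Carrier
        G = ∑ (3 ℕ.* suc l) ((q ^ d) ^_)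

        last-exponent : 3 ℕ.+ 3 ℕ.* (s ℕ.+ n) ≡ d ℕ.* (3 ℕ.* suc l)
        last-exponent = ≡.trans
          (3+3[s+n]≡3[s+1+n] s n)
          (≡.trans (≡.cong (λ e → 3 ℕ.* (s ℕ.+ e)) 1+n≡d)
          (3[ld+d]≡d[3[1+l]] l d))

        V′-last : V′ s d ≈ V′ s n * ((1# - q ^ d) * G)
        V′-last = trans (reflexive (≡.cong (V′ s) (≡.sym 1+n≡d))) (*-congˡ (begin
          1# - p * p ^ (s ℕ.+ n)          ≈⟨ +-congˡ (-‿cong (q^*p^ 3 (s ℕ.+ n))) ⟩
          1# - q ^ (3 ℕ.+ 3 ℕ.* (s ℕ.+ n)) ≡⟨ ≡.cong (λ k → 1# - q ^ k) last-exponent ⟩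
          1# - q ^ (d ℕ.* (3 ℕ.* suc l))  ≈⟨ +-congˡ (-‿cong (^-assocʳ q d (3 ℕ.* suc l))) ⟨
          1# - (q ^ d) ^ (3 ℕ.* suc l)    ≈⟨ geometric (q ^ d) (3 ℕ.* suc l) ⟨
          (1# - q ^ d) * G                ∎))

        G≉0 : ¬ G ≈ 0#
        G≉0 G≈0 = V′≉0 s d (trans V′-last
          (trans (*-congˡ (trans (*-congˡ G≈0) (zeroʳ _))) (zeroʳ _)))

        zero-exponent : 1 ℕ.+ 3 ℕ.* (s ℕ.+ m) ≡ (3 ℕ.* l ℕ.+ r) ℕ.* d
        zero-exponent = ≡.trans
          (1+3[s+m]≡3s+[1+3m] s m)
          (≡.trans (≡.cong (3 ℕ.* s ℕ.+_) 3m+1≡rd)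
          (3[ld]+rd≡[3l+r]d l r d))

        1-q^d∣U′ : 1# - q ^ d ∣ U′ s d
        1-q^d∣U′ = ∣ʳ-trans
          (∣ʳ-respʳ-≈ (+-congˡ (-‿cong (trans (^-congʳ q (≡.sym zero-exponent))
              (trans (sym (q^*p^ 1 (s ℕ.+ m))) (*-congʳ (*-identityʳ q))))))
            (1-q^d∣1-q^kd (3 ℕ.* l ℕ.+ r)))
          (factor∣∏ d (λ i → 1# - q * p ^ (s ℕ.+ i)) m<d)

        u : Carrier
        u = quotient 1-q^d∣U′

        u*[1-q^d]≈U′ : u * (1# - q ^ d) ≈ U′ s d
        u*[1-q^d]≈U′ = quotient-* 1-q^d∣U′

      -- For l > 0 the denominator `V (l d)` is a multiple of `P`, so integrality rests on the
      -- cancellation within each block.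
      integral-ratio : ∀ l → IntegralAt P (ratio (l ℕ.* d))
      integral-ratio zero    = integral (ratio 0) K.refl (regular-1 P)
      integral-ratio (suc l) = ≡.subst (λ n → IntegralAt P (ratio n)) (ℕ.+-comm (l ℕ.* d) d)
        (integral-resp-≃ (K.sym (ratio-split (l ℕ.* d) d)) (integral-* (integral-ratio l) (integral-block l)))

      -- As p^(ld) is 1 modulo `P`, the factors of index l d + i are congruent to those of index i;
      -- the complete blocks before them contribute the sixth power of their ratio.
      τ-periodic : ∀ l {j} → j ℕ.< d → P ∣ᶠ τ (l ℕ.* d ℕ.+ j) +ᶠ -ᶠ (ratio (l ℕ.* d) ^ᶠ 6 *ᶠ τ j)
      τ-periodic l {j} j<d = ∣ᶠ-resp-≃
        (K.trans (FractionSolver.solve 3 (λ c x y → c FractionSolver.:* (x FractionSolver.:- y)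
            FractionSolver.:= c FractionSolver.:* x FractionSolver.:- c FractionSolver.:* y) K.refl γ σ (τ j))
          (K.+-congʳ { -ᶠ (γ *ᶠ τ j)} (K.sym (τ-split s j))))
        (∣ᶠ-* (integral-^ (integral-ratio l) 6)
          (∣ᶠ-congruent {v≉0 = V′^n≉0 s j 6} {v′≉0 = V^n≉0 j 6}
            (≋-* (≋-* (≋-+ ≋-refl (≋-neg (≋-* (≋-* ≋-refl y≋) y≋))) y≋) (≋-^ 6 (≋-∏ j λ i _ → factor≋ q l i)))
            (≋-^ 6 (≋-∏ j λ i _ → factor≋ p l i))
            (regular-^ 6 (V′-regular l j<d))))
        where
        s : ℕ
        s = l ℕ.* d
        γ σ : Fraction
        γ = ratio s ^ᶠ 6
        σ = frac ((1# - q * p ^ (s ℕ.+ j) * p ^ (s ℕ.+ j)) * p ^ (s ℕ.+ j) * U′ s j ^ 6)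
          (V′ s j ^ 6) (V′^n≉0 s j 6)
        y≋ : p ^ (s ℕ.+ j) ≋ p ^ j
        y≋ = p^[ld+j]≋p^j l j

      blocks : P ∣ᶠ ∑ᶠ d τ → ∀ L → P ∣ᶠ ∑ᶠ (L ℕ.* d) τ
      blocks P∣ zero    = ∣ᶠ-0
      blocks P∣ (suc L) = ≡.subst (λ n → P ∣ᶠ ∑ᶠ n τ) (ℕ.+-comm (L ℕ.* d) d)
        (∣ᶠ-resp-≃ (K.sym (∑ᶠ-split (L ℕ.* d) d τ)) (∣ᶠ-+ (blocks P∣ L)
          (∣ᶠ-∑-congruent d (λ j j<d → τ-periodic L j<d)
            (∣ᶠ-resp-≃ (K.sym (∑ᶠ-distribˡ (ratio (L ℕ.* d) ^ᶠ 6) d τ))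
              (∣ᶠ-* (integral-^ (integral-ratio L) 6) P∣)))))

  -- Shaped like `term`, so that the comparison of the two is factor by factor.
  t : ℕ → Fraction
  t k = frac (∑ (6 ℕ.* k ℕ.+ 1) (q ^_) * U k ^ 6 * p ^ k) (V k ^ 6) (V^n≉0 k 6)

  [1-q]*t≃τ : ∀ k → fromCarrier (1# - q) *ᶠ t k ≃ τ k
  [1-q]*t≃τ k = cross (begin
    (1# - q) * (∑ (6 ℕ.* k ℕ.+ 1) (q ^_) * U k ^ 6 * p ^ k) * V k ^ 6
      ≈⟨ solve 5 (λ e g u s v → e :* (g :* u :* s) :* v := e :* g :* s :* u :* (con (+ 1) :* v))
           refl (1# - q) (∑ (6 ℕ.* k ℕ.+ 1) (q ^_)) (U k ^ 6) (p ^ k) (V k ^ 6) ⟩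
    (1# - q) * ∑ (6 ℕ.* k ℕ.+ 1) (q ^_) * p ^ k * U k ^ 6 * (1# * V k ^ 6)
      ≈⟨ *-congʳ (*-congʳ (*-congʳ (trans (geometric q (6 ℕ.* k ℕ.+ 1)) (+-congˡ (-‿cong exponent))))) ⟩
    (1# - q * p ^ k * p ^ k) * p ^ k * U k ^ 6 * (1# * V k ^ 6) ∎)
    where
    open import Relation.Binary.Reasoning.Setoid setoid
    exponent : q ^ (6 ℕ.* k ℕ.+ 1) ≈ q * p ^ k * p ^ k
    exponent = trans (^-congʳ q (6k+1≡1+3[k+k] k)) (trans (sym (q^*p^ 1 (k ℕ.+ k)))
      (trans (*-cong (*-identityʳ q) (^-homo-* p k k)) (sym (*-assoc _ _ _))))

  τ⇒t : ∀ {Q} → Regular Q (1# - q) → ∀ n → Q ∣ᶠ ∑ᶠ n τ → Q ∣ᶠ ∑ᶠ n t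
  τ⇒t reg n Q∣τ = ∣ᶠ-cancel-regular 1-q≉0 reg
    (∣ᶠ-resp-≃ (K.trans (∑ᶠ-cong n λ k _ → K.sym ([1-q]*t≃τ k)) (∑ᶠ-distribˡ (fromCarrier (1# - q)) n t)) Q∣τ)
    where
    1-q≉0 : ¬ 1# - q ≈ 0#
    1-q≉0 = ≉-resp (+-congˡ (-‿cong (*-identityʳ q))) (1-q^1+k≉0 0)

  module _ {d : ℕ} {P : Carrier} (M : CyclotomicModulus d P) where
    open CyclotomicModulus M

    regular-1-q : Regular P (1# - q)
    regular-1-q = regular-resp-≈ P (+-congˡ (-‿cong (*-identityʳ q)))
      (regular-1-q^ 1 λ d∣1 → ℕ.<⇒≱ 1<d (ℕ.∣⇒≤ d∣1))

    P∣∑t : ∀ L → P ∣ᶠ ∑ᶠ (L ℕ.* d) t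
    P∣∑t L with d ℕ.% 3 | ℕ.m≡m%n+[m/n]*n d 3 | ℕ.m%n<n d 3
    ... | 0 | d≡3e   | _ = contradiction (coprime-3 (ℕ.divides (d ℕ./ 3) d≡3e , ℕ.∣-refl)) λ ()
    ... | 1 | d≡1+3e | _ = τ⇒t regular-1-q (L ℕ.* d) (blocks M {r = 1} (proj₁ (cut₁ e eq)) (proj₂ (cut₁ e eq))
        (block-1 M e eq) L)
      where
      e : ℕ
      e = d ℕ./ 3
      eq : 1 ℕ.+ 3 ℕ.* e ≡ d
      eq = ≡.sym (≡.trans d≡1+3e (≡.cong suc (ℕ.*-comm e 3)))
    -- The first block is known modulo P^2, but the blocks are proportional modulo `P` only, so one
    -- factor is given up.
    ... | 2 | d≡2+3e | _ = τ⇒t regular-1-q (L ℕ.* d) (blocks M {r = 2} (proj₁ (cut₂ e eq)) (proj₂ (cut₂ e eq))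
        (∣ᶠ-drop-factor P≉0 (block-2 M e eq)) L)
      where
      e : ℕ
      e = d ℕ./ 3
      eq : 2 ℕ.+ 3 ℕ.* e ≡ d
      eq = ≡.sym (≡.trans d≡2+3e (≡.cong (2 ℕ.+_) (ℕ.*-comm e 3)))
    ... | suc (suc (suc _)) | _ | ℕ.s≤s (ℕ.s≤s (ℕ.s≤s ()))

    P²∣∑t : d ℕ.% 3 ≡ 2 → P * P ∣ᶠ ∑ᶠ d t
    P²∣∑t d%3≡2 = τ⇒t (regular-*-modulus P≉0 regular-1-q regular-1-q) d (block-2 M (d ℕ./ 3) eq)
      where
      eq : 2 ℕ.+ 3 ℕ.* (d ℕ./ 3) ≡ d
      eq = ≡.sym (≡.trans (ℕ.m≡m%n+[m/n]*n d 3) (≡.cong₂ ℕ._+_ d%3≡2 (ℕ.*-comm (d ℕ./ 3) 3)))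

-- Cyclotomic factors

module CyclotomicFactors {c ℓ} (D : IntegralDomain c ℓ) (I : Indeterminate D)
  (φ : ℕ → IntegralDomain.Carrier D) where
  open IntegralDomain D
  open Indeterminate I
  open IntegerSolver commutativeRing
  open FiniteSums commutativeRing
  open Divisibility D
  open Modulo using (Regular; regular-factor)
  open Exp semiring using (_^_; ^-homo-*; ^-assocʳ; ^-congʳ)

  -- The bound k allows induction on it, and k = n - 1 gives the divisor in the recursive definition
  -- of Φ_n.
  ∏φ : ℕ → ℕ → Carrier
  ∏φ n zero = 1#
  ∏φ n (suc k) with suc k ℕ.∣? n
  ... | yes _ = φ (suc k) * ∏φ n k
  ... | no  _ = ∏φ n k

  Factorizes : ℕ → Set ℓ
  Factorizes n = ∏φ n n ≈ q ^ n - 1#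

  record Good (n : ℕ) : Set (c ⊔ ℓ) where
    field
      factorizes  : Factorizes n
      regular-nat : ∀ k → Regular (φ n) (nat (suc k))
  open Good

  ∏φ-suc : ∀ {n k} → suc k ℕ.∣ n → ∏φ n (suc k) ≈ φ (suc k) * ∏φ n k
  ∏φ-suc {n} {k} k∣n with suc k ℕ.∣? n
  ... | yes _  = refl
  ... | no k∤n = contradiction k∣n k∤n

  ∏φ-skip : ∀ {n k} → ¬ suc k ℕ.∣ n → ∏φ n (suc k) ≈ ∏φ n k
  ∏φ-skip {n} {k} k∤n with suc k ℕ.∣? n
  ... | yes k∣n = contradiction k∣n k∤n
  ... | no _    = refl

  q^n-1≉0 : ∀ n → 1 ℕ.≤ n → ¬ q ^ n - 1# ≈ 0#
  q^n-1≉0 (suc n) _ e = 1-q^1+k≉0 n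
    (trans (solve 1 (λ x → con (+ 1) :- x := :- (x :- con (+ 1))) refl _)
      (trans (-‿cong e) (solve 0 (:- con (+ 0) := con (+ 0)) refl)))

  factorizes-last : ∀ {n} → 1 ℕ.≤ n → Factorizes n → φ n * ∏φ n (n ℕ.∸ 1) ≈ q ^ n - 1#
  factorizes-last {suc n} _ f = trans (sym (∏φ-suc ℕ.∣-refl)) f

  φ≉0 : ∀ {n} → 1 ℕ.≤ n → Factorizes n → ¬ φ n ≈ 0#
  φ≉0 {n} 1≤n f φ≈0 = q^n-1≉0 n 1≤n (trans (sym (factorizes-last 1≤n f)) (trans (*-congʳ φ≈0) (zeroˡ _)))

  φ∣q^n-1 : ∀ {n} → 1 ℕ.≤ n → Factorizes n → φ n ∣ q ^ n - 1#
  φ∣q^n-1 {n} 1≤n f = ∣ʳ-respʳ-≈ (factorizes-last 1≤n f) (∣-*ʳ (∏φ n (n ℕ.∸ 1)) ∣ʳ-refl)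

  ∏φ-mono : ∀ {m n} → m ℕ.∣ n → ∀ {j k} → j ℕ.≤ k → ∏φ m j ∣ ∏φ n k
  ∏φ-mono m∣n {zero} {zero} _ = ∣ʳ-refl
  ∏φ-mono {m} {n} m∣n {j} {suc k} j≤1+k with ℕ.m≤n⇒m<n∨m≡n j≤1+k
  ... | inj₁ (ℕ.s≤s j≤k) with suc k ℕ.∣? n
  ...   | yes _ = ∣-*ˡ (φ (suc k)) (∏φ-mono m∣n j≤k)
  ...   | no  _ = ∏φ-mono m∣n j≤k
  ∏φ-mono {m} {n} m∣n {suc k} {suc k} _ | inj₂ ≡.refl with suc k ℕ.∣? m | suc k ℕ.∣? n
  ... | yes _   | yes _   = ∣-*-cong ∣ʳ-refl (∏φ-mono m∣n (ℕ.≤-refl {k}))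
  ... | yes k∣m | no k∤n  = contradiction (ℕ.∣-trans k∣m m∣n) k∤n
  ... | no _    | yes _   = ∣-*ˡ (φ (suc k)) (∏φ-mono m∣n (ℕ.≤-refl {k}))
  ... | no _    | no _    = ∏φ-mono m∣n (ℕ.≤-refl {k})

  q^g-1∣q^jg-1 : ∀ g j → q ^ g - 1# ∣ q ^ (j ℕ.* g) - 1#
  q^g-1∣q^jg-1 g j = ∑ j ((q ^ g) ^_) , trans
    (solve 2 (λ s x → s :* (x :- con (+ 1)) := :- ((con (+ 1) :- x) :* s)) refl _ (q ^ g))
    (trans (-‿cong (geometric (q ^ g) j))
    (trans (-‿cong (+-congˡ (-‿cong (trans (^-assocʳ q g j) (^-congʳ q (ℕ.*-comm g j))))))
      (solve 1 (λ x → :- (con (+ 1) :- x) := x :- con (+ 1)) refl _)))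

  module _ {P x : Carrier} where
    -- {k : P ∣ (1 - q^k) x} is closed under multiples and differences, hence under gcd.
    private
      Kills : ℕ → Set (c ⊔ ℓ)
      Kills k = P ∣ (1# - q ^ k) * x

      kills-resp : ∀ {j k} → j ≡ k → Kills j → Kills k
      kills-resp ≡.refl s = s

      kills-multiple : ∀ {k} j → Kills k → Kills (j ℕ.* k)
      kills-multiple {k} j s = ∣ʳ-respʳ-≈
        (trans (solve 3 (λ s y x → s :* (y :* x) := y :* s :* x) refl (∑ j ((q ^ k) ^_)) _ x)
          (*-congʳ (trans (geometric (q ^ k) j)
            (+-congˡ (-‿cong (trans (^-assocʳ q k j) (^-congʳ q (ℕ.*-comm k j))))))))
        (∣-*ˡ (∑ j ((q ^ k) ^_)) s)

      kills-difference : ∀ {j k} → Kills (j ℕ.+ k) → Kills k → Kills j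
      kills-difference {j} {k} s t = ∣ʳ-respʳ-≈
        (trans (+-congʳ (*-congʳ (+-congˡ (-‿cong (^-homo-* q j k)))))
          (solve 3 (λ u v x → (con (+ 1) :- u :* v) :* x :+ :- (u :* ((con (+ 1) :- v) :* x))
            := (con (+ 1) :- u) :* x) refl (q ^ j) (q ^ k) x))
        (∣-+ s (∣-neg (∣-*ˡ (q ^ j) t)))

    gcd-closed : ∀ {m n} → Kills m → Kills n → Kills (gcd m n)
    gcd-closed {m = m} {n = n} s t with Bézout.identity (gcd-GCD m n)
    ... | Bézout.+- a b g+bn≡am = kills-difference {gcd m n}
      (kills-resp (≡.sym g+bn≡am) (kills-multiple {m} a s)) (kills-multiple {n} b t)
    ... | Bézout.-+ a b g+am≡bn = kills-difference {gcd m n}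
      (kills-resp (≡.sym g+am≡bn) (kills-multiple {n} b t)) (kills-multiple {m} a s)

  -- For g = gcd(e, k) < e, φ e divides (q^e - 1)/(q^g - 1), which is e/g modulo q^g - 1.
  regular-1-q^ : ∀ {e} → 1 ℕ.≤ e → (∀ d → 1 ℕ.≤ d → d ℕ.≤ e → Good d) →
    ∀ k → ¬ e ℕ.∣ k → Regular (φ e) (1# - q ^ k)
  regular-1-q^ {e} 1≤e good k e∤k {x} φ∣[1-q^k]x = go (gcd[m,n]∣m e k)
    where
    g : ℕ
    g = gcd e k
    open Modulo (1# - q ^ g) using (≋-sym; ∑-powers≋nat)

    φ∣[1-q^e]x : φ e ∣ (1# - q ^ e) * x
    φ∣[1-q^e]x = ∣-*ʳ x (∣ʳ-respʳ-≈ (solve 1 (λ y → :- (y :- con (+ 1)) := con (+ 1) :- y) refl _)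
      (∣-neg (φ∣q^n-1 1≤e (factorizes (good e 1≤e ℕ.≤-refl)))))

    φ∣[1-q^g]x : φ e ∣ (1# - q ^ g) * x
    φ∣[1-q^g]x = gcd-closed {m = e} {n = k} φ∣[1-q^e]x φ∣[1-q^k]x

    go : g ℕ.∣ e → φ e ∣ x
    go (ℕ.divides zero e≡0) = contradiction (≡.subst (1 ℕ.≤_) e≡0 1≤e) λ ()
    go g∣e@(ℕ.divides (suc j) e≡[1+j]g) = regular-nat (good e 1≤e ℕ.≤-refl) j
      (∣ʳ-respʳ-≈ (trans (sym (distribʳ x _ _))
        (*-congʳ (solve 2 (λ a b → a :+ (b :- a) := b) refl G (nat (suc j)))))
        (∣-+ {φ e} {G * x} {(nat (suc j) - G) * x} (∣-*ʳ x φ∣G) φ∣[nat-G]x))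
      where
      1≤g : 1 ℕ.≤ g
      1≤g = ℕ.n≢0⇒n>0 λ g≡0 → contradiction (≡.subst (1 ℕ.≤_) (≡.trans e≡[1+j]g
        (≡.trans (≡.cong (suc j ℕ.*_) g≡0) (ℕ.*-zeroʳ (suc j)))) 1≤e) λ ()

      g≢e : ¬ g ≡ e
      g≢e g≡e = e∤k (≡.subst (ℕ._∣ k) g≡e (gcd[m,n]∣n e k))

      g≤e : g ℕ.≤ e
      g≤e = ≡.subst (g ℕ.≤_) (≡.sym e≡[1+j]g) (ℕ.m≤m+n g (j ℕ.* g))

      G : Carrier
      G = ∑ (suc j) ((q ^ g) ^_)

      [q^g-1]*G≈q^e-1 : (q ^ g - 1#) * G ≈ q ^ e - 1#
      [q^g-1]*G≈q^e-1 = trans (*-comm _ _) (trans (quotient-* (q^g-1∣q^jg-1 g (suc j)))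
        (+-congʳ (^-congʳ q (≡.sym e≡[1+j]g))))

      -- q^g - 1 is the product over the divisors of g, which are divisors of e below e. Hence φ e
      -- (q^g - 1) divides q^e - 1 = (q^g - 1) G.
      φ∣G : φ e ∣ G
      φ∣G = *-cancelˡ-∣ (q^n-1≉0 g 1≤g) (∣ʳ-respʳ-≈
        (trans (factorizes-last 1≤e (factorizes (good e 1≤e ℕ.≤-refl))) (sym [q^g-1]*G≈q^e-1))
        (∣ʳ-respˡ-≈ (*-comm _ _) (∣-*-cong ∣ʳ-refl
          (∣ʳ-respˡ-≈ (factorizes (good g 1≤g g≤e)) (∏φ-mono g∣e (ℕ.∸-monoˡ-≤ 1 (ℕ.≤∧≢⇒< g≤e g≢e)))))))

      1-q^g∣nat-G : 1# - q ^ g ∣ nat (suc j) - G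
      1-q^g∣nat-G = ≋-sym (∑-powers≋nat (suc j) (≋-sym ∣ʳ-refl))

      φ∣[nat-G]x : φ e ∣ (nat (suc j) - G) * x
      φ∣[nat-G]x = ∣ʳ-respʳ-≈ (trans (sym (*-assoc _ _ x)) (*-congʳ (quotient-* 1-q^g∣nat-G)))
        (∣-*ˡ (quotient 1-q^g∣nat-G) φ∣[1-q^g]x)

  -- φ d divides 1 - q^d, which is regular modulo φ e because e cannot divide the smaller d.
  regular-φ : ∀ {d e} → 1 ℕ.≤ d → d ℕ.< e → (∀ d → 1 ℕ.≤ d → d ℕ.≤ e → Good d) → Regular (φ e) (φ d)
  regular-φ {d} {e} 1≤d d<e good = regular-factor (φ e)
    (∣ʳ-respʳ-≈ (solve 1 (λ y → :- (y :- con (+ 1)) := con (+ 1) :- y) refl _)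
      (∣-neg (φ∣q^n-1 1≤d (factorizes (good d 1≤d (ℕ.<⇒≤ d<e))))))
    (regular-1-q^ (ℕ.≤-trans 1≤d (ℕ.<⇒≤ d<e)) good d
      λ e∣d → ℕ.<⇒≱ d<e (ℕ.∣⇒≤ {{ℕ.>-nonZero 1≤d}} e∣d))

  regular-∏φ : ∀ {n e} k → k ℕ.< e → (∀ d → 1 ℕ.≤ d → d ℕ.≤ e → Good d) → Regular (φ e) (∏φ n k)
  regular-∏φ zero    k<e good = Modulo.regular-1 _
  regular-∏φ {n} (suc k) k<e good with suc k ℕ.∣? n
  ... | yes _ = Modulo.regular-* _ (regular-φ (ℕ.s≤s ℕ.z≤n) k<e good) (regular-∏φ k (ℕ.<⇒≤ k<e) good)
  ... | no  _ = regular-∏φ k (ℕ.<⇒≤ k<e) good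

  -- The factors are adjoined one by one: in N = u ∏φ n k the product is regular modulo the next φ,
  -- which therefore divides u.
  ∏φ∣ : ∀ {n N} k → (∀ d → 1 ℕ.≤ d → d ℕ.≤ k → Good d) →
    (∀ d → 1 ℕ.≤ d → d ℕ.≤ k → d ℕ.∣ n → φ d ∣ N) → ∏φ n k ∣ N
  ∏φ∣ zero    good φ∣N = _ , *-identityʳ _
  ∏φ∣ {n} {N} (suc k) good φ∣N with suc k ℕ.∣? n
    | ∏φ∣ {n} {N} k (λ d 1≤d d≤k → good d 1≤d (ℕ.m≤n⇒m≤1+n d≤k)) (λ d 1≤d d≤k → φ∣N d 1≤d (ℕ.m≤n⇒m≤1+n d≤k))
  ... | no  _   | ∏∣N = ∏∣N
  ... | yes k∣n | u , u∏≈N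
    with v , vφ≈u ← regular-∏φ {n} k (ℕ.n<1+n k) good {u}
      (∣ʳ-respʳ-≈ (trans (sym u∏≈N) (*-comm _ _)) (φ∣N (suc k) (ℕ.s≤s ℕ.z≤n) ℕ.≤-refl k∣n))
    = v , trans (sym (*-assoc v _ _)) (trans (*-congʳ vφ≈u) u∏≈N)

  -- Makes the long division defining Φ_(n+1) exact, with information on smaller indices alone.
  ∏φ∣q^n-1 : ∀ n → (∀ d → 1 ℕ.≤ d → d ℕ.≤ n → Good d) → ∏φ (suc n) n ∣ q ^ suc n - 1#
  ∏φ∣q^n-1 n good = ∏φ∣ n good λ d 1≤d d≤n d∣1+n →
    ∣ʳ-trans (φ∣q^n-1 1≤d (factorizes (good d 1≤d d≤n))) (q^d-1∣q^n-1 d∣1+n)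
    where
    q^d-1∣q^n-1 : ∀ {d n} → d ℕ.∣ n → q ^ d - 1# ∣ q ^ n - 1#
    q^d-1∣q^n-1 (ℕ.divides j ≡.refl) = q^g-1∣q^jg-1 _ j

  -- [n] lacks the factor for d = 1. Multiplying both sides by q - 1 restores it, and φ 1 divides q
  -- - 1.
  qint∣ : ∀ {n N} → 1 ℕ.≤ n → (∀ d → 1 ℕ.≤ d → d ℕ.≤ n → Good d) →
    (∀ d → 1 ℕ.< d → d ℕ.∣ n → φ d ∣ N) → ∑ n (q ^_) ∣ N
  qint∣ {n} {N} 1≤n good φ∣N = *-cancelˡ-∣ (q^n-1≉0 1 ℕ.≤-refl)
    (∣ʳ-respˡ-≈ (trans (factorizes (good n 1≤n ℕ.≤-refl)) (sym [q-1]*qint))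
      (∏φ∣ n good φ∣[q-1]N))
    where
    [q-1]*qint : (q ^ 1 - 1#) * ∑ n (q ^_) ≈ q ^ n - 1#
    [q-1]*qint = trans (*-congʳ (+-congʳ (*-identityʳ q)))
      (trans (solve 2 (λ q s → (q :- con (+ 1)) :* s := :- ((con (+ 1) :- q) :* s)) refl q _)
      (trans (-‿cong (geometric q n)) (solve 1 (λ x → :- (con (+ 1) :- x) := x :- con (+ 1)) refl _)))

    φ∣[q-1]N : ∀ d → 1 ℕ.≤ d → d ℕ.≤ n → d ℕ.∣ n → φ d ∣ (q ^ 1 - 1#) * N
    φ∣[q-1]N d 1≤d d≤n d∣n with ℕ.m≤n⇒m<n∨m≡n 1≤d
    ... | inj₁ 1<d    = ∣-*ˡ _ (φ∣N d 1<d d∣n)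
    ... | inj₂ ≡.refl = ∣-*ʳ N (φ∣q^n-1 ℕ.≤-refl (factorizes (good 1 ℕ.≤-refl d≤n)))

  -- One factor φ n is taken out of N. The others still divide the quotient, because φ n is regular
  -- modulo each of them; `regular-φ` gives the opposite direction, hence `regular-sym`.
  qint*φ∣ : ∀ {n N} → 1 ℕ.≤ n → (∀ d → 1 ℕ.≤ d → d ℕ.≤ n → Good d) →
    (∀ d → 1 ℕ.< d → d ℕ.∣ n → φ d ∣ N) → φ n * φ n ∣ N → ∑ n (q ^_) * φ n ∣ N
  qint*φ∣ {n} {N} 1≤n good φ∣N (w , wφ²≈N) = ∣ʳ-respʳ-≈ N′φ≈N (∣-*-cong (qint∣ 1≤n good φ∣N′) ∣ʳ-refl)
    where
    N′ : Carrier
    N′ = w * φ n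
    N′φ≈N : N′ * φ n ≈ N
    N′φ≈N = trans (*-assoc w (φ n) (φ n)) wφ²≈N
    φ∣N′ : ∀ d → 1 ℕ.< d → d ℕ.∣ n → φ d ∣ N′
    φ∣N′ d 1<d d∣n with ℕ.m≤n⇒m<n∨m≡n (ℕ.∣⇒≤ {{ℕ.>-nonZero 1≤n}} d∣n)
    ... | inj₂ ≡.refl = w , refl
    ... | inj₁ d<n    = regular-sym (φ≉0 1≤n (factorizes (good n 1≤n ℕ.≤-refl)))
      (regular-φ (ℕ.<⇒≤ 1<d) d<n good) (∣ʳ-respʳ-≈ (trans (sym N′φ≈N) (*-comm N′ (φ n))) (φ∣N d 1<d d∣n))

-- The polynomial ring

module PolynomialRing where
  open ≡ using (refl; sym; trans; cong; cong₂)
  open ≡.≡-Reasoning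
  open IntegerSolver ℤ.+-*-commutativeRing using (solve; _:=_; _:+_; _:*_)

  coef : Poly → ℕ → ℤ
  coef []      i       = 0ℤ
  coef (a ∷ p) zero    = a
  coef (a ∷ p) (suc i) = coef p i

  infix 4 _≃ₚ_
  -- Read coefficientwise, equality does not see trailing zeros, and the ring laws reduce to laws of
  -- ℤ.
  record _≃ₚ_ (p r : Poly) : Set where
    constructor pointwise
    field coef-≡ : ∀ i → coef p i ≡ coef r i
  open _≃ₚ_ public

  coef-+ : ∀ p r i → coef (p +ₚ r) i ≡ coef p i ℤ.+ coef r i
  coef-+ []      r       i       = sym (ℤ.+-identityˡ _)
  coef-+ (a ∷ p) []      i       = sym (ℤ.+-identityʳ _)
  coef-+ (a ∷ p) (b ∷ r) zero    = refl
  coef-+ (a ∷ p) (b ∷ r) (suc i) = coef-+ p r i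

  coef-neg : ∀ p i → coef (negₚ p) i ≡ ℤ.- coef p i
  coef-neg []      i       = refl
  coef-neg (a ∷ p) zero    = refl
  coef-neg (a ∷ p) (suc i) = coef-neg p i

  coef-scale : ∀ a p i → coef (scaleₚ a p) i ≡ a ℤ.* coef p i
  coef-scale a []      i       = sym (ℤ.*-zeroʳ a)
  coef-scale a (b ∷ p) zero    = refl
  coef-scale a (b ∷ p) (suc i) = coef-scale a p i

  coef-∷-*-zero : ∀ a p r → coef ((a ∷ p) *ₚ r) 0 ≡ a ℤ.* coef r 0
  coef-∷-*-zero a p r = trans (coef-+ (scaleₚ a r) _ 0)
    (trans (ℤ.+-identityʳ _) (coef-scale a r 0))

  coef-∷-*-suc : ∀ a p r i → coef ((a ∷ p) *ₚ r) (suc i) ≡ a ℤ.* coef r (suc i) ℤ.+ coef (p *ₚ r) i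
  coef-∷-*-suc a p r i = trans (coef-+ (scaleₚ a r) _ (suc i))
    (cong (ℤ._+ coef (p *ₚ r) i) (coef-scale a r (suc i)))

  coef-*-[] : ∀ p i → coef (p *ₚ []) i ≡ 0ℤ
  coef-*-[] []      i       = refl
  coef-*-[] (a ∷ p) zero    = refl
  coef-*-[] (a ∷ p) (suc i) = coef-*-[] p i

  coef-*-∷-zero : ∀ p b r → coef (p *ₚ (b ∷ r)) 0 ≡ coef p 0 ℤ.* b
  coef-*-∷-zero []      b r = refl
  coef-*-∷-zero (a ∷ p) b r = coef-∷-*-zero a p (b ∷ r)

  -- Together with the case of index 0, the recursion of `_*ₚ_` in its second argument;
  -- commutativity follows by comparing the two recursions.
  coef-*-∷-suc : ∀ p b r i →
    coef (p *ₚ (b ∷ r)) (suc i) ≡ coef p (suc i) ℤ.* b ℤ.+ coef (p *ₚ r) i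
  coef-*-∷-suc []      b r i = refl
  coef-*-∷-suc (a ∷ p) b r zero = begin
    coef ((a ∷ p) *ₚ (b ∷ r)) 1                      ≡⟨ coef-∷-*-suc a p (b ∷ r) 0 ⟩
    a ℤ.* coef r 0 ℤ.+ coef (p *ₚ (b ∷ r)) 0         ≡⟨ cong (ℤ._+_ (a ℤ.* coef r 0)) (coef-*-∷-zero p b r) ⟩
    a ℤ.* coef r 0 ℤ.+ coef p 0 ℤ.* b                ≡⟨ ℤ.+-comm (a ℤ.* coef r 0) _ ⟩
    coef p 0 ℤ.* b ℤ.+ a ℤ.* coef r 0                ≡⟨ cong (ℤ._+_ (coef p 0 ℤ.* b)) (coef-∷-*-zero a p r) ⟨
    coef p 0 ℤ.* b ℤ.+ coef ((a ∷ p) *ₚ r) 0         ∎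
  coef-*-∷-suc (a ∷ p) b r (suc i) = begin
    coef ((a ∷ p) *ₚ (b ∷ r)) (suc (suc i))
      ≡⟨ coef-∷-*-suc a p (b ∷ r) (suc i) ⟩
    a ℤ.* coef r (suc i) ℤ.+ coef (p *ₚ (b ∷ r)) (suc i)
      ≡⟨ cong (ℤ._+_ (a ℤ.* coef r (suc i))) (coef-*-∷-suc p b r i) ⟩
    a ℤ.* coef r (suc i) ℤ.+ (coef p (suc i) ℤ.* b ℤ.+ coef (p *ₚ r) i)
      ≡⟨ solve 3 (λ x y z → x :+ (y :+ z) := y :+ (x :+ z)) refl
           (a ℤ.* coef r (suc i)) (coef p (suc i) ℤ.* b) (coef (p *ₚ r) i) ⟩
    coef p (suc i) ℤ.* b ℤ.+ (a ℤ.* coef r (suc i) ℤ.+ coef (p *ₚ r) i)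
      ≡⟨ cong (ℤ._+_ (coef p (suc i) ℤ.* b)) (coef-∷-*-suc a p r i) ⟨
    coef p (suc i) ℤ.* b ℤ.+ coef ((a ∷ p) *ₚ r) (suc i) ∎

  *ₚ-comm : ∀ p r i → coef (p *ₚ r) i ≡ coef (r *ₚ p) i
  *ₚ-comm []      r i       = sym (coef-*-[] r i)
  *ₚ-comm (a ∷ p) r zero    = trans (coef-∷-*-zero a p r)
    (trans (ℤ.*-comm a (coef r 0)) (sym (coef-*-∷-zero r a p)))
  *ₚ-comm (a ∷ p) r (suc i) = trans (coef-∷-*-suc a p r i)
    (trans (cong₂ ℤ._+_ (ℤ.*-comm a (coef r (suc i))) (*ₚ-comm p r i)) (sym (coef-*-∷-suc r a p i)))

  *ₚ-congˡ : ∀ p {r s} → r ≃ₚ s → ∀ i → coef (p *ₚ r) i ≡ coef (p *ₚ s) i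
  *ₚ-congˡ []      r≃s i = refl
  *ₚ-congˡ (a ∷ p) {r} {s} r≃s zero = trans (coef-∷-*-zero a p r)
    (trans (cong (a ℤ.*_) (coef-≡ r≃s 0)) (sym (coef-∷-*-zero a p s)))
  *ₚ-congˡ (a ∷ p) {r} {s} r≃s (suc i) = trans (coef-∷-*-suc a p r i)
    (trans (cong₂ ℤ._+_ (cong (a ℤ.*_) (coef-≡ r≃s (suc i))) (*ₚ-congˡ p r≃s i)) (sym (coef-∷-*-suc a p s i)))

  *ₚ-distribˡ : ∀ p r s i → coef (p *ₚ (r +ₚ s)) i ≡ coef (p *ₚ r) i ℤ.+ coef (p *ₚ s) i
  *ₚ-distribˡ []      r s i = refl
  *ₚ-distribˡ (a ∷ p) r s zero = begin
    coef ((a ∷ p) *ₚ (r +ₚ s)) 0              ≡⟨ coef-∷-*-zero a p (r +ₚ s) ⟩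
    a ℤ.* coef (r +ₚ s) 0                     ≡⟨ cong (a ℤ.*_) (coef-+ r s 0) ⟩
    a ℤ.* (coef r 0 ℤ.+ coef s 0)             ≡⟨ ℤ.*-distribˡ-+ a _ _ ⟩
    a ℤ.* coef r 0 ℤ.+ a ℤ.* coef s 0         ≡⟨ cong₂ ℤ._+_ (coef-∷-*-zero a p r) (coef-∷-*-zero a p s) ⟨
    coef ((a ∷ p) *ₚ r) 0 ℤ.+ coef ((a ∷ p) *ₚ s) 0  ∎
  *ₚ-distribˡ (a ∷ p) r s (suc i) = begin
    coef ((a ∷ p) *ₚ (r +ₚ s)) (suc i)        ≡⟨ coef-∷-*-suc a p (r +ₚ s) i ⟩
    a ℤ.* coef (r +ₚ s) (suc i) ℤ.+ coef (p *ₚ (r +ₚ s)) i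
      ≡⟨ cong₂ (λ x y → a ℤ.* x ℤ.+ y) (coef-+ r s (suc i)) (*ₚ-distribˡ p r s i) ⟩
    a ℤ.* (coef r (suc i) ℤ.+ coef s (suc i)) ℤ.+ (coef (p *ₚ r) i ℤ.+ coef (p *ₚ s) i)
      ≡⟨ solve 5 (λ a x y z w → a :* (x :+ y) :+ (z :+ w) := (a :* x :+ z) :+ (a :* y :+ w)) refl
           a (coef r (suc i)) (coef s (suc i)) (coef (p *ₚ r) i) (coef (p *ₚ s) i) ⟩
    (a ℤ.* coef r (suc i) ℤ.+ coef (p *ₚ r) i) ℤ.+ (a ℤ.* coef s (suc i) ℤ.+ coef (p *ₚ s) i)
      ≡⟨ cong₂ ℤ._+_ (coef-∷-*-suc a p r i) (coef-∷-*-suc a p s i) ⟨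
    coef ((a ∷ p) *ₚ r) (suc i) ℤ.+ coef ((a ∷ p) *ₚ s) (suc i) ∎

  *ₚ-distribʳ : ∀ p r s i → coef ((r +ₚ s) *ₚ p) i ≡ coef (r *ₚ p) i ℤ.+ coef (s *ₚ p) i
  *ₚ-distribʳ p r s i = trans (*ₚ-comm (r +ₚ s) p i)
    (trans (*ₚ-distribˡ p r s i) (cong₂ ℤ._+_ (*ₚ-comm p r i) (*ₚ-comm p s i)))

  scale-*ₚ : ∀ a p r i → coef (scaleₚ a p *ₚ r) i ≡ a ℤ.* coef (p *ₚ r) i
  scale-*ₚ a []      r i = sym (ℤ.*-zeroʳ a)
  scale-*ₚ a (b ∷ p) r zero = trans (coef-∷-*-zero (a ℤ.* b) (scaleₚ a p) r)
    (trans (ℤ.*-assoc a b _) (cong (ℤ._*_ a) (sym (coef-∷-*-zero b p r))))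
  scale-*ₚ a (b ∷ p) r (suc i) = begin
    coef (scaleₚ a (b ∷ p) *ₚ r) (suc i)                      ≡⟨ coef-∷-*-suc (a ℤ.* b) (scaleₚ a p) r i ⟩
    a ℤ.* b ℤ.* coef r (suc i) ℤ.+ coef (scaleₚ a p *ₚ r) i
      ≡⟨ cong (ℤ._+_ (a ℤ.* b ℤ.* coef r (suc i))) (scale-*ₚ a p r i) ⟩
    a ℤ.* b ℤ.* coef r (suc i) ℤ.+ a ℤ.* coef (p *ₚ r) i
      ≡⟨ solve 4 (λ a b x y → a :* b :* x :+ a :* y := a :* (b :* x :+ y)) refl
           a b (coef r (suc i)) (coef (p *ₚ r) i) ⟩
    a ℤ.* (b ℤ.* coef r (suc i) ℤ.+ coef (p *ₚ r) i)          ≡⟨ cong (a ℤ.*_) (coef-∷-*-suc b p r i) ⟨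
    a ℤ.* coef ((b ∷ p) *ₚ r) (suc i)                         ∎

  *ₚ-assoc : ∀ p r s i → coef ((p *ₚ r) *ₚ s) i ≡ coef (p *ₚ (r *ₚ s)) i
  *ₚ-assoc []      r s i = refl
  *ₚ-assoc (a ∷ p) r s zero = begin
    coef ((scaleₚ a r +ₚ (0ℤ ∷ (p *ₚ r))) *ₚ s) 0     ≡⟨ *ₚ-distribʳ s (scaleₚ a r) _ 0 ⟩
    coef (scaleₚ a r *ₚ s) 0 ℤ.+ coef ((0ℤ ∷ (p *ₚ r)) *ₚ s) 0
      ≡⟨ cong₂ ℤ._+_ (scale-*ₚ a r s 0) (coef-∷-*-zero 0ℤ (p *ₚ r) s) ⟩
    a ℤ.* coef (r *ₚ s) 0 ℤ.+ 0ℤ                      ≡⟨ ℤ.+-identityʳ _ ⟩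
    a ℤ.* coef (r *ₚ s) 0                             ≡⟨ coef-∷-*-zero a p (r *ₚ s) ⟨
    coef ((a ∷ p) *ₚ (r *ₚ s)) 0                      ∎
  *ₚ-assoc (a ∷ p) r s (suc i) = begin
    coef ((scaleₚ a r +ₚ (0ℤ ∷ (p *ₚ r))) *ₚ s) (suc i)   ≡⟨ *ₚ-distribʳ s (scaleₚ a r) _ (suc i) ⟩
    coef (scaleₚ a r *ₚ s) (suc i) ℤ.+ coef ((0ℤ ∷ (p *ₚ r)) *ₚ s) (suc i)
      ≡⟨ cong₂ ℤ._+_ (scale-*ₚ a r s (suc i)) (coef-∷-*-suc 0ℤ (p *ₚ r) s i) ⟩
    a ℤ.* coef (r *ₚ s) (suc i) ℤ.+ (0ℤ ℤ.+ coef ((p *ₚ r) *ₚ s) i)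
      ≡⟨ cong (ℤ._+_ (a ℤ.* coef (r *ₚ s) (suc i))) (trans (ℤ.+-identityˡ _) (*ₚ-assoc p r s i)) ⟩
    a ℤ.* coef (r *ₚ s) (suc i) ℤ.+ coef (p *ₚ (r *ₚ s)) i  ≡⟨ coef-∷-*-suc a p (r *ₚ s) i ⟨
    coef ((a ∷ p) *ₚ (r *ₚ s)) (suc i)                    ∎

  *ₚ-identityˡ : ∀ p i → coef (oneₚ *ₚ p) i ≡ coef p i
  *ₚ-identityˡ p zero    = trans (coef-∷-*-zero 1ℤ [] p) (ℤ.*-identityˡ _)
  *ₚ-identityˡ p (suc i) = trans (coef-∷-*-suc 1ℤ [] p i) (trans (ℤ.+-identityʳ _) (ℤ.*-identityˡ _))

  ≃ₚ-isCommutativeRing : IsCommutativeRing _≃ₚ_ _+ₚ_ _*ₚ_ negₚ [] oneₚ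
  ≃ₚ-isCommutativeRing = record
    { isRing = record
      { +-isAbelianGroup = record
        { isGroup = record
          { isMonoid = record
            { isSemigroup = record
              { isMagma = record
                { isEquivalence = record
                  { refl  = pointwise λ _ → refl
                  ; sym   = λ e → pointwise λ i → sym (coef-≡ e i)
                  ; trans = λ e f → pointwise λ i → trans (coef-≡ e i) (coef-≡ f i)
                  }
                ; ∙-cong = λ {p} {p′} {r} {r′} e f → pointwise λ i →
                    trans (coef-+ p r i) (trans (cong₂ ℤ._+_ (coef-≡ e i) (coef-≡ f i)) (sym (coef-+ p′ r′ i)))
                }
              ; assoc = λ p r s → pointwise λ i → begin
                  coef ((p +ₚ r) +ₚ s) i                  ≡⟨ coef-+ (p +ₚ r) s i ⟩
                  coef (p +ₚ r) i ℤ.+ coef s i            ≡⟨ cong (ℤ._+ coef s i) (coef-+ p r i) ⟩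
                  coef p i ℤ.+ coef r i ℤ.+ coef s i      ≡⟨ ℤ.+-assoc (coef p i) _ _ ⟩
                  coef p i ℤ.+ (coef r i ℤ.+ coef s i)    ≡⟨ cong (ℤ._+_ (coef p i)) (coef-+ r s i) ⟨
                  coef p i ℤ.+ coef (r +ₚ s) i            ≡⟨ coef-+ p (r +ₚ s) i ⟨
                  coef (p +ₚ (r +ₚ s)) i                  ∎
              }
            ; identity = (λ p → pointwise λ _ → refl)
                       , (λ p → pointwise λ i → trans (coef-+ p [] i) (ℤ.+-identityʳ _))
            }
          ; inverse = (λ p → pointwise λ i → trans (coef-+ (negₚ p) p i)
                        (trans (cong (ℤ._+ coef p i) (coef-neg p i)) (ℤ.+-inverseˡ (coef p i))))
                    , (λ p → pointwise λ i → trans (coef-+ p (negₚ p) i)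
                        (trans (cong (ℤ._+_ (coef p i)) (coef-neg p i)) (ℤ.+-inverseʳ (coef p i))))
          ; ⁻¹-cong = λ {p} {r} e → pointwise λ i →
              trans (coef-neg p i) (trans (cong ℤ.-_ (coef-≡ e i)) (sym (coef-neg r i)))
          }
        ; comm = λ p r → pointwise λ i →
            trans (coef-+ p r i) (trans (ℤ.+-comm (coef p i) _) (sym (coef-+ r p i)))
        }
      ; *-cong = λ {p} {p′} {r} {r′} e f → pointwise λ i →
          trans (*ₚ-congˡ p f i) (trans (*ₚ-comm p r′ i) (trans (*ₚ-congˡ r′ e i) (*ₚ-comm r′ p′ i)))
      ; *-assoc = λ p r s → pointwise (*ₚ-assoc p r s)
      ; *-identity = (λ p → pointwise (*ₚ-identityˡ p))
                   , (λ p → pointwise λ i → trans (*ₚ-comm p oneₚ i) (*ₚ-identityˡ p i))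
      ; distrib = (λ p r s → pointwise λ i → trans (*ₚ-distribˡ p r s i) (sym (coef-+ (p *ₚ r) _ i)))
                , (λ p r s → pointwise λ i → trans (*ₚ-distribʳ p r s i) (sym (coef-+ (r *ₚ p) _ i)))
      }
    ; *-comm = λ p r → pointwise (*ₚ-comm p r)
    }

  polynomialRing : CommutativeRing 0ℓ 0ℓ
  polynomialRing = record { isCommutativeRing = ≃ₚ-isCommutativeRing }

  -- The lowest non-zero coefficients of p and r multiply to a coefficient of the product.
  no-zero-divisors : ∀ p r → p *ₚ r ≃ₚ [] → ¬ p ≃ₚ [] → r ≃ₚ []
  no-zero-divisors []      r e p≄0 = contradiction (pointwise λ _ → refl) p≄0
  no-zero-divisors (a ∷ p) r e p≄0 with a ℤ.≟ 0ℤ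
  ... | yes refl = no-zero-divisors p r
    (pointwise λ i → trans (sym (trans (coef-∷-*-suc 0ℤ p r i) (ℤ.+-identityˡ _))) (coef-≡ e (suc i)))
    (λ p≃0 → p≄0 (pointwise λ { zero → refl ; (suc i) → coef-≡ p≃0 i }))
  ... | no a≢0 = strip r e
    where
    strip : ∀ r → (a ∷ p) *ₚ r ≃ₚ [] → r ≃ₚ []
    strip []      e = pointwise λ _ → refl
    strip (b ∷ r) e with ℤ.i*j≡0⇒i≡0∨j≡0 a (trans (sym (coef-∷-*-zero a p (b ∷ r))) (coef-≡ e 0))
    ... | inj₁ a≡0  = contradiction a≡0 a≢0
    ... | inj₂ refl = pointwise λ { zero → refl ; (suc i) → coef-≡ r≃0 i }
      where
      r≃0 : r ≃ₚ []
      r≃0 = strip r (pointwise λ i → trans (sym (trans (coef-*-∷-suc (a ∷ p) 0ℤ r i)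
        (trans (cong (ℤ._+ coef ((a ∷ p) *ₚ r) i) (ℤ.*-zeroʳ (coef (a ∷ p) (suc i)))) (ℤ.+-identityˡ _))))
        (coef-≡ e (suc i)))

  polynomialDomain : IntegralDomain 0ℓ 0ℓ
  polynomialDomain = record
    { commutativeRing  = polynomialRing
    ; 1≉0              = λ e → contradiction (coef-≡ e 0) λ ()
    ; x*y≈0∧x≉0⇒y≈0 = λ {p} {r} → no-zero-divisors p r
    }

  -- Opaque, because q = 0 ∷ 1 ∷ [] would let every product with a power of q unfold.
  abstract
    indeterminate : Indeterminate polynomialDomain
    indeterminate = record
      { q         = qpow 1
      ; q≉0       = λ e → contradiction (coef-≡ e 1) λ ()
      ; 1-q^1+k≉0 = λ k e → contradiction (trans (sym (coef₀ k)) (coef-≡ e 0)) λ ()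
      }
      where
      open Exp (CommutativeRing.semiring polynomialRing) using (_^_)
      coef₀ : ∀ k → coef (oneₚ -ₚ qpow 1 ^ suc k) 0 ≡ 1ℤ
      coef₀ k = trans (coef-+ oneₚ (negₚ (qpow 1 ^ suc k)) 0)
        (cong (ℤ._+_ 1ℤ) (trans (coef-neg (qpow 1 ^ suc k) 0)
          (cong ℤ.-_ (coef-∷-*-zero 0ℤ oneₚ (qpow 1 ^ k)))))

    q≃qpow-1 : Indeterminate.q indeterminate ≃ₚ qpow 1
    q≃qpow-1 = pointwise λ _ → refl

  isZero⇒≃ : ∀ p → IsZeroₚ p → p ≃ₚ []
  isZero⇒≃ []      []          = pointwise λ _ → refl
  isZero⇒≃ (a ∷ p) (a≡0 ∷ p≡0) = pointwise λ { zero → a≡0 ; (suc i) → coef-≡ (isZero⇒≃ p p≡0) i }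

  ≃⇒isZero : ∀ p → p ≃ₚ [] → IsZeroₚ p
  ≃⇒isZero []      e = []
  ≃⇒isZero (a ∷ p) e = coef-≡ e 0 ∷ ≃⇒isZero p (pointwise λ i → coef-≡ e (suc i))

  ≈ₚ⇒≃ₚ : ∀ {p r} → p ≈ₚ r → p ≃ₚ r
  ≈ₚ⇒≃ₚ p≈r = Divisibility.x-y≈0⇒x≈y polynomialDomain (isZero⇒≃ _ p≈r)

  ≃ₚ⇒≈ₚ : ∀ {p r} → p ≃ₚ r → p ≈ₚ r
  ≃ₚ⇒≈ₚ p≃r = ≃⇒isZero _ (Divisibility.x≈y⇒x-y≈0 polynomialDomain p≃r)

-- Long division and the polynomials Φ

-- The helpers of Defs are private. Each one is recovered as the solution of a metavariable, in the
-- …-eq clause below it: abstracting the surrounding function (such as a partially applied foldl)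
-- leaves the private function in a position where unification can read it off. Not all helpers are
-- accessible at once: step n a as bs is divHF n (subPrefix a bs as) bs, and aux n c a bs as xs is
-- divHF n (c ∷ subPrefix a bs as) xs.
module PrivateDefs where
  open ≡ using (refl)

  mutual
    step : ℕ → ℤ → List ℤ → List ℤ → List ℤ
    step = _

    step-eq : ∀ ps ms a n as bs → reverse ps ≡ as → reverse ms ≡ bs → length as ≡ n →
      ¬ a ≡ 0ℤ → length bs ≤ length as →
      divMonicₚ (ps ++ a ∷ []) (ms ++ 1ℤ ∷ []) ≡ reverse (a ∷ step n a as bs)
    step-eq ps ms a n as bs eq₁ eq₂ eq₃ a≢0 l
      rewrite List.reverse-++ ms (1ℤ ∷ []) | eq₂ | List.reverse-++ ps (a ∷ []) | eq₁
      with a ℤ.≟ 0ℤ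
    ... | yes a≡0 = contradiction a≡0 a≢0
    ... | no  _ with length bs ℕ.≤? length as
    ...   | no ¬l = contradiction l ¬l
    ...   | yes _ rewrite eq₃ with foldl {A = List ℤ} {B = ℤ} (λ y x → x ∷ y) (a ∷ [])
    ...     | w = refl

  mutual
    aux : ℕ → ℤ → ℤ → List ℤ → List ℤ → List ℤ → List ℤ
    aux = _

    aux-eq : ∀ n a x as b bs →
      step n a (x ∷ as) (b ∷ bs) ≡ aux n (x ℤ.- a ℤ.* b) a bs as (b ∷ bs)
    aux-eq n a x as b bs with x ℤ.- a ℤ.* b | b ∷ bs
    ... | c | B = refl

  mutual
    subPrefix : ℤ → List ℤ → List ℤ → List ℤ
    subPrefix = _

    subPrefix-eq : ∀ n c a bs as xs → aux n c a bs as xs ≡ aux n c 0ℤ [] (subPrefix a bs as) xs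
    subPrefix-eq n c a bs as xs = refl

  mutual
    divHF : ℕ → List ℤ → List ℤ → List ℤ
    divHF = _

    divHF-eq : ∀ n a as bs → step n a as bs ≡ divHF n (subPrefix a bs as) bs
    divHF-eq n a as bs with subPrefix a bs as
    ... | V = refl

  divHF-yes : ∀ n a as bs → length bs ≤ length as → divHF (suc n) (a ∷ as) bs ≡ a ∷ divHF n (subPrefix a bs as) bs
  divHF-yes n a as bs l with length bs ℕ.≤? length as
  ... | yes _ = refl
  ... | no ¬l = contradiction l ¬l

  divHF-no : ∀ n a as bs → ¬ length bs ≤ length as → divHF (suc n) (a ∷ as) bs ≡ []
  divHF-no n a as bs ¬l with length bs ℕ.≤? length as
  ... | yes l = contradiction l ¬l
  ... | no _ = refl

  divMonic-eq : ∀ ps ms a → ¬ a ≡ 0ℤ → divMonicₚ (ps ++ a ∷ []) (ms ++ 1ℤ ∷ []) ≡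
    reverse (divHF (suc (length (reverse ps))) (a ∷ reverse ps) (reverse ms))
  divMonic-eq ps ms a a≢0 rewrite List.reverse-++ ms (1ℤ ∷ []) | List.reverse-++ ps (a ∷ []) with a ℤ.≟ 0ℤ
  ... | yes a≡0 = contradiction a≡0 a≢0
  ... | no  _   = refl

  nextΦ : ℕ → List Poly → Poly
  nextΦ m prev = divMonicₚ (qpow m -ₚ oneₚ) (foldr _*ₚ_ oneₚ
    (map proj₂ (filter (λ dp → proj₁ dp ℕ.∣? m) (zip (map suc (upTo (length prev))) prev))))

  mutual
    cycs : ℕ → List Poly
    cycs = _

    cycs-eq : ∀ m → Φ (suc m) ≡ nextΦ (suc m) (cycs m)
    cycs-eq m with foldr {A = Poly} {B = Poly} _*ₚ_ oneₚ | map {A = ℕ × Poly} proj₂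
      | filter {A = ℕ × Poly} (λ dp → proj₁ dp ℕ.∣? suc m) | zipWith {A = ℕ} {B = Poly} {C = ℕ × Poly} _,_
    ... | w | x | y | z = refl

  cycs-suc : ∀ m → cycs (suc m) ≡ cycs m ++ Φ (suc m) ∷ []
  cycs-suc m = refl

module PolynomialDivision where
  open PolynomialRing
  open PrivateDefs
  open IntegralDomain polynomialDomain hiding (_+_; _*_; _-_; -_)
  open IntegralDomain polynomialDomain using () renaming (_+_ to _⊕_; _*_ to _⊗_; _-_ to _⊖_)
  open IntegerSolver polynomialRing
  open Divisibility polynomialDomain
  open Exp semiring using (_^_; ^-homo-*; ^-congʳ)

  open Indeterminate indeterminate using () renaming (q to X)

  const : ℤ → Poly
  const a = a ∷ []

  const-* : ∀ a b → const (a ℤ.* b) ≈ const a ⊗ const b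
  const-* a b = pointwise λ { zero → ≡.sym (ℤ.+-identityʳ _) ; (suc i) → ≡.refl }

  const-sub : ∀ a b → const (a ℤ.- b) ≈ const a ⊖ const b
  const-sub a b = pointwise λ { zero → ≡.refl ; (suc i) → ≡.refl }

  ∷-≈ : ∀ a p → a ∷ p ≈ const a ⊕ X ⊗ p
  ∷-≈ a p = trans (pointwise λ
    { zero    → ≡.sym (≡.trans (coef-+ (const a) (qpow 1 ⊗ p) 0)
        (≡.trans (≡.cong (ℤ._+_ a) (coef-∷-*-zero 0ℤ oneₚ p)) (ℤ.+-identityʳ a)))
    ; (suc i) → ≡.sym (≡.trans (coef-+ (const a) (qpow 1 ⊗ p) (suc i)) (≡.trans (ℤ.+-identityˡ _)
        (≡.trans (coef-∷-*-suc 0ℤ oneₚ p i) (≡.trans (ℤ.+-identityˡ _) (*ₚ-identityˡ p i))))) })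
    (+-congˡ {const a} (*-congʳ {p} (sym q≃qpow-1)))

  coef-beyond : ∀ p {i} → length p ℕ.≤ i → coef p i ≡ 0ℤ
  coef-beyond []      _           = ≡.refl
  coef-beyond (a ∷ p) (ℕ.s≤s p≤i) = coef-beyond p p≤i

  -- A degree bound read off the coefficients, as the length of a list may exceed the degree.
  VanishesFrom : ℕ → Poly → Set
  VanishesFrom k p = ∀ i → k ℕ.≤ i → coef p i ≡ 0ℤ

  coef-*-top : ∀ p r k n → VanishesFrom (suc k) p → VanishesFrom (suc n) r →
    coef (p *ₚ r) (k ℕ.+ n) ≡ coef p k ℤ.* coef r n
  coef-*-top []      r k       n p≡0 r≡0 = ≡.refl
  coef-*-top (a ∷ p) r zero    zero    p≡0 r≡0 = coef-∷-*-zero a p r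
  coef-*-top (a ∷ p) r zero    (suc n) p≡0 r≡0 = ≡.trans (coef-∷-*-suc a p r n)
    (≡.trans (≡.cong (ℤ._+_ (a ℤ.* coef r (suc n))) p*r≡0) (ℤ.+-identityʳ _))
    where
    p*r≡0 : coef (p *ₚ r) n ≡ 0ℤ
    p*r≡0 = coef-≡ (trans (*-congʳ {r} {p} {[]} (pointwise λ i → p≡0 (suc i) (ℕ.s≤s ℕ.z≤n))) (zeroˡ r)) n
  coef-*-top (a ∷ p) r (suc k) n p≡0 r≡0 = ≡.trans (coef-∷-*-suc a p r (k ℕ.+ n))
    (≡.trans (≡.cong₂ ℤ._+_
        (≡.trans (≡.cong (ℤ._*_ a) (r≡0 _ (ℕ.s≤s (ℕ.m≤n+m n k)))) (ℤ.*-zeroʳ a))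
        (coef-*-top p r k n (λ i k<i → p≡0 (suc i) (ℕ.s≤s k<i)) r≡0))
      (ℤ.+-identityˡ _))

  -- Uniqueness of division by a monic polynomial of degree k: the coefficient of w at n equals that
  -- of m w at k + n, where r vanishes. The degree bound of w thus descends to 0.
  vanishing-quotient : ∀ {m r} k → VanishesFrom (suc k) m → coef m k ≡ 1ℤ → VanishesFrom k r →
    ∀ n w → VanishesFrom n w → m ⊗ w ≈ r → w ≈ []
  vanishing-quotient k m≡0 mₖ≡1 r≡0 zero    w w≡0 mw≈r = pointwise λ i → w≡0 i ℕ.z≤n
  vanishing-quotient {m} {r} k m≡0 mₖ≡1 r≡0 (suc n) w w≡0 mw≈r =
    vanishing-quotient {m} {r} k m≡0 mₖ≡1 r≡0 n w w≡0′ mw≈r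
    where
    wₙ≡0 : coef w n ≡ 0ℤ
    wₙ≡0 = ≡.trans (≡.sym (ℤ.*-identityˡ _)) (≡.trans (≡.cong (ℤ._* coef w n) (≡.sym mₖ≡1))
      (≡.trans (≡.sym (coef-*-top m w k n m≡0 w≡0)) (≡.trans (coef-≡ mw≈r (k ℕ.+ n)) (r≡0 _ (ℕ.m≤m+n k n)))))
    w≡0′ : VanishesFrom n w
    w≡0′ i n≤i with ℕ.m≤n⇒m<n∨m≡n n≤i
    ... | inj₁ n<i    = w≡0 i n<i
    ... | inj₂ ≡.refl = wₙ≡0

  fromHigh : List ℤ → Poly
  fromHigh []       = []
  fromHigh (a ∷ as) = const a ⊗ X ^ length as ⊕ fromHigh as

  snoc-≈ : ∀ p a → p ++ a ∷ [] ≈ const a ⊗ X ^ length p ⊕ p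
  snoc-≈ []      a = sym (trans (+-identityʳ _) (*-identityʳ _))
  snoc-≈ (b ∷ p) a = trans (∷-≈ b (p ++ a ∷ [])) (trans (+-congˡ {const b} (*-congˡ {X} (snoc-≈ p a)))
    (trans (solve 5 (λ b x a y p → b :+ x :* (a :* y :+ p) := a :* (x :* y) :+ (b :+ x :* p)) refl
        (const b) X (const a) (X ^ length p) p)
      (+-congˡ {const a ⊗ X ^ suc (length p)} (sym (∷-≈ b p)))))

  reverse-≈ : ∀ as → reverse as ≈ fromHigh as
  reverse-≈ []       = refl
  reverse-≈ (a ∷ as) = trans (reflexive (List.unfold-reverse a as)) (trans (snoc-≈ (reverse as) a)
    (+-cong (*-congˡ {const a} (^-congʳ X (List.length-reverse as))) (reverse-≈ as)))

  subPrefix-length : ∀ c bs as → length bs ℕ.≤ length as → length (subPrefix c bs as) ≡ length as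
  subPrefix-length c []       as       _           = ≡.refl
  subPrefix-length c (b ∷ bs) (a ∷ as) (ℕ.s≤s b≤a) = ≡.cong suc (subPrefix-length c bs as b≤a)

  -- The lists are aligned at their leading entries, which shifts `bs` by the difference of the
  -- lengths.
  subPrefix-≈ : ∀ c bs as → length bs ℕ.≤ length as →
    fromHigh as ≈ const c ⊗ X ^ (length as ℕ.∸ length bs) ⊗ fromHigh bs ⊕ fromHigh (subPrefix c bs as)
  subPrefix-≈ c []       as       _ =
    sym (trans (+-congʳ {fromHigh as} (zeroʳ (const c ⊗ X ^ length as))) (+-identityˡ _))
  subPrefix-≈ c (b ∷ bs) (a ∷ as) (ℕ.s≤s b≤a) = trans (+-congˡ {const a ⊗ X ^ length as} (subPrefix-≈ c bs as b≤a))
    (sym (begin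
      const c ⊗ X ^ k ⊗ (const b ⊗ X ^ length bs ⊕ fromHigh bs)
        ⊕ (const (a ℤ.- c ℤ.* b) ⊗ X ^ length s ⊕ fromHigh s)
        ≈⟨ +-congˡ {const c ⊗ X ^ k ⊗ (const b ⊗ X ^ length bs ⊕ fromHigh bs)} (+-congʳ {fromHigh s} (*-cong
             (trans (const-sub a (c ℤ.* b)) (+-congˡ {const a} (-‿cong (const-* c b))))
             (trans (^-congʳ X (≡.trans (subPrefix-length c bs as b≤a) (≡.sym (ℕ.m∸n+n≡m b≤a))))
               (^-homo-* X k (length bs))))) ⟩
      const c ⊗ X ^ k ⊗ (const b ⊗ X ^ length bs ⊕ fromHigh bs)
        ⊕ ((const a ⊖ const c ⊗ const b) ⊗ (X ^ k ⊗ X ^ length bs) ⊕ fromHigh s)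
        ≈⟨ solve 7 (λ a b c x y p s → c :* x :* (b :* y :+ p) :+ ((a :- c :* b) :* (x :* y) :+ s)
             := a :* (x :* y) :+ (c :* x :* p :+ s)) refl
             (const a) (const b) (const c) (X ^ k) (X ^ length bs) (fromHigh bs) (fromHigh s) ⟩
      const a ⊗ (X ^ k ⊗ X ^ length bs) ⊕ (const c ⊗ X ^ k ⊗ fromHigh bs ⊕ fromHigh s)
        ≈⟨ +-congʳ {const c ⊗ X ^ k ⊗ fromHigh bs ⊕ fromHigh s} (*-congˡ {const a} (trans
             (sym (^-homo-* X k (length bs))) (^-congʳ X (ℕ.m∸n+n≡m b≤a)))) ⟩
      const a ⊗ X ^ length as ⊕ (const c ⊗ X ^ k ⊗ fromHigh bs ⊕ fromHigh s) ∎))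
    where
    open import Relation.Binary.Reasoning.Setoid setoid
    k : ℕ
    k = length as ℕ.∸ length bs
    s : List ℤ
    s = subPrefix c bs as

  -- `fromHigh` reads the exponent of a leading coefficient off the length of the rest, so this
  -- length fixes the quotient term.
  divHF-length : ∀ n as bs → length as ℕ.≤ n → length (divHF n as bs) ≡ length as ℕ.∸ length bs
  divHF-length zero    []       bs _ = ≡.sym (ℕ.0∸n≡0 (length bs))
  divHF-length (suc n) []       bs _ = ≡.sym (ℕ.0∸n≡0 (length bs))
  divHF-length (suc n) (a ∷ as) bs (ℕ.s≤s a≤n) with length bs ℕ.≤? length as
  ... | no b≰a  = ≡.sym (ℕ.m≤n⇒m∸n≡0 (ℕ.≰⇒> b≰a))
  ... | yes b≤a = ≡.trans
      (≡.cong suc (≡.trans (divHF-length n (subPrefix a bs as) bs (≡.subst (ℕ._≤ n) (≡.sym s≡) a≤n))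
        (≡.cong (ℕ._∸ length bs) s≡)))
      (≡.sym (ℕ.+-∸-assoc 1 b≤a))
    where
    s≡ : length (subPrefix a bs as) ≡ length as
    s≡ = subPrefix-length a bs as b≤a

  -- `bs` is the divisor without its leading 1; a remainder no longer than `bs` therefore has
  -- smaller degree than the divisor.
  divHF-remainder : ∀ n as bs → length as ℕ.≤ n → ∃ λ rs → length rs ℕ.≤ length bs ×
    fromHigh as ≈ fromHigh (1ℤ ∷ bs) ⊗ fromHigh (divHF n as bs) ⊕ fromHigh rs
  divHF-remainder zero    []       bs _ = [] , ℕ.z≤n , sym (trans (+-identityʳ _) (zeroʳ (fromHigh (1ℤ ∷ bs))))
  divHF-remainder (suc n) []       bs _ = [] , ℕ.z≤n , sym (trans (+-identityʳ _) (zeroʳ (fromHigh (1ℤ ∷ bs))))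
  divHF-remainder (suc n) (a ∷ as) bs (ℕ.s≤s a≤n) with length bs ℕ.≤? length as
  ... | no b≰a  = a ∷ as , ℕ.≰⇒> b≰a , sym (trans
    (+-congʳ {fromHigh (a ∷ as)} (zeroʳ (fromHigh (1ℤ ∷ bs))))
    (+-identityˡ _))
  ... | yes b≤a with rs , rs≤ , s≈ ← divHF-remainder n (subPrefix a bs as) bs
                  (≡.subst (ℕ._≤ n) (≡.sym (subPrefix-length a bs as b≤a)) a≤n) = rs , rs≤ , (begin
    const a ⊗ X ^ length as ⊕ fromHigh as
      ≈⟨ +-cong (*-congˡ {const a} (trans (^-congʳ X (≡.sym (ℕ.m∸n+n≡m b≤a))) (^-homo-* X k (length bs))))
           (trans (subPrefix-≈ a bs as b≤a) (+-congˡ {const a ⊗ X ^ k ⊗ fromHigh bs} s≈)) ⟩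
    const a ⊗ (X ^ k ⊗ X ^ length bs) ⊕ (const a ⊗ X ^ k ⊗ fromHigh bs ⊕
      ((oneₚ ⊗ X ^ length bs ⊕ fromHigh bs) ⊗ fromHigh d ⊕ fromHigh rs))
      ≈⟨ solve 6 (λ a x y b d r → a :* (x :* y) :+ (a :* x :* b :+ ((con (+ 1) :* y :+ b) :* d :+ r))
           := (con (+ 1) :* y :+ b) :* (a :* x :+ d) :+ r) refl
           (const a) (X ^ k) (X ^ length bs) (fromHigh bs) (fromHigh d) (fromHigh rs) ⟩
    (oneₚ ⊗ X ^ length bs ⊕ fromHigh bs) ⊗ (const a ⊗ X ^ k ⊕ fromHigh d) ⊕ fromHigh rs
      ≈⟨ +-congʳ {fromHigh rs} (*-congˡ {fromHigh (1ℤ ∷ bs)}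
           (+-congʳ {fromHigh d} (*-congˡ {const a} (^-congʳ X (≡.sym d-length))))) ⟩
    fromHigh (1ℤ ∷ bs) ⊗ fromHigh (a ∷ d) ⊕ fromHigh rs ∎)
    where
    open import Relation.Binary.Reasoning.Setoid setoid
    k : ℕ
    k = length as ℕ.∸ length bs
    d : List ℤ
    d = divHF n (subPrefix a bs as) bs
    d-length : length d ≡ k
    d-length = ≡.trans (divHF-length n (subPrefix a bs as) bs (≡.subst (ℕ._≤ n) (≡.sym (subPrefix-length a bs as b≤a)) a≤n))
      (≡.cong (ℕ._∸ length bs) (subPrefix-length a bs as b≤a))

  -- A condition on the list itself: with 1 as its last entry there are no trailing zeros for
  -- `divMonicₚ` to strip.
  Monic : Poly → Set
  Monic p = ∃ λ ps → p ≡ ps ++ 1ℤ ∷ []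

  coef-snoc : ∀ ps a → coef (ps ++ a ∷ []) (length ps) ≡ a
  coef-snoc []       a = ≡.refl
  coef-snoc (b ∷ ps) a = coef-snoc ps a

  length-snoc : ∀ (ps : Poly) a → length (ps ++ a ∷ []) ≡ suc (length ps)
  length-snoc ps a = ≡.trans (List.length-++ ps) (ℕ.+-comm (length ps) 1)

  snoc-vanishes : ∀ ps a → VanishesFrom (suc (length ps)) (ps ++ a ∷ [])
  snoc-vanishes ps a i l = coef-beyond (ps ++ a ∷ []) (ℕ.≤-trans (ℕ.≤-reflexive (length-snoc ps a)) l)

  snoc-view : ∀ p n → length p ≡ suc n → ∃ λ ps → p ≡ ps ++ coef p n ∷ []
  snoc-view (a ∷ [])    zero    _ = [] , ≡.refl
  snoc-view (a ∷ b ∷ p) (suc n) l with ps , eq ← snoc-view (b ∷ p) n (ℕ.suc-injective l) =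
    a ∷ ps , ≡.cong (a ∷_) eq

  monic≉0 : ∀ {p} → Monic p → ¬ p ≈ []
  monic≉0 (ps , ≡.refl) p≈0 = contradiction (≡.trans (≡.sym (coef-snoc ps 1ℤ)) (coef-≡ p≈0 (length ps))) λ ()

  length-+ₚ : ∀ p r → length (p +ₚ r) ≡ length p ℕ.⊔ length r
  length-+ₚ []      r       = ≡.refl
  length-+ₚ (a ∷ p) []      = ≡.refl
  length-+ₚ (a ∷ p) (b ∷ r) = ≡.cong suc (length-+ₚ p r)

  length-*ₚ : ∀ a p r n → length r ≡ suc n → length ((a ∷ p) *ₚ r) ≡ suc (length p ℕ.+ n)
  length-*ₚ a []      r n l = ≡.trans (length-+ₚ (scaleₚ a r) _)
    (≡.trans (≡.cong (ℕ._⊔ 1) (≡.trans (List.length-map (a ℤ.*_) r) l)) (≡.cong suc (ℕ.⊔-identityʳ n)))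
  length-*ₚ a (b ∷ p) r n l = ≡.trans (length-+ₚ (scaleₚ a r) _)
    (≡.trans (≡.cong₂ ℕ._⊔_ (≡.trans (List.length-map (a ℤ.*_) r) l) (≡.cong suc (length-*ₚ b p r n l)))
      (≡.cong suc (ℕ.m≤n⇒m⊔n≡n (ℕ.m≤n⇒m≤1+n (ℕ.m≤n+m n (length p))))))

  -- The length of the product list is computed exactly, because the list has to end at the leading
  -- coefficient.
  monic-* : ∀ {p r} → Monic p → Monic r → Monic (p *ₚ r)
  monic-* (ps , ≡.refl) (rs , ≡.refl) with snoc-view (p *ₚ r) (length ps ℕ.+ length rs) (length-p*r ps)
    where
    p r : Poly
    p = ps ++ 1ℤ ∷ []
    r = rs ++ 1ℤ ∷ []
    length-p*r : ∀ ps → length ((ps ++ 1ℤ ∷ []) *ₚ r) ≡ suc (length ps ℕ.+ length rs)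
    length-p*r []       = length-*ₚ 1ℤ [] r (length rs) (length-snoc rs 1ℤ)
    length-p*r (a ∷ ps) = ≡.trans (length-*ₚ a (ps ++ 1ℤ ∷ []) r (length rs) (length-snoc rs 1ℤ))
      (≡.cong (λ k → suc (k ℕ.+ length rs)) (length-snoc ps 1ℤ))
  ... | qs , eq = qs , ≡.trans eq (≡.cong (λ a → qs ++ a ∷ [])
    (≡.trans (coef-*-top (ps ++ 1ℤ ∷ []) (rs ++ 1ℤ ∷ []) (length ps) (length rs)
        (snoc-vanishes ps 1ℤ) (snoc-vanishes rs 1ℤ))
      (≡.cong₂ ℤ._*_ (coef-snoc ps 1ℤ) (coef-snoc rs 1ℤ))))

  -- Subtracting m d from p = m u shows that m (u - d) is the remainder, whose degree is too small
  -- unless u = d.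
  divMonic-exact : ∀ {p m u} → Monic p → Monic m → p ≈ m ⊗ u →
    divMonicₚ p m ≈ u × Monic (divMonicₚ p m)
  divMonic-exact {u = u} (ps , ≡.refl) (ms , ≡.refl) p≈mu
    rewrite divMonic-eq ps ms 1ℤ (λ ()) = trans (reverse-≈ d) d≈u , monic
    where
    as bs d : List ℤ
    as = reverse ps
    bs = reverse ms
    d  = divHF (suc (length as)) (1ℤ ∷ as) bs

    fromHigh-reverse : ∀ xs → fromHigh (1ℤ ∷ reverse xs) ≈ xs ++ 1ℤ ∷ []
    fromHigh-reverse xs = trans (sym (reverse-≈ (1ℤ ∷ reverse xs)))
      (reflexive (≡.trans (List.unfold-reverse 1ℤ (reverse xs))
        (≡.cong (_++ 1ℤ ∷ []) (List.reverse-involutive xs))))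

    d≈u : fromHigh d ≈ u
    d≈u with rs , rs≤ , p≈ ← divHF-remainder (suc (length as)) (1ℤ ∷ as) bs ℕ.≤-refl =
      sym (x-y≈0⇒x≈y (vanishing-quotient {ms ++ 1ℤ ∷ []} {reverse rs} (length ms)
        (snoc-vanishes ms 1ℤ) (coef-snoc ms 1ℤ)
        (λ i l → coef-beyond (reverse rs) (ℕ.≤-trans (ℕ.≤-reflexive (List.length-reverse rs))
          (ℕ.≤-trans rs≤ (ℕ.≤-trans (ℕ.≤-reflexive (List.length-reverse ms)) l))))
        (length w) w (λ i → coef-beyond w) (begin
          M ⊗ w                              ≈⟨ distribˡ M u (negₚ (fromHigh d)) ⟩
          M ⊗ u ⊕ M ⊗ negₚ (fromHigh d)      ≈⟨ +-congʳ {M ⊗ negₚ (fromHigh d)} (trans (sym p≈mu)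
                                                  (trans (sym (fromHigh-reverse ps)) (trans p≈
                                                    (+-congʳ {fromHigh rs}
                                                      (*-congʳ {fromHigh d} (fromHigh-reverse ms)))))) ⟩
          (M ⊗ fromHigh d ⊕ fromHigh rs) ⊕ M ⊗ negₚ (fromHigh d)
            ≈⟨ solve 3 (λ m d r → (m :* d :+ r) :+ m :* :- d := r) refl M (fromHigh d) (fromHigh rs) ⟩
          fromHigh rs                        ≈⟨ reverse-≈ rs ⟨
          reverse rs                         ∎)))
      where
      open import Relation.Binary.Reasoning.Setoid setoid
      M w : Poly
      M = ms ++ 1ℤ ∷ []
      w = u ⊖ fromHigh d

    monic-if : Dec (length bs ℕ.≤ length as) → Monic (reverse d)
    monic-if (yes b≤a) = reverse d′ ,
      ≡.trans (≡.cong reverse (divHF-yes (length as) 1ℤ as bs b≤a)) (List.unfold-reverse 1ℤ d′)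
      where
      d′ : List ℤ
      d′ = divHF (length as) (subPrefix 1ℤ bs as) bs
    -- A dividend shorter than the divisor has the empty quotient, so that u and with it the monic
    -- dividend would be zero.
    monic-if (no b≰a)  = contradiction
      (trans p≈mu (trans (*-congˡ {ms ++ 1ℤ ∷ []} u≈0) (zeroʳ (ms ++ 1ℤ ∷ [])))) (monic≉0 (ps , ≡.refl))
      where
      u≈0 : u ≈ []
      u≈0 = trans (sym d≈u) (reflexive (≡.cong fromHigh (divHF-no (length as) 1ℤ as bs b≰a)))

    monic : Monic (reverse d)
    monic = monic-if (length bs ℕ.≤? length as)

-- Factorization of q^n - 1 and regularity of integers modulo Φ_n

module CyclotomicPolynomials where
  open PolynomialRing
  open PrivateDefs using (cycs; cycs-eq; cycs-suc)
  open PolynomialDivision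
  open Indeterminate indeterminate using () renaming (q to X)
  open IntegralDomain polynomialDomain hiding (_+_; _*_; _-_; -_)
  open IntegralDomain polynomialDomain using () renaming (_*_ to _⊗_; _-_ to _⊖_)
  open IntegerSolver polynomialRing
  open FiniteSums polynomialRing
  open Divisibility polynomialDomain
  open Modulo using (Regular)
  open Exp semiring using (_^_)
  open CyclotomicFactors polynomialDomain indeterminate Φ

  X^≈qpow : ∀ k → X ^ k ≈ qpow k
  X^≈qpow zero    = refl
  X^≈qpow (suc k) = sym (trans (∷-≈ 0ℤ (qpow k)) (trans
    (+-congʳ {X ⊗ qpow k} {const 0ℤ} {[]} (pointwise λ { zero → ≡.refl ; (suc i) → ≡.refl }))
    (*-congˡ {X} (sym (X^≈qpow k)))))

  X^-1≈qpow-1 : ∀ n → X ^ n ⊖ oneₚ ≈ qpow n -ₚ oneₚ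
  X^-1≈qpow-1 n = +-congʳ {negₚ oneₚ} (X^≈qpow n)

  monic-qpow-1 : ∀ n → Monic (qpow (suc n) -ₚ oneₚ)
  monic-qpow-1 n = -[1+ 0 ] ∷ replicate n 0ℤ , ≡.cong (-[1+ 0 ] ∷_) (+ₚ-identityʳ (qpow n))
    where
    +ₚ-identityʳ : ∀ p → p +ₚ [] ≡ p
    +ₚ-identityʳ []      = ≡.refl
    +ₚ-identityʳ (a ∷ p) = ≡.refl

  indexed : ℕ → List (ℕ × Poly)
  indexed k = zip (map suc (upTo (length (cycs k)))) (cycs k)

  divisors : ℕ → ℕ → List Poly
  divisors n k = map proj₂ (filter (λ dp → proj₁ dp ℕ.∣? n) (indexed k))

  length-cycs : ∀ k → length (cycs k) ≡ k
  length-cycs zero    = ≡.refl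
  length-cycs (suc k) = ≡.trans (≡.cong length (cycs-suc k))
    (≡.trans (List.length-++ (cycs k)) (≡.trans (ℕ.+-comm _ 1) (≡.cong suc (length-cycs k))))

  zip-snoc : ∀ {A B : Set} (xs : List A) (ys : List B) {x y} → length xs ≡ length ys →
    zip (xs ++ x ∷ []) (ys ++ y ∷ []) ≡ zip xs ys ++ (x , y) ∷ []
  zip-snoc []       []       _ = ≡.refl
  zip-snoc (x ∷ xs) (y ∷ ys) l = ≡.cong (_ ∷_) (zip-snoc xs ys (ℕ.suc-injective l))

  indexed-suc : ∀ k → indexed (suc k) ≡ indexed k ++ (suc k , Φ (suc k)) ∷ []
  indexed-suc k = begin
    zip (map suc (upTo (length (cycs (suc k))))) (cycs (suc k))
      ≡⟨ ≡.cong₂ (λ l c → zip (map suc (upTo l)) c) (length-cycs (suc k)) (cycs-suc k) ⟩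
    zip (map suc (upTo (suc k))) (cycs k ++ Φ (suc k) ∷ [])
      ≡⟨ ≡.cong (λ l → zip l (cycs k ++ Φ (suc k) ∷ []))
           (≡.trans (≡.cong (map suc) (≡.sym (List.upTo-∷ʳ k))) (List.map-++ suc (upTo k) (k ∷ []))) ⟩
    zip (map suc (upTo k) ++ suc k ∷ []) (cycs k ++ Φ (suc k) ∷ [])
      ≡⟨ zip-snoc (map suc (upTo k)) (cycs k)
           (≡.trans (List.length-map suc (upTo k)) (≡.trans (List.length-upTo k) (≡.sym (length-cycs k)))) ⟩
    zip (map suc (upTo k)) (cycs k) ++ (suc k , Φ (suc k)) ∷ []
      ≡⟨ ≡.cong (λ l → zip (map suc (upTo l)) (cycs k) ++ (suc k , Φ (suc k)) ∷ []) (length-cycs k) ⟨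
    indexed k ++ (suc k , Φ (suc k)) ∷ [] ∎
    where open ≡.≡-Reasoning

  prodₗ : List Poly → Poly
  prodₗ = foldr _*ₚ_ oneₚ

  prodₗ-snoc : ∀ ps p → prodₗ (ps ++ p ∷ []) ≈ p ⊗ prodₗ ps
  prodₗ-snoc []       p = refl
  prodₗ-snoc (r ∷ ps) p = trans (*-congˡ {r} (prodₗ-snoc ps p))
    (solve 3 (λ r p s → r :* (p :* s) := p :* (r :* s)) refl r p (prodₗ ps))

  divisors-suc : ∀ n k → divisors n (suc k) ≡
    divisors n k ++ map proj₂ (filter (λ dp → proj₁ dp ℕ.∣? n) ((suc k , Φ (suc k)) ∷ []))
  divisors-suc n k = ≡.trans (≡.cong (λ l → map proj₂ (filter P? l)) (indexed-suc k))
    (≡.trans (≡.cong (map proj₂) (List.filter-++ P? (indexed k) _))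
      (List.map-++ proj₂ (filter P? (indexed k)) _))
    where
    P? = λ (dp : ℕ × Poly) → proj₁ dp ℕ.∣? n

  prod-divisors : ∀ n k → prodₗ (divisors n k) ≈ ∏φ n k
  prod-divisors n zero    = refl
  prod-divisors n (suc k) = trans (reflexive (≡.cong prodₗ (divisors-suc n k))) (last (suc k ℕ.∣? n))
    where
    new : List (ℕ × Poly)
    new = (suc k , Φ (suc k)) ∷ []
    with-new : List (ℕ × Poly) → Poly
    with-new l = prodₗ (divisors n k ++ map proj₂ l)
    last : Dec (suc k ℕ.∣ n) → with-new (filter (λ dp → proj₁ dp ℕ.∣? n) new) ≈ ∏φ n (suc k)
    last (yes k∣n) = trans (reflexive (≡.cong with-new (List.filter-accept (λ dp → proj₁ dp ℕ.∣? n) k∣n)))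
      (trans (prodₗ-snoc (divisors n k) (Φ (suc k)))
        (trans (*-congˡ {Φ (suc k)} (prod-divisors n k)) (sym (∏φ-suc {n} {k} k∣n))))
    last (no k∤n)  = trans (reflexive (≡.cong with-new (List.filter-reject (λ dp → proj₁ dp ℕ.∣? n) k∤n)))
      (trans (reflexive (≡.cong prodₗ (List.++-identityʳ (divisors n k))))
        (trans (prod-divisors n k) (sym (∏φ-skip {n} {k} k∤n))))

  monic-prodₗ : ∀ {ps} → All Monic ps → Monic (prodₗ ps)
  monic-prodₗ []       = [] , ≡.refl
  monic-prodₗ (m ∷ ms) = monic-* m (monic-prodₗ ms)

  monic-indexed : ∀ k → (∀ d → 1 ≤ d → d ≤ k → Monic (Φ d)) → All (λ dp → Monic (proj₂ dp)) (indexed k)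
  monic-indexed zero    monic = []
  monic-indexed (suc k) monic = ≡.subst (All _) (≡.sym (indexed-suc k))
    (All.++⁺ (monic-indexed k λ d 1≤d d≤k → monic d 1≤d (ℕ.m≤n⇒m≤1+n d≤k))
      (monic (suc k) (ℕ.s≤s ℕ.z≤n) ℕ.≤-refl ∷ []))

  monic-prod-divisors : ∀ n k → (∀ d → 1 ≤ d → d ≤ k → Monic (Φ d)) → Monic (prodₗ (divisors n k))
  monic-prod-divisors n k monic = monic-prodₗ (All.map⁺ (All.filter⁺ _ (monic-indexed k monic)))

  coef₀-* : ∀ p r → coef (p *ₚ r) 0 ≡ coef p 0 ℤ.* coef r 0
  coef₀-* []      r = ≡.refl
  coef₀-* (a ∷ p) r = coef-∷-*-zero a p r

  -- Since P has an invertible constant term, y is divided by c from the lowest degree upwards.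
  divide-content : ∀ P c u → u ℤ.* coef P 0 ≡ 1ℤ → ∀ y f → (∀ i → coef (P *ₚ y) i ≡ c ℤ.* f i) →
    ∃ λ z → ∀ i → coef y i ≡ c ℤ.* coef z i
  divide-content P c u uP₀≡1 []      f eq = [] , λ _ → ≡.sym (ℤ.*-zeroʳ c)
  divide-content P c u uP₀≡1 (b ∷ y) f eq = z₀ ∷ proj₁ rest , λ { zero → b≡cz₀ ; (suc i) → proj₂ rest i }
    where
    open ≡.≡-Reasoning
    module S = IntegerSolver ℤ.+-*-commutativeRing
    z₀ : ℤ
    z₀ = u ℤ.* f 0
    b≡cz₀ : b ≡ c ℤ.* z₀
    b≡cz₀ = begin
      b                           ≡⟨ ℤ.*-identityˡ b ⟨
      1ℤ ℤ.* b                    ≡⟨ ≡.cong (ℤ._* b) uP₀≡1 ⟨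
      u ℤ.* coef P 0 ℤ.* b        ≡⟨ ℤ.*-assoc u (coef P 0) b ⟩
      u ℤ.* (coef P 0 ℤ.* b)      ≡⟨ ≡.cong (ℤ._*_ u) (≡.trans (≡.sym (coef₀-* P (b ∷ y))) (eq 0)) ⟩
      u ℤ.* (c ℤ.* f 0)           ≡⟨ S.solve 3 (λ u c f → u S.:* (c S.:* f) S.:= c S.:* (u S.:* f))
                                       ≡.refl u c (f 0) ⟩
      c ℤ.* z₀                    ∎
    rest : ∃ λ z → ∀ i → coef y i ≡ c ℤ.* coef z i
    rest = divide-content P c u uP₀≡1 y (λ i → f (suc i) ℤ.- coef P (suc i) ℤ.* z₀) λ i → begin
      coef (P *ₚ y) i
        ≡⟨ S.solve 2 (λ x w → w S.:= (x S.:+ w) S.:- x) ≡.refl (coef P (suc i) ℤ.* b) (coef (P *ₚ y) i) ⟩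
      (coef P (suc i) ℤ.* b ℤ.+ coef (P *ₚ y) i) ℤ.- coef P (suc i) ℤ.* b
        ≡⟨ ≡.cong₂ (λ x b → x ℤ.- coef P (suc i) ℤ.* b)
             (≡.trans (≡.sym (coef-*-∷-suc P b y i)) (eq (suc i))) b≡cz₀ ⟩
      c ℤ.* f (suc i) ℤ.- coef P (suc i) ℤ.* (c ℤ.* z₀)
        ≡⟨ S.solve 4 (λ c f p z → c S.:* f S.:- p S.:* (c S.:* z) S.:= c S.:* (f S.:- p S.:* z))
             ≡.refl c (f (suc i)) (coef P (suc i)) z₀ ⟩
      c ℤ.* (f (suc i) ℤ.- coef P (suc i) ℤ.* z₀) ∎

  nat≈const : ∀ n → nat n ≈ const (+ n)
  nat≈const zero    = pointwise λ { zero → ≡.refl ; (suc i) → ≡.refl }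
  nat≈const (suc n) = trans (nat-suc n) (+-congˡ {oneₚ} (nat≈const n))

  const≉0 : ∀ k → ¬ const (+ suc k) ≈ []
  const≉0 k e = contradiction (coef-≡ e 0) λ ()

  coef-const-* : ∀ c p i → coef (const c *ₚ p) i ≡ c ℤ.* coef p i
  coef-const-* c p zero    = coef-∷-*-zero c [] p
  coef-const-* c p (suc i) = ≡.trans (coef-∷-*-suc c [] p i) (ℤ.+-identityʳ _)

  -- From y P = (k + 1) x it follows that k + 1 divides every coefficient of y; cancelling it leaves
  -- P as a divisor of x.
  unit⇒regular-nat : ∀ P u → u ℤ.* coef P 0 ≡ 1ℤ → ∀ k → Regular P (nat (suc k))
  unit⇒regular-nat P u uP₀≡1 k {x} (y , yP≈nx) with z , y≡cz ← divide-content P (+ suc k) u uP₀≡1 y (coef x)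
      (λ i → ≡.trans (*ₚ-comm P y i) (≡.trans (coef-≡ (trans yP≈nx (*-congʳ {x} (nat≈const (suc k)))) i)
        (coef-const-* (+ suc k) x i)))
    = z , *-cancelˡ-≉0 (const≉0 k) (trans (sym (*-assoc (const (+ suc k)) z P))
        (trans (*-congʳ {P} {const (+ suc k) ⊗ z} {y}
          (sym (pointwise λ i → ≡.trans (y≡cz i) (≡.sym (coef-const-* (+ suc k) z i)))))
          (trans yP≈nx (*-congʳ {x} (nat≈const (suc k))))))

  -- At q = 0 the factorization of q^n - 1 reads Φ_n(0) w = -1, so the inverse is -w.
  factorizes⇒unit : ∀ {n} → 1 ≤ n → Factorizes n → ∃ λ u → u ℤ.* coef (Φ n) 0 ≡ 1ℤ
  factorizes⇒unit {suc n} 1≤n f = ℤ.- w , (begin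
    ℤ.- w ℤ.* coef (Φ (suc n)) 0
      ≡⟨ S.solve 2 (λ w x → S.:- w S.:* x S.:= S.:- (x S.:* w)) ≡.refl w (coef (Φ (suc n)) 0) ⟩
    ℤ.- (coef (Φ (suc n)) 0 ℤ.* w)     ≡⟨ ≡.cong ℤ.-_ (≡.trans (≡.sym (coef₀-* (Φ (suc n)) (∏φ (suc n) n)))
                                            (coef-≡ (trans (factorizes-last {suc n} 1≤n f) (X^-1≈qpow-1 (suc n))) 0)) ⟩
    1ℤ ∎)
    where
    open ≡.≡-Reasoning
    module S = IntegerSolver ℤ.+-*-commutativeRing
    w : ℤ
    w = coef (∏φ (suc n) n) 0

  record GoodΦ (n : ℕ) : Set where
    field
      good  : Good n
      monic : Monic (Φ n)
  open GoodΦ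

  -- Goodness of the smaller indices makes the division exact; exactness gives the factorization,
  -- this the unit constant term, and the latter the regularity of integers.
  Φ-good-step : ∀ n → (∀ d → 1 ≤ d → d ≤ n → GoodΦ d) → GoodΦ (suc n)
  Φ-good-step n IH = record
    { good  = record
      { factorizes  = fac
      ; regular-nat = unit⇒regular-nat (Φ (suc n)) (proj₁ unit) (proj₂ unit)
      }
    ; monic = ≡.subst Monic (≡.sym (cycs-eq n)) (proj₂ exact)
    }
    where
    dividend divisor : Poly
    dividend = qpow (suc n) -ₚ oneₚ
    divisor = prodₗ (divisors (suc n) n)

    ∏∣ : ∏φ (suc n) n ∣ X ^ suc n ⊖ oneₚ
    ∏∣ = ∏φ∣q^n-1 n λ d 1≤d d≤n → good (IH d 1≤d d≤n)

    exact : divMonicₚ dividend divisor ≈ quotient ∏∣ × Monic (divMonicₚ dividend divisor)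
    exact = divMonic-exact (monic-qpow-1 n)
      (monic-prod-divisors (suc n) n λ d 1≤d d≤n → monic (IH d 1≤d d≤n))
      (trans (sym (X^-1≈qpow-1 (suc n))) (trans (sym (quotient-* ∏∣))
        (trans (*-comm (quotient ∏∣) (∏φ (suc n) n)) (*-congʳ {quotient ∏∣} (sym (prod-divisors (suc n) n))))))

    fac : Factorizes (suc n)
    fac = trans (∏φ-suc {suc n} {n} ℕ.∣-refl) (trans (*-congʳ {∏φ (suc n) n}
      (trans (reflexive (cycs-eq n)) (proj₁ exact))) (quotient-* ∏∣))

    unit : ∃ λ u → u ℤ.* coef (Φ (suc n)) 0 ≡ 1ℤ
    unit = factorizes⇒unit {suc n} (ℕ.s≤s ℕ.z≤n) fac

  Φ-good : ∀ n d → 1 ≤ d → d ≤ n → GoodΦ d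
  Φ-good zero    zero    () _
  Φ-good (suc n) d 1≤d d≤1+n with ℕ.m≤n⇒m<n∨m≡n d≤1+n
  ... | inj₁ (ℕ.s≤s d≤n) = Φ-good n d 1≤d d≤n
  ... | inj₂ ≡.refl      = Φ-good-step n (Φ-good n)

-- Transfer to the stated fractions and congruences

module Assembly where
  open PolynomialRing
  open PolynomialDivision
  open CyclotomicPolynomials
  open Indeterminate indeterminate using () renaming (q to X)
  open IntegralDomain polynomialDomain hiding (_+_; _*_; _-_; -_)
  open IntegralDomain polynomialDomain using () renaming (_+_ to _⊕_; _*_ to _⊗_; _-_ to _⊖_)
  open IntegerSolver polynomialRing
  open FiniteSums polynomialRing
  open Divisibility polynomialDomain
  open FractionField polynomialDomain
  open FractionDivisibility polynomialDomain
  open JacksonSum polynomialDomain indeterminate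
  open Congruences polynomialDomain indeterminate using (CyclotomicModulus)
  open CyclotomicCongruences polynomialDomain indeterminate
  open FiniteSums fractionField using () renaming (∑ to ∑ᶠ)
  open CyclotomicFactors polynomialDomain indeterminate Φ
  open GoodΦ

  good-Φ : ∀ n d → 1 ≤ d → d ≤ n → Good d
  good-Φ n d 1≤d d≤n = good (Φ-good n d 1≤d d≤n)

  ∑-first : ∀ x n → ∑ (suc n) (x ^_) ≈ oneₚ ⊕ x ⊗ ∑ n (x ^_)
  ∑-first x zero    = solve 1 (λ x → con (+ 0) :+ con (+ 1) := con (+ 1) :+ x :* con (+ 0)) refl x
  ∑-first x (suc n) = trans (+-congʳ {x ^ suc n} (∑-first x n))
    (solve 3 (λ x s y → con (+ 1) :+ x :* s :+ x :* y := con (+ 1) :+ x :* (s :+ y))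
      refl x (∑ n (x ^_)) (x ^ n))

  qint≈∑ : ∀ n → qint n ≈ ∑ n (X ^_)
  qint≈∑ zero    = refl
  qint≈∑ (suc n) = trans (∷-≈ 1ℤ (qint n)) (trans (+-congˡ {oneₚ} (*-congˡ {X} (qint≈∑ n)))
    (sym (∑-first X n)))

  poch≈∏ : ∀ a k → poch a 3 k ≈ ∏ k (λ i → oneₚ ⊖ X ^ a ⊗ p ^ i)
  poch≈∏ a zero    = refl
  poch≈∏ a (suc k) = *-cong (poch≈∏ a k) (+-congˡ {oneₚ} (-‿cong
    (trans (sym (X^≈qpow (a ℕ.+ 3 ℕ.* k))) (sym (q^*p^ a k)))))

  poch≈U : ∀ k → poch 1 3 k ≈ U k
  poch≈U k = trans (poch≈∏ 1 k) (∏-cong k λ i _ → +-congˡ {oneₚ} (-‿cong (*-congʳ {p ^ i} (*-identityʳ X))))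

  num-term : ∀ k → proj₁ (term k) ≈ num (t k)
  num-term k = *-cong (*-cong (qint≈∑ (6 ℕ.* k ℕ.+ 1)) (^-congˡ 6 (poch≈U k)))
    (trans (sym (X^≈qpow (3 ℕ.* k))) (sym (p^≈q^ k)))

  den-term : ∀ k → proj₂ (term k) ≈ den (t k)
  den-term k = ^-congˡ 6 (poch≈∏ 3 k)

  -- Both sums add fractions by the same formula without reducing, so that numerators and
  -- denominators agree separately.
  sumTo≈ : ∀ n → proj₁ (sumTo n) ≈ num (∑ᶠ n t) × proj₂ (sumTo n) ≈ den (∑ᶠ n t)
  sumTo≈ zero    = refl , refl
  sumTo≈ (suc n) =
      +-cong (*-cong (proj₁ (sumTo≈ n)) (den-term n)) (*-cong (num-term n) (proj₂ (sumTo≈ n)))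
    , *-cong (proj₂ (sumTo≈ n)) (den-term n)

  cyclotomicModulus : ∀ {n} d → 1 ℕ.< d → d ℕ.∣ n → Coprime n 3 → CyclotomicModulus d (Φ d)
  cyclotomicModulus d 1<d d∣n coprime-3 = record
    { 1<d          = 1<d
    ; coprime-3    = λ (i∣d , i∣3) → coprime-3 (ℕ.∣-trans i∣d d∣n , i∣3)
    ; P≉0          = φ≉0 1≤d (Good.factorizes (good-Φ d d 1≤d ℕ.≤-refl))
    ; P∣1-q^d      = ∣ʳ-respʳ-≈ (solve 1 (λ y → :- (y :- con (+ 1)) := con (+ 1) :- y) refl (X ^ d))
        (∣-neg (φ∣q^n-1 1≤d (Good.factorizes (good-Φ d d 1≤d ℕ.≤-refl))))
    ; regular-1-q^ = λ k → regular-1-q^ 1≤d (good-Φ d) k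
    ; regular-nat  = Good.regular-nat (good-Φ d d 1≤d ℕ.≤-refl)
    }
    where
    1≤d : 1 ≤ d
    1≤d = ℕ.<⇒≤ 1<d

  module _ {n : ℕ} (1≤n : 1 ≤ n) (coprime-3 : Coprime n 3) {N D : Poly}
    (eq : (proj₁ (S n -F zeroF) *ₚ D) ≈ₚ (N *ₚ proj₂ (S n -F zeroF))) where

    num*D≈N*den : num (∑ᶠ n t) ⊗ D ≈ N ⊗ den (∑ᶠ n t)
    num*D≈N*den = begin
      num (∑ᶠ n t) ⊗ D               ≈⟨ *-congʳ {D} (proj₁ (sumTo≈ n)) ⟨
      proj₁ (sumTo n) ⊗ D            ≈⟨ *-congʳ {D} (trans (+-identityʳ (proj₁ (sumTo n) ⊗ oneₚ))
                                           (*-identityʳ (proj₁ (sumTo n)))) ⟨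
      proj₁ (S n -F zeroF) ⊗ D       ≈⟨ ≈ₚ⇒≃ₚ eq ⟩
      N ⊗ (proj₂ (sumTo n) ⊗ oneₚ)   ≈⟨ *-congˡ {N} (trans (*-identityʳ (proj₂ (sumTo n))) (proj₂ (sumTo≈ n))) ⟩
      N ⊗ den (∑ᶠ n t)               ∎
      where open import Relation.Binary.Reasoning.Setoid setoid

    Φ∣N : ∀ d → 1 ℕ.< d → d ℕ.∣ n → Φ d ∣ N
    Φ∣N d 1<d d∣n@(ℕ.divides L n≡Ld) = ∣ᶠ⇒∣ {x = ∑ᶠ n t} {N} {D}
      (≡.subst (λ k → Φ d ∣ᶠ ∑ᶠ k t) (≡.sym n≡Ld) (P∣∑t (cyclotomicModulus d 1<d d∣n coprime-3) L))
      num*D≈N*den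

    qint∣N : qint n ∣ N
    qint∣N = ∣ʳ-respˡ-≈ {_} {∑ n (X ^_)} {qint n} (sym (qint≈∑ n)) (qint∣ {n} {N} 1≤n (good-Φ n) Φ∣N)

    Φ²∣N : n % 3 ≡ 2 → Φ n ⊗ Φ n ∣ N
    Φ²∣N n%3≡2 = ∣ᶠ⇒∣ {x = ∑ᶠ n t} {N} {D}
      (P²∣∑t (cyclotomicModulus n 1<n ℕ.∣-refl coprime-3) n%3≡2) num*D≈N*den
      where
      1<n : 1 ℕ.< n
      1<n = ℕ.≤∧≢⇒< 1≤n λ 1≡n → contradiction (≡.subst (λ k → k % 3 ≡ 2) (≡.sym 1≡n) n%3≡2) λ ()

    qint*Φ∣N : n % 3 ≡ 2 → qint n ⊗ Φ n ∣ N
    qint*Φ∣N n%3≡2 = ∣ʳ-respˡ-≈ {_} {∑ n (X ^_) ⊗ Φ n} {qint n ⊗ Φ n} (*-congʳ {Φ n} (sym (qint≈∑ n)))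
      (qint*φ∣ {n} {N} 1≤n (good-Φ n) Φ∣N (Φ²∣N n%3≡2))

  ∣⇒∣ₚ : ∀ {P N} → P ∣ N → P ∣ₚ N
  ∣⇒∣ₚ {P} {N} (u , uP≈N) = u , ≃ₚ⇒≈ₚ {N} {P *ₚ u} (trans (sym uP≈N) (*-comm u P))

open Assembly

theorem2p3 : (n : ℕ) → 1 ≤ n → Coprime n 3 →
    ((n % 3 ≡ 1 → S n ≡F zeroF mod qint n) ×
    (n % 3 ≡ 2 → S n ≡F zeroF mod (qint n *ₚ Φ n)))
theorem2p3 n 1≤n coprime-3 =
    (λ _ N D _ _ eq → ∣⇒∣ₚ (qint∣N 1≤n coprime-3 {N} {D} eq))
  , (λ n%3≡2 N D _ _ eq → ∣⇒∣ₚ (qint*Φ∣N 1≤n coprime-3 {N} {D} eq n%3≡2))
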